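{- The following statements are equivalent: (1) the Four Colour Theorem is true; (2) for every connected, loopless plane graph $G$, $(-1)^{v(G)}R(G^{\times};-2,-3,1/3)<0$; (3) for every connected, loopless plane graph $G$, $(-1)^{v(G)}R(G^{\times};-3,-4,1/4)<0$; (4) for every connected, loopless plane graph $G$, $R(G^{\times};3,2,-1/2)\neq 0$.
   Context: The Four Colour Theorem is the statement that every loopless plane graph has a proper vertex colouring with at most four colours. An embedded graph is a graph (loops and multiple edges allowed) cellularly embedded in a closed, possibly non-orientable, surface, i.e. each face is an open disc. Equivalently, it is a ribbon graph: a surface with boundary written as a union of vertex discs and edge discs (ribbons), each edge disc meeting the vertex discs in exactly two disjoint arcs. A plane graph is a connected embedded graph of Euler genus $0$ (embedded in the sphere). $v(G)=|V(G)|$, $c(G)$ is the number of connected components, $r(G)=v(G)-c(G)$, $n(G)=|E(G)|-r(G)$, and $f(G)$ is the number of boundary components of the ribbon graph. For $A\subseteq E(G)$, $c(A),r(A),n(A),f(A)$ refer to the spanning ribbon subgraph $(V(G),A)$. The Petrie dual $G^{\times}$ is the ribbon graph obtained from $G$ by adding a half-twist to every edge. Ribbon graph (Bollobás–Riordan) polynomial: $R(G;x,y,z)=\sum_{A\subseteq E(G)}(x-1)^{r(G)-r(A)}y^{n(A)}z^{c(A)-f(A)+n(A)}$. -}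

module Defs where

import Algebra.Definitions.RawSemiring
open import Data.Bool.Base using (Bool; true; false; not; if_then_else_)
import Data.Bool.Properties as Bool
open import Data.Fin.Base using (Fin)
import Data.Fin.Properties as Fin
open import Data.Fin.Subset using (Subset; inside; outside; ∣_∣; ⊤)
open import Data.Integer.Base as ℤ using (ℤ; +_; -[1+_])
open import Data.List.Base
  using (List; []; _∷_; _++_; map; concatMap; cartesianProduct; allFin; filter; length; deduplicate)
open import Data.List.Membership.Propositional using (_∈_)
import Data.List.Membership.DecPropositional as DecMembership
open import Data.List.Relation.Unary.Any using (here; there)
open import Data.Nat.Base as ℕ using (ℕ; zero; suc)
open import Data.Product.Base using (∃; _×_; _,_)
open import Data.Product.Properties using (≡-dec)
open import Data.Rational as ℚ using (ℚ; 0ℚ; 1ℚ; _+_; _*_; _-_; 1/_; ≢-nonZero)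
open import Data.Rational.Base using (+-*-rawSemiring)
open import Data.Sum.Base using (_⊎_; inj₁; inj₂)
open import Data.Vec.Base using ([]; _∷_; lookup)
open import Function.Base using (_∘_)
open import Function.Bundles using (_⇔_; _↔_; Inverse)
open import Relation.Binary.Construct.Closure.Equivalence as EqC using (EqClosure)
open import Relation.Binary.Construct.Closure.ReflexiveTransitive using (ε; _◅_; _◅◅_)
open import Relation.Binary.Construct.Closure.Symmetric using (fwd; bwd)
open import Relation.Binary.Definitions using (Decidable; DecidableEquality)
open import Relation.Binary.PropositionalEquality using (_≡_; _≢_; refl)
open import Relation.Nullary.Decidable using (yes; no; map′; ¬?; _×-dec_; _⊎-dec_)

module _ {A : Set} where

  Linked : List (A × A) → A → A → Set
  Linked es = EqClosure (λ x y → (x , y) ∈ es)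

  private
    weaken : ∀ {e es a b} → Linked es a b → Linked (e ∷ es) a b
    weaken = EqC.map there

    Via : A → A → List (A × A) → A → A → Set
    Via x y es a b =
      Linked es a b ⊎ (Linked es a x × Linked es y b) ⊎ (Linked es a y × Linked es x b)

    fromVia : ∀ {x y es a b} → Via x y es a b → Linked ((x , y) ∷ es) a b
    fromVia (inj₁ p) = weaken p
    fromVia (inj₂ (inj₁ (p , q))) = weaken p ◅◅ (fwd (here refl) ◅ weaken q)
    fromVia (inj₂ (inj₂ (p , q))) = weaken p ◅◅ (bwd (here refl) ◅ weaken q)

    extend : ∀ {x y es a b c} → Linked es a b → Via x y es b c → Via x y es a c
    extend l (inj₁ p) = inj₁ (l ◅◅ p)
    extend l (inj₂ (inj₁ (p , q))) = inj₂ (inj₁ (l ◅◅ p , q))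
    extend l (inj₂ (inj₂ (p , q))) = inj₂ (inj₂ (l ◅◅ p , q))

    toVia : ∀ {x y es a b} → Linked ((x , y) ∷ es) a b → Via x y es a b
    toVia ε = inj₁ ε
    toVia (fwd (there m) ◅ r) = extend (fwd m ◅ ε) (toVia r)
    toVia (bwd (there m) ◅ r) = extend (bwd m ◅ ε) (toVia r)
    toVia (fwd (here refl) ◅ r) with toVia r
    ... | inj₁ p = inj₂ (inj₁ (ε , p))
    ... | inj₂ (inj₁ (_ , q)) = inj₂ (inj₁ (ε , q))
    ... | inj₂ (inj₂ (_ , q)) = inj₁ q
    toVia (bwd (here refl) ◅ r) with toVia r
    ... | inj₁ p = inj₂ (inj₂ (ε , p))
    ... | inj₂ (inj₁ (_ , q)) = inj₁ q
    ... | inj₂ (inj₂ (_ , q)) = inj₂ (inj₂ (ε , q))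

  module _ (_≟_ : DecidableEquality A) where

    linked? : ∀ es → Decidable (Linked es)
    linked? [] a b with a ≟ b
    ... | yes refl = yes ε
    ... | no a≢b = no λ { ε → a≢b refl ; (fwd () ◅ _) ; (bwd () ◅ _) }
    linked? ((x , y) ∷ es) a b = map′ fromVia toVia
      (linked? es a b
        ⊎-dec (linked? es a x ×-dec linked? es y b)
        ⊎-dec (linked? es a y ×-dec linked? es x b))

    -- Deduplicating up to Linked keeps exactly one point of each component.
    #components : List A → List (A × A) → ℕ
    #components points es = length (deduplicate (linked? es) points)

-- The two ends of the edge e are (e , false) and (e , true).
HalfEdge : ℕ → Set
HalfEdge m = Fin m × Bool

-- Ribbon graphs are encoded as signed rotation systems.  Each vertex disc is
-- given an orientation; next h is the half-edge attached after h in the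
-- positive direction around its vertex.  A ribbon is twisted when it does not
-- respect the chosen orientations of the discs at its two ends.  Vertices
-- without half-edges are allowed.
record RibbonGraph : Set where
  field
    #V #E   : ℕ
    end     : HalfEdge #E → Fin #V
    next    : HalfEdge #E ↔ HalfEdge #E
    -- The half-edges at a vertex form a single cycle of next.
    cyclic  : ∀ h h′ → end h ≡ end h′ ⇔ EqClosure (λ a b → Inverse.to next a ≡ b) h h′
    twisted : Fin #E → Bool

petrieDual : RibbonGraph → RibbonGraph
petrieDual G = record G { twisted = not ∘ RibbonGraph.twisted G }

module _ (G : RibbonGraph) where
  open RibbonGraph G

  -- The arc of the vertex disc along which a half-edge h is attached runs, in
  -- the positive direction, from the point (h , false) to the point (h , true).
  Corner : Set
  Corner = HalfEdge #E × Bool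

  halfEdges : List (HalfEdge #E)
  halfEdges = cartesianProduct (allFin #E) (false ∷ true ∷ [])

  corners : List Corner
  corners = cartesianProduct halfEdges (false ∷ true ∷ [])

  _≟ᶜ_ : DecidableEquality Corner
  _≟ᶜ_ = ≡-dec (≡-dec Fin._≟_ Bool._≟_) Bool._≟_

  -- Pieces of the boundary of the spanning ribbon subgraph (V(G) , A), as pairs
  -- of corners.  A ribbon in A contributes its two free sides.  Removing a ribbon
  -- not in A exposes the two vertex arcs along which it was attached.
  vertexPiece : HalfEdge #E → Corner × Corner
  vertexPiece h = (h , true) , (Inverse.to next h , false)

  edgePieces : Subset #E → Fin #E → List (Corner × Corner)
  edgePieces A e =
    if lookup A e
    then map (λ s → ((e , false) , s) , ((e , true) , (if twisted e then s else not s)))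
             (false ∷ true ∷ [])
    else map (λ i → ((e , i) , false) , ((e , i) , true)) (false ∷ true ∷ [])

  boundary : Subset #E → List (Corner × Corner)
  boundary A = map vertexPiece halfEdges ++ concatMap (edgePieces A) (allFin #E)

  -- Vertices carrying no corner; each contributes its whole boundary circle.
  bareVertices : List (Fin #V)
  bareVertices = filter (λ v → ¬? (v ∈? map end halfEdges)) (allFin #V)
    where open DecMembership Fin._≟_ using (_∈?_)

  f : Subset #E → ℕ
  f A = #components _≟ᶜ_ corners (boundary A) ℕ.+ length bareVertices

  adjacencies : Subset #E → List (Fin #V × Fin #V)
  adjacencies A = map (λ e → end (e , false) , end (e , true))
    (filter (λ e → lookup A e Bool.≟ inside) (allFin #E))

  c : Subset #E → ℕ
  c A = #components Fin._≟_ (allFin #V) (adjacencies A)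

  r : Subset #E → ℤ
  r A = + #V ℤ.- + c A

  n : Subset #E → ℤ
  n A = + ∣ A ∣ ℤ.- r A

  eulerGenus : ℤ
  eulerGenus = + 2 ℤ.* + c ⊤ ℤ.- (+ #V ℤ.- + #E ℤ.+ + f ⊤)

  Connected : Set
  Connected = c ⊤ ≡ 1

  Plane : Set
  Plane = Connected × eulerGenus ≡ + 0

  Loopless : Set
  Loopless = ∀ e → end (e , false) ≢ end (e , true)

  Colourable : ℕ → Set
  Colourable k = ∃ λ (κ : Fin #V → Fin k) → ∀ e → κ (end (e , false)) ≢ κ (end (e , true))

FourColourTheorem : Set
FourColourTheorem = ∀ G → Plane G → Loopless G → Colourable G 4

open Algebra.Definitions.RawSemiring +-*-rawSemiring public using (_^_)

_⁻¹ : ℚ → ℚ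
q ⁻¹ with q ℚ.≟ 0ℚ
... | yes _  = 0ℚ
... | no q≢0 = 1/_ q {{≢-nonZero q≢0}}

-- All exponents occurring in R are in fact nonnegative, so the second clause
-- (and in particular the convention 0 ⁻¹ = 0) never affects its value.
infixr 8 _^ℤ_
_^ℤ_ : ℚ → ℤ → ℚ
q ^ℤ (+ k)     = q ^ k
q ^ℤ -[1+ k ]  = (q ⁻¹) ^ suc k

∑⊆ : ∀ m → (Subset m → ℚ) → ℚ
∑⊆ zero    t = t []
∑⊆ (suc m) t = ∑⊆ m (t ∘ (outside ∷_)) + ∑⊆ m (t ∘ (inside ∷_))

-- The Bollobás–Riordan polynomial as a function on ℚ; sum over all A ⊆ E(G).
R : RibbonGraph → ℚ → ℚ → ℚ → ℚ
R G x y z = ∑⊆ (RibbonGraph.#E G) λ A →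
    (x - 1ℚ) ^ℤ (r G ⊤ ℤ.- r G A)
  * y ^ℤ n G A
  * z ^ℤ (+ c G A ℤ.- + f G A ℤ.+ n G A)

{-# OPTIONS --safe #-}
-- At x - 1 = y = -λ and z = 1/λ every term of R(G×) is ±λ^(f-1), so for
-- λ = 3, 4, -2 the three evaluations are, up to an explicit nonzero factor, values
-- at λ of the Penrose polynomial P(λ) = Σ_A (-1)^|A| λ^f(A) of the twisted graph.
-- For λ = -2 the relation split + untwisted + twisted = 0 between the three ways of
-- joining the corners at an edge replaces twisted ribbons by untwisted ones; for plane G
-- Euler's formula then turns the sum into Σ_A (-1)^|A| 4^c(A), the number of proper
-- 4-colourings.
-- For λ = k ∈ {3, 4}, P(k) counts with signs the k-colourings of the corners, constant
-- along vertex arcs, that at each edge either split or cross.  Reading colours in 𝔽₂², the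
-- change of colour along the face sides of each edge is a nonzero tension with zero sum
-- around every face, hence on the sphere comes from a proper 4-colouring κ of the
-- vertices; pairing κ with the colours of the corners shows that the number of crossings
-- is even.  So P(k) ≥ 0, and P(k) ≠ 0 makes G 4-colourable.  Conversely κ itself
-- is such a colouring for k = 4, and for k = 3 so is κ + τ, where κ and τ are the colours
-- of vertices and faces in a 4-colouring of the stellation of G.
module Submission where

open import Defs
import Algebra.Properties.CommutativeMonoid.Sum as Summation
import Algebra.Properties.CommutativeSemiring.Exp as Exp
import Algebra.Properties.Semiring.Mult as Mult
import Algebra.Properties.Semiring.Sum as SemiringSum
open import Algebra.Bundles using (CommutativeMonoid; CommutativeRing)
open import Data.Bool.Base using (Bool; true; false; not; if_then_else_; _∧_; _xor_)
import Data.Bool.Properties as Bool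
import Data.Bool.Solver as Bool
open import Data.Empty using (⊥-elim)
open import Data.Fin.Base as Fin using (Fin; zero; suc; punchIn; punchOut; splitAt; remQuot; finToFun; funToFin)
import Data.Fin.Properties as Fin
open import Data.Fin.Subset using (Subset; inside; outside; ∣_∣; ⊤; ⊥; ∁)
import Data.Fin.Subset.Properties as Subset
import Data.Integer.Base as ℤ
import Data.Integer.Properties as ℤ
import Data.Integer.Solver as ℤ
open import Data.List.Base as List
  using (List; []; _∷_; _++_; map; allFin; filter; length; tabulate; deduplicate)
open import Data.List.Membership.Propositional using (_∈_; _∉_; find; lose)
import Data.List.Membership.Propositional.Properties as ∈
import Data.List.Membership.Setoid.Properties as SetoidMembership
import Data.List.Relation.Unary.All as All
open import Data.List.Relation.Unary.AllPairs as AllPairs using (AllPairs; []; _∷_)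
open import Data.List.Relation.Unary.Any as Any using (Any; here; there; index)
import Data.List.Relation.Unary.Any.Properties as Any
import Data.List.Relation.Unary.Unique.DecSetoid.Properties as UniqueDec
open import Data.List.Relation.Unary.Unique.Propositional using (Unique)
import Data.List.Relation.Unary.Unique.Propositional.Properties as Unique
open import Data.Maybe.Base using (Maybe; just; nothing)
import Data.Maybe.Properties as Maybe
open import Data.Nat.Base as ℕ using (ℕ; zero; suc; s≤s; _≤_)
import Data.Nat.Properties as ℕ
open import Data.Nat.Tactic.RingSolver using (solve-∀)
open import Data.Product.Base using (Σ; ∃; _×_; _,_; proj₁; proj₂)
open import Data.Product.Function.NonDependent.Propositional using (_×-↔_)
open import Data.Rational as ℚ using (ℚ; 0ℚ; 1ℚ; _+_; _*_; _-_; -_; _/_; _<_)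
import Data.Rational.Properties as ℚ
import Data.Rational.Solver as ℚ
open import Data.Sum.Base as Sum using (_⊎_; inj₁; inj₂)
open import Data.Sum.Function.Propositional using (_⊎-↔_)
import Data.Sum.Properties as Sum
open import Data.Unit.Base using (tt) renaming (⊤ to Unit)
open import Data.Vec.Base as Vec using (Vec; []; _∷_; lookup; _[_]≔_)
import Data.Vec.Properties as Vec
open import Function.Base using (_∘_; id)
open import Function.Bundles using (Inverse; Equivalence; _↔_; _⇔_; mk↔ₛ′; mk⇔)
open import Function.Construct.Composition using (_↔-∘_)
open import Function.Construct.Identity using (↔-id)
open import Function.Construct.Symmetry using (↔-sym)
open import Relation.Binary.Bundles using (DecSetoid)
open import Relation.Binary.Construct.Closure.Equivalence as EqC using (EqClosure)
open import Relation.Binary.Construct.Closure.ReflexiveTransitive using (ε; _◅_; _◅◅_)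
open import Relation.Binary.Construct.Closure.Symmetric using (fwd; bwd)
open import Relation.Binary.Definitions using (DecidableEquality)
open import Relation.Binary.PropositionalEquality
  using (_≡_; _≢_; _≗_; refl; sym; trans; cong; cong₂; subst; subst₂; isEquivalence; module ≡-Reasoning)
open import Relation.Nullary.Decidable using (Dec; yes; no; does; from-yes; ¬?; _×-dec_; _⊎-dec_; _→-dec_)
open import Relation.Nullary.Negation using (¬_)

-- Quotients by linkedness

-- Planarity is given only as a number, so all topology has to be read off from counts. Boundary
-- circles are the components of a graph on the corners, and adding one link keeps a component count
-- or lowers it by one. At a single edge this tells which of the three joinings closes the most
-- circles; both the relation at -2 and the behaviour of faces under insertion of an edge come from
-- there. The passage from a tension to a vertex colouring, usually an appeal to the vanishing
-- homology of the sphere, becomes an induction over edges: insertion never lowers the Euler genus,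
-- so every spanning subgraph of a plane graph has genus 0, and an inserted edge either joins two
-- components or splits a face. The parity of the crossings needs a bilinear form on 𝔽₂² with value
-- 1 at each nonzero vector paired with itself; every symmetric form fails this, hence the
-- asymmetric `form`. The stellation needs an orientation of each face; it is a two-colouring of the
-- corners that alternates along the boundary and is carried along while the boundary is assembled.

record Quotient {A : Set} (_~_ : A → A → Set) (N : ℕ) : Set where
  field
    class     : A → Fin N
    rep       : Fin N → A
    class-rep : ∀ i → class (rep i) ≡ i
    sound     : ∀ {x y} → x ~ y → class x ≡ class y
    complete  : ∀ {x y} → class x ≡ class y → x ~ y

module _ {A : Set} {_~₁_ _~₂_ : A → A → Set} {M N} (P : Quotient _~₁_ M) (Q : Quotient _~₂_ N)
         (2⊆1 : ∀ {x y} → x ~₂ y → x ~₁ y) where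
  open Quotient

  -- Representatives for the coarser relation are inequivalent under the finer one, so their classes
  -- there are distinct.
  quotient-≤ : M ℕ.≤ N
  quotient-≤ = Fin.injective⇒≤ {f = class Q ∘ rep P} λ {i} {j} eq →
    trans (sym (class-rep P i)) (trans (sound P (2⊆1 (complete Q eq))) (class-rep P j))

-- The relation determines the number of classes, so a count is found by exhibiting any quotient of
-- that size.
quotient-unique : ∀ {A : Set} {_~₁_ _~₂_ : A → A → Set} {M N} → Quotient _~₁_ M → Quotient _~₂_ N →
                  (∀ {x y} → x ~₁ y → x ~₂ y) → (∀ {x y} → x ~₂ y → x ~₁ y) → M ≡ N
quotient-unique P Q 1⊆2 2⊆1 = ℕ.≤-antisym (quotient-≤ P Q 2⊆1) (quotient-≤ Q P 1⊆2)

module _ {A : Set} where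
  open Quotient

  link : ∀ {es : List (A × A)} {x y} → (x , y) ∈ es → Linked es x y
  link m = fwd m ◅ ε

  linked-sym : ∀ {es : List (A × A)} {x y} → Linked es x y → Linked es y x
  linked-sym = EqC.symmetric _

  linked-mono : ∀ {es es′ : List (A × A)} → (∀ {p} → p ∈ es → p ∈ es′) →
                ∀ {x y} → Linked es x y → Linked es′ x y
  linked-mono sub = EqC.map sub

  linked-respects : ∀ {B : Set} (g : A → B) {es : List (A × A)} →
                    (∀ {x y} → (x , y) ∈ es → g x ≡ g y) → ∀ {x y} → Linked es x y → g x ≡ g y
  linked-respects g = EqC.gfold isEquivalence g

  -- A path can be shortened until it uses the new pair at most once, which leaves three cases
  -- according to the direction of use.
  linked-∷⁻ : ∀ {es : List (A × A)} {x y a b} → Linked ((x , y) ∷ es) a b →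
              Linked es a b ⊎ (Linked es a x × Linked es y b) ⊎ (Linked es a y × Linked es x b)
  linked-∷⁻ ε = inj₁ ε
  linked-∷⁻ (fwd (there m) ◅ r) = step (fwd m ◅ ε) (linked-∷⁻ r)
    where
    step : ∀ {es : List (A × A)} {x y a b c} → Linked es a b →
           Linked es b c ⊎ (Linked es b x × Linked es y c) ⊎ (Linked es b y × Linked es x c) →
           Linked es a c ⊎ (Linked es a x × Linked es y c) ⊎ (Linked es a y × Linked es x c)
    step l = Sum.map (l ◅◅_) (Sum.map (λ (p , q) → l ◅◅ p , q) (λ (p , q) → l ◅◅ p , q))
  linked-∷⁻ (bwd (there m) ◅ r) with linked-∷⁻ r
  ... | inj₁ p = inj₁ (bwd m ◅ p)
  ... | inj₂ (inj₁ (p , q)) = inj₂ (inj₁ (bwd m ◅ p , q))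
  ... | inj₂ (inj₂ (p , q)) = inj₂ (inj₂ (bwd m ◅ p , q))
  linked-∷⁻ (fwd (here refl) ◅ r) with linked-∷⁻ r
  ... | inj₁ p = inj₂ (inj₁ (ε , p))
  ... | inj₂ (inj₁ (_ , q)) = inj₂ (inj₁ (ε , q))
  ... | inj₂ (inj₂ (_ , q)) = inj₁ q
  linked-∷⁻ (bwd (here refl) ◅ r) with linked-∷⁻ r
  ... | inj₁ p = inj₂ (inj₂ (ε , p))
  ... | inj₂ (inj₁ (_ , q)) = inj₁ q
  ... | inj₂ (inj₂ (_ , q)) = inj₂ (inj₂ (ε , q))

  linked-join : ∀ {es : List (A × A)} {x y} → Linked es x y → ∀ {a b} → Linked ((x , y) ∷ es) a b → Linked es a b
  linked-join {es} {x} {y} xy = EqC._⋆ λ { (here refl) → xy ; (there m) → link m }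

  -- `merge` redirects the class `j` of `y` to the class `i` of `x` and closes the gap at `j`; the
  -- only new coincidence is that of `i` and `j`.
  quotient-cut : ∀ {es : List (A × A)} {x y N} → Quotient (Linked es) (suc N) → ¬ Linked es x y →
                 Quotient (Linked ((x , y) ∷ es)) N
  quotient-cut {es} {x} {y} {N} Q x≁y = record
    { class     = λ a → merge (class Q a)
    ; rep       = λ k → rep Q (punchIn j k)
    ; class-rep = λ k → trans (cong merge (class-rep Q (punchIn j k))) (merge-punchIn k)
    ; sound     = linked-respects (λ a → merge (class Q a)) λ where
        (here refl) → trans (merge-i) (sym merge-j)
        (there m)   → cong merge (sound Q (link m))
    ; complete  = λ {a} {b} eq → unmerge a b (merge-injective eq)
    }
    where
    i = class Q x
    j = class Q y
    j≢i : j ≢ i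
    j≢i eq = x≁y (complete Q (sym eq))
    merge : Fin (suc N) → Fin N
    merge k with j Fin.≟ k
    ... | yes _  = punchOut j≢i
    ... | no j≢k = punchOut j≢k
    merge-punchIn : ∀ k → merge (punchIn j k) ≡ k
    merge-punchIn k with j Fin.≟ punchIn j k
    ... | yes eq = ⊥-elim (Fin.punchInᵢ≢i j k (sym eq))
    ... | no _   = Fin.punchOut-punchIn j
    merge-j : merge j ≡ punchOut j≢i
    merge-j with j Fin.≟ j
    ... | yes _ = refl
    ... | no ¬p = ⊥-elim (¬p refl)
    merge-i : merge i ≡ punchOut j≢i
    merge-i with j Fin.≟ i
    ... | yes eq = ⊥-elim (j≢i eq)
    ... | no _   = Fin.punchOut-cong j refl
    merge-injective : ∀ {k l} → merge k ≡ merge l → k ≡ l ⊎ (k ≡ j × l ≡ i) ⊎ (k ≡ i × l ≡ j)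
    merge-injective {k} {l} eq with j Fin.≟ k | j Fin.≟ l
    ... | yes p | yes q = inj₁ (trans (sym p) q)
    ... | yes p | no q  = inj₂ (inj₁ (sym p , sym (Fin.punchOut-injective j≢i q eq)))
    ... | no p  | yes q = inj₂ (inj₂ (Fin.punchOut-injective p j≢i eq , sym q))
    ... | no p  | no q  = inj₁ (Fin.punchOut-injective p q eq)
    unmerge : ∀ a b → class Q a ≡ class Q b ⊎ (class Q a ≡ j × class Q b ≡ i) ⊎ (class Q a ≡ i × class Q b ≡ j) →
              Linked ((x , y) ∷ es) a b
    unmerge a b (inj₁ eq) = linked-mono there (complete Q eq)
    unmerge a b (inj₂ (inj₁ (p , q))) =
      linked-mono there (complete Q p) ◅◅ (bwd (here refl) ◅ linked-mono there (complete Q (sym q)))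
    unmerge a b (inj₂ (inj₂ (p , q))) =
      linked-mono there (complete Q p) ◅◅ (fwd (here refl) ◅ linked-mono there (complete Q (sym q)))

module _ {A : Set} {_~_ : A → A → Set} (~-sym : ∀ {x y} → x ~ y → y ~ x) (~-trans : ∀ {x y z} → x ~ y → y ~ z → x ~ z) where

  index-unique : ∀ {xs x} i → AllPairs (λ x y → ¬ (x ~ y)) xs → (p : Any (x ~_) xs) → x ~ List.lookup xs i → index p ≡ i
  index-unique zero    _                   (here _)  _ = refl
  index-unique zero    (x≁ AllPairs.∷ _)   (there p) q =
    ⊥-elim (All.lookupAny x≁ p .proj₁ (~-trans (~-sym q) (All.lookupAny x≁ p .proj₂)))
  index-unique (suc i) (x≁ AllPairs.∷ _)   (here p)  q = ⊥-elim (All.lookup x≁ (∈.∈-lookup i) (~-trans (~-sym p) q))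
  index-unique (suc i) (_ AllPairs.∷ uniq) (there p) q = cong suc (index-unique i uniq p q)

module _ {A : Set} (_≟_ : DecidableEquality A) {points : List A} (total : ∀ x → x ∈ points) where

  components-quotient : ∀ es → Quotient (Linked es) (#components _≟_ points es)
  components-quotient es = record
    { class     = λ x → index (reaches x)
    ; rep       = List.lookup reps
    ; class-rep = λ i → index-unique linked-sym _◅◅_ i (UniqueDec.deduplicate-! DS points) (reaches (List.lookup reps i)) ε
    ; sound     = λ {x} {y} xy → index-unique linked-sym _◅◅_ _ (UniqueDec.deduplicate-! DS points) (reaches x)
                    (xy ◅◅ Any.lookup-index (reaches y))
    ; complete  = SetoidMembership.index-injective S (reaches _) (reaches _)
    }
    where
    S = EqC.setoid (λ x y → (x , y) ∈ es)
    DS : DecSetoid _ _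
    DS = record { isDecEquivalence = record { isEquivalence = EqC.isEquivalence _ ; _≟_ = linked? _≟_ es } }
    reps = deduplicate (linked? _≟_ es) points
    reaches : ∀ x → Any (Linked es x) reps
    reaches x = SetoidMembership.∈-deduplicate⁺ S (linked? _≟_ es) (λ yz zx → zx ◅◅ linked-sym yz)
      (Any.map (λ { refl → ε }) (total x))

  components-cong : ∀ {es es′} → (∀ {x y} → Linked es x y → Linked es′ x y) →
                    (∀ {x y} → Linked es′ x y → Linked es x y) →
                    #components _≟_ points es ≡ #components _≟_ points es′
  components-cong = quotient-unique (components-quotient _) (components-quotient _)

  components-join : ∀ {es x y} → Linked es x y → #components _≟_ points ((x , y) ∷ es) ≡ #components _≟_ points es
  components-join xy = components-cong (linked-join xy) (linked-mono there)

  -- With `components-join`, this compares the counts before and after the insertion of an edge.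
  components-cut : ∀ {es x y} → ¬ Linked es x y →
                   #components _≟_ points es ≡ suc (#components _≟_ points ((x , y) ∷ es))
  components-cut {es} {x} x≁y with #components _≟_ points es in eq | components-quotient es
  ... | zero  | Q with () ← Quotient.class Q x
  ... | suc N | Q = cong suc (quotient-unique (quotient-cut Q x≁y) (components-quotient _) id id)

-- Path systems

-- The free points are the ends of the path components of the graph es, and
-- mate exchanges the two ends of a path.
record Paths {A : Set} (es : List (A × A)) (Free : A → Set) : Set where
  field
    mate        : A → A
    mate-free   : ∀ {x} → Free x → Free (mate x)
    mate-≢      : ∀ {x} → Free x → mate x ≢ x
    mate-mate   : ∀ {x} → Free x → mate (mate x) ≡ x
    mate-linked : ∀ {x} → Free x → Linked es x (mate x)
    free-linked : ∀ {x y} → Free x → Free y → Linked es x y → y ≡ x ⊎ y ≡ mate x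
    side        : A → Bool
    side-flips  : ∀ {x y} → (x , y) ∈ es → side y ≡ not (side x)
    side-mate   : ∀ {x} → Free x → side (mate x) ≡ not (side x)

  mate-swap : ∀ {x y} → Free x → y ≡ mate x → x ≡ mate y
  mate-swap fx refl = sym (mate-mate fx)

  mate-injective : ∀ {x y} → Free x → Free y → mate x ≡ mate y → x ≡ y
  mate-injective fx fy eq = trans (sym (mate-mate fx)) (trans (cong mate eq) (mate-mate fy))

paths-resp : ∀ {A : Set} {es : List (A × A)} {Free Free′ : A → Set} →
             (∀ {x} → Free x → Free′ x) → (∀ {x} → Free′ x → Free x) → Paths es Free → Paths es Free′
paths-resp to from P = record
  { mate        = mate
  ; mate-free   = λ fx → to (mate-free (from fx))
  ; mate-≢      = λ fx → mate-≢ (from fx)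
  ; mate-mate   = λ fx → mate-mate (from fx)
  ; mate-linked = λ fx → mate-linked (from fx)
  ; free-linked = λ fx fy → free-linked (from fx) (from fy)
  ; side        = side
  ; side-flips  = side-flips
  ; side-mate   = λ fx → side-mate (from fx)
  }
  where open Paths P

module _ {A : Set} (_≟_ : DecidableEquality A) where

  module _ {es : List (A × A)} {Free : A → Set} (P : Paths es Free) where
    open Paths P

    -- Reversing `side` on a whole component preserves all conditions, so it can be adjusted when
    -- `u` and `v` lie on different paths. On a common path they are mates, and `side-mate` already
    -- makes their sides opposite.
    paths-align : ∀ {u v} → Free u → Free v → u ≢ v →
                  Σ (Paths es Free) λ Q → Paths.side Q v ≡ not (Paths.side Q u)
    paths-align {u} {v} fu fv u≢v with side v Bool.≟ not (side u)
    ... | yes aligned = P , aligned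
    ... | no unaligned = record
        { mate        = mate
        ; mate-free   = mate-free
        ; mate-≢      = mate-≢
        ; mate-mate   = mate-mate
        ; mate-linked = mate-linked
        ; free-linked = free-linked
        ; side        = side′
        ; side-flips  = λ m → side′-cong (link m) (side-flips m)
        ; side-mate   = λ fx → side′-cong (mate-linked fx) (side-mate fx)
        } , aligned′
      where
      v≁u : ¬ Linked es u v
      v≁u uv with free-linked fu fv uv
      ... | inj₁ v≡u = u≢v (sym v≡u)
      ... | inj₂ refl = unaligned (side-mate fu)
      side′ : A → Bool
      side′ x with linked? _≟_ es u x
      ... | yes _ = not (side x)
      ... | no _  = side x
      side′-cong : ∀ {x y} → Linked es x y → side y ≡ not (side x) → side′ y ≡ not (side′ x)
      side′-cong {x} {y} xy eq with linked? _≟_ es u x | linked? _≟_ es u y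
      ... | yes _ | yes _  = cong not eq
      ... | yes p | no ¬q  = ⊥-elim (¬q (p ◅◅ xy))
      ... | no ¬p | yes q  = ⊥-elim (¬p (q ◅◅ linked-sym xy))
      ... | no _  | no _   = eq
      aligned′ : side′ v ≡ not (side′ u)
      aligned′ with linked? _≟_ es u v | linked? _≟_ es u u
      ... | yes p | _      = ⊥-elim (v≁u p)
      ... | no _  | no ¬p  = ⊥-elim (¬p ε)
      ... | no _  | yes _  = trans (Bool.¬-not unaligned) (trans (Bool.not-involutive _) (sym (Bool.not-involutive _)))

    -- If `v` is the other end of the path from `u`, the new pair closes a circle; otherwise two
    -- paths merge and their far ends become mates.
    paths-extend-aligned : ∀ {u v} → Free u → Free v → u ≢ v → side v ≡ not (side u) →
                           Paths ((u , v) ∷ es) (λ x → Free x × x ≢ u × x ≢ v)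
    paths-extend-aligned {u} {v} fu fv u≢v aligned = record
      { mate        = mate′
      ; mate-free   = free′
      ; mate-≢      = mate′-≢
      ; mate-mate   = mate′-mate′
      ; mate-linked = linked′
      ; free-linked = λ fx fy l → only fx fy (linked-∷⁻ l)
      ; side        = side
      ; side-flips  = λ { (here refl) → aligned ; (there m) → side-flips m }
      ; side-mate   = side-mate′
      }
      where
      Free′ : A → Set
      Free′ x = Free x × x ≢ u × x ≢ v
      -- When `v ≡ mate u`, the first two cases concern only `u` and `v`, which are no longer free,
      -- so one formula covers both situations.
      mate′ : A → A
      mate′ x with x ≟ mate u | x ≟ mate v
      ... | yes _ | _     = mate v
      ... | no _  | yes _ = mate u
      ... | no _  | no _  = mate x
      mates≢ : mate u ≢ mate v
      mates≢ eq = u≢v (mate-injective fu fv eq)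
      mate′-u : mate′ (mate u) ≡ mate v
      mate′-u with mate u ≟ mate u
      ... | yes _ = refl
      ... | no ¬p = ⊥-elim (¬p refl)
      mate′-v : mate′ (mate v) ≡ mate u
      mate′-v with mate v ≟ mate u | mate v ≟ mate v
      ... | yes eq | _ = ⊥-elim (mates≢ (sym eq))
      ... | no _ | yes _ = refl
      ... | no _ | no ¬p = ⊥-elim (¬p refl)
      mate′-other : ∀ {x} → x ≢ mate u → x ≢ mate v → mate′ x ≡ mate x
      mate′-other {x} x≢ x≢′ with x ≟ mate u | x ≟ mate v
      ... | yes p | _     = ⊥-elim (x≢ p)
      ... | no _  | yes p = ⊥-elim (x≢′ p)
      ... | no _  | no _  = refl
      free′ : ∀ {x} → Free′ x → Free′ (mate′ x)
      free′ {x} (fx , x≢u , x≢v) with x ≟ mate u | x ≟ mate v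
      ... | yes refl | _ = mate-free fv , (λ eq → x≢v (sym (mate-swap fv (sym eq)))) , mate-≢ fv
      ... | no _ | yes refl = mate-free fu , mate-≢ fu , (λ eq → x≢u (sym (mate-swap fu (sym eq))))
      ... | no p | no q = mate-free fx , (λ eq → p (mate-swap fx (sym eq))) , (λ eq → q (mate-swap fx (sym eq)))
      mate′-≢ : ∀ {x} → Free′ x → mate′ x ≢ x
      mate′-≢ {x} (fx , x≢u , x≢v) with x ≟ mate u | x ≟ mate v
      ... | yes refl | _ = mates≢ ∘ sym
      ... | no _ | yes refl = mates≢
      ... | no p | no q = mate-≢ fx
      mate′-mate′ : ∀ {x} → Free′ x → mate′ (mate′ x) ≡ x
      mate′-mate′ {x} (fx , x≢u , x≢v) with x ≟ mate u | x ≟ mate v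
      ... | yes refl | _ = mate′-v
      ... | no _ | yes refl = mate′-u
      ... | no p | no q = trans (mate′-other (x≢u ∘ mate-injective fx fu) (x≢v ∘ mate-injective fx fv)) (mate-mate fx)
      linked′ : ∀ {x} → Free′ x → Linked ((u , v) ∷ es) x (mate′ x)
      linked′ {x} (fx , x≢u , x≢v) with x ≟ mate u | x ≟ mate v
      ... | yes refl | _ = linked-mono there (linked-sym (mate-linked fu)) ◅◅ fwd (here refl)
              ◅ linked-mono there (mate-linked fv)
      ... | no _ | yes refl = linked-mono there (linked-sym (mate-linked fv)) ◅◅ bwd (here refl)
              ◅ linked-mono there (mate-linked fu)
      ... | no p | no q = linked-mono there (mate-linked fx)
      only : ∀ {x y} → Free′ x → Free′ y →
             Linked es x y ⊎ (Linked es x u × Linked es v y) ⊎ (Linked es x v × Linked es u y) → y ≡ x ⊎ y ≡ mate′ x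
      only (fx , x≢u , x≢v) (fy , y≢u , y≢v) (inj₁ p) with free-linked fx fy p
      ... | inj₁ eq = inj₁ eq
      ... | inj₂ refl = inj₂ (sym (mate′-other (y≢u ∘ sym ∘ mate-swap fu) (y≢v ∘ sym ∘ mate-swap fv)))
      only (fx , x≢u , x≢v) (fy , y≢u , y≢v) (inj₂ (inj₁ (p , q))) with free-linked fx fu p | free-linked fv fy q
      ... | inj₁ eq | _ = ⊥-elim (x≢u (sym eq))
      ... | _ | inj₁ eq = ⊥-elim (y≢v eq)
      ... | inj₂ eq | inj₂ refl with mate-swap fx eq
      ...   | refl = inj₂ (sym mate′-u)
      only (fx , x≢u , x≢v) (fy , y≢u , y≢v) (inj₂ (inj₂ (p , q))) with free-linked fx fv p | free-linked fu fy q
      ... | inj₁ eq | _ = ⊥-elim (x≢v (sym eq))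
      ... | _ | inj₁ eq = ⊥-elim (y≢u eq)
      ... | inj₂ eq | inj₂ refl with mate-swap fx eq
      ...   | refl = inj₂ (sym mate′-v)
      side-mate′ : ∀ {x} → Free′ x → side (mate′ x) ≡ not (side x)
      side-mate′ {x} (fx , x≢u , x≢v) with x ≟ mate u | x ≟ mate v
      ... | yes refl | _ = trans (side-mate fv) (trans (cong not aligned) (cong not (sym (side-mate fu))))
      ... | no _ | yes refl =
              trans (side-mate fu) (trans (sym aligned)
              (trans (sym (Bool.not-involutive _)) (cong not (sym (side-mate fv)))))
      ... | no _ | no _ = side-mate fx

  paths-extend : ∀ {es : List (A × A)} {Free : A → Set} → Paths es Free → ∀ {u v} → Free u → Free v → u ≢ v →
                 Paths ((u , v) ∷ es) (λ x → Free x × x ≢ u × x ≢ v)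
  paths-extend P fu fv u≢v with paths-align P fu fv u≢v
  ... | Q , aligned = paths-extend-aligned Q fu fv u≢v aligned

-- The three ways of joining the four corners of an edge in pairs: nothing is an
-- absent ribbon, just t a ribbon with twist t.
Kind : Set
Kind = Maybe Bool

end-flip side-flip : Kind → Bool → Bool
end-flip nothing  i = i
end-flip (just _) i = not i
side-flip (just true) s = s
side-flip _           s = not s

-- The three nontrivial elements of a Klein four-group acting simply transitively on the corners of
-- each edge; the commutation and cancellation laws below are those of this group.
partner : ∀ {m} → Kind → HalfEdge m × Bool → HalfEdge m × Bool
partner k ((e , i) , s) = (e , end-flip k i) , side-flip k s

partner-involutive : ∀ {m} k (x : HalfEdge m × Bool) → partner k (partner k x) ≡ x
partner-involutive nothing      ((e , i) , s) = cong ((e , i) ,_) (Bool.not-involutive s)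
partner-involutive (just false) ((e , i) , s) = cong₂ (λ i s → (e , i) , s) (Bool.not-involutive i) (Bool.not-involutive s)
partner-involutive (just true)  ((e , i) , s) = cong (λ i → (e , i) , s) (Bool.not-involutive i)

first : ∀ {m} → Fin m → HalfEdge m × Bool
first e = (e , false) , false

-- A corner outside the pair of `first`, chosen so that the resulting pieces have the order and
-- direction of those in `edgePieces`.
second : ∀ {m} → Kind → Fin m → HalfEdge m × Bool
second nothing  e = (e , true) , false
second (just _) e = (e , false) , true

kindPieces : ∀ {m} → Kind → Fin m → List ((HalfEdge m × Bool) × (HalfEdge m × Bool))
kindPieces k e = (first e , partner k (first e)) ∷ (second k e , partner k (second k e)) ∷ []

edge : ∀ {m} → HalfEdge m × Bool → Fin m
edge ((e , _) , _) = e

edge-second : ∀ {m} k (e : Fin m) → edge (second k e) ≡ e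
edge-second nothing  e = refl
edge-second (just _) e = refl

kindPieces-partner : ∀ {m k e} {x y : HalfEdge m × Bool} → (x , y) ∈ kindPieces k e → edge x ≡ e × y ≡ partner k x
kindPieces-partner         (here refl)         = refl , refl
kindPieces-partner {k = k} {e} (there (here refl)) = edge-second k e , refl

corner-cases : ∀ {m} k (x : HalfEdge m × Bool) → let e = edge x in
               x ≡ first e ⊎ x ≡ partner k (first e) ⊎ x ≡ second k e ⊎ x ≡ partner k (second k e)
corner-cases nothing      ((e , false) , false) = inj₁ refl
corner-cases nothing      ((e , false) , true)  = inj₂ (inj₁ refl)
corner-cases nothing      ((e , true) , false)  = inj₂ (inj₂ (inj₁ refl))
corner-cases nothing      ((e , true) , true)   = inj₂ (inj₂ (inj₂ refl))
corner-cases (just false) ((e , false) , false) = inj₁ refl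
corner-cases (just false) ((e , false) , true)  = inj₂ (inj₂ (inj₁ refl))
corner-cases (just false) ((e , true) , false)  = inj₂ (inj₂ (inj₂ refl))
corner-cases (just false) ((e , true) , true)   = inj₂ (inj₁ refl)
corner-cases (just true)  ((e , false) , false) = inj₁ refl
corner-cases (just true)  ((e , false) , true)  = inj₂ (inj₂ (inj₁ refl))
corner-cases (just true)  ((e , true) , false)  = inj₂ (inj₁ refl)
corner-cases (just true)  ((e , true) , true)   = inj₂ (inj₂ (inj₂ refl))

partner-≢ : ∀ {m} k (x : HalfEdge m × Bool) → partner k x ≢ x
partner-≢ nothing      ((e , i) , s) eq = Bool.not-¬ {s} refl (sym (cong proj₂ eq))
partner-≢ (just false) ((e , i) , s) eq = Bool.not-¬ {s} refl (sym (cong proj₂ eq))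
partner-≢ (just true)  ((e , i) , s) eq = Bool.not-¬ {i} refl (sym (cong (proj₂ ∘ proj₁) eq))

first-≢-second : ∀ {m} k (e : Fin m) → first e ≢ second k e
first-≢-second nothing  e ()
first-≢-second (just _) e ()

first-≢-partner-second : ∀ {m} k (e : Fin m) → first e ≢ partner k (second k e)
first-≢-partner-second nothing      e ()
first-≢-partner-second (just false) e ()
first-≢-partner-second (just true)  e ()

kindPieces-linked : ∀ {m} k (x : HalfEdge m × Bool) → Linked (kindPieces k (edge x)) x (partner k x)
kindPieces-linked {m} k x = by-cases (corner-cases k x)
  where
  forth : ∀ {z es} → x ≡ z → Linked es z (partner k z) → Linked es x (partner k x)
  forth refl l = l
  back : ∀ {z es} → x ≡ partner k z → Linked es z (partner k z) → Linked es x (partner k x)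
  back {z} refl l = subst (Linked _ _) (sym (partner-involutive k z)) (linked-sym l)
  by-cases : let e = edge x in
             x ≡ first e ⊎ x ≡ partner k (first e) ⊎ x ≡ second k e ⊎ x ≡ partner k (second k e) →
             Linked (kindPieces k e) x (partner k x)
  by-cases (inj₁ eq)               = forth eq (link (here refl))
  by-cases (inj₂ (inj₁ eq))        = back eq (link (here refl))
  by-cases (inj₂ (inj₂ (inj₁ eq))) = forth eq (link (there (here refl)))
  by-cases (inj₂ (inj₂ (inj₂ eq))) = back eq (link (there (here refl)))

-- Boundary curves after joining the corners of some edges

module _ (G : RibbonGraph) where
  open RibbonGraph G

  vertexPieces : List (Corner G × Corner G)
  vertexPieces = map (vertexPiece G) (halfEdges G)

  halfEdges-complete : ∀ h → h ∈ halfEdges G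
  halfEdges-complete (e , false) = ∈.∈-cartesianProduct⁺ (∈.∈-allFin e) (here refl)
  halfEdges-complete (e , true)  = ∈.∈-cartesianProduct⁺ (∈.∈-allFin e) (there (here refl))

  corners-complete : ∀ x → x ∈ corners G
  corners-complete (h , false) = ∈.∈-cartesianProduct⁺ (halfEdges-complete h) (here refl)
  corners-complete (h , true)  = ∈.∈-cartesianProduct⁺ (halfEdges-complete h) (there (here refl))

  vertexPiece-∈ : ∀ h → vertexPiece G h ∈ vertexPieces
  vertexPiece-∈ h = ∈.∈-map⁺ (vertexPiece G) (halfEdges-complete h)

  State : Set
  State = Fin #E → Kind

  -- Only the listed edges have their corners joined; the corners of all other edges are the free
  -- ends of the paths that arise.
  layers : State → List (Fin #E) → List (Corner G × Corner G)
  layers st []       = vertexPieces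
  layers st (e ∷ es) = kindPieces (st e) e ++ layers st es

  ∈-layers⁻ : ∀ st L {p} → p ∈ layers st L → p ∈ vertexPieces ⊎ ∃ λ e → e ∈ L × p ∈ kindPieces (st e) e
  ∈-layers⁻ st []      m = inj₁ m
  ∈-layers⁻ st (e ∷ L) m with ∈.∈-++⁻ (kindPieces (st e) e) m
  ... | inj₁ q = inj₂ (e , here refl , q)
  ... | inj₂ q with ∈-layers⁻ st L q
  ...   | inj₁ r = inj₁ r
  ...   | inj₂ (e′ , e′∈ , r) = inj₂ (e′ , there e′∈ , r)

  ∈-layers⁺ˡ : ∀ st L {p} → p ∈ vertexPieces → p ∈ layers st L
  ∈-layers⁺ˡ st []      m = m
  ∈-layers⁺ˡ st (e ∷ L) m = ∈.∈-++⁺ʳ (kindPieces (st e) e) (∈-layers⁺ˡ st L m)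

  ∈-layers⁺ʳ : ∀ st {e L p} → e ∈ L → p ∈ kindPieces (st e) e → p ∈ layers st L
  ∈-layers⁺ʳ st             (here refl) m = ∈.∈-++⁺ˡ m
  ∈-layers⁺ʳ st {L = e ∷ _} (there e∈)  m = ∈.∈-++⁺ʳ (kindPieces (st e) e) (∈-layers⁺ʳ st e∈ m)

  private
    prev : HalfEdge #E → HalfEdge #E
    prev = Inverse.from next
    next-prev : ∀ h → Inverse.to next (prev h) ≡ h
    next-prev h = Inverse.strictlyInverseˡ next h
    prev-next : ∀ h → prev (Inverse.to next h) ≡ h
    prev-next h = Inverse.strictlyInverseʳ next h

  -- Every corner bounds exactly one angle of its vertex disc, so these pieces match the corners in
  -- pairs; `angle` names a pair by its preceding half-edge.
  vertexPaths : Paths vertexPieces (λ _ → Unit)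
  vertexPaths = record
    { mate        = mate
    ; mate-free   = λ _ → tt
    ; mate-≢      = λ { {h , false} _ () ; {h , true} _ () }
    ; mate-mate   = λ { {h , false} _ → cong (_, false) (next-prev h) ; {h , true} _ → cong (_, true) (prev-next h) }
    ; mate-linked = λ { {h , false} _ →
        bwd (subst (λ h′ → ((prev h , true) , h′ , false) ∈ vertexPieces) (next-prev h) (vertexPiece-∈ (prev h))) ◅ ε
                      ; {h , true} _ → fwd (vertexPiece-∈ h) ◅ ε }
    ; free-linked = λ {x} {y} _ _ l → base x y (linked-respects angle angle-respects l)
    ; side        = proj₂
    ; side-flips  = flips
    ; side-mate   = λ { {h , false} _ → refl ; {h , true} _ → refl }
    }
    where
    mate : Corner G → Corner G
    mate (h , false) = prev h , true
    mate (h , true)  = Inverse.to next h , false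
    angle : Corner G → HalfEdge #E
    angle (h , false) = prev h
    angle (h , true)  = h
    angle-respects : ∀ {x y} → (x , y) ∈ vertexPieces → angle x ≡ angle y
    angle-respects m with ∈.∈-map⁻ (vertexPiece G) m
    ... | h , _ , refl = sym (prev-next h)
    flips : ∀ {x y} → (x , y) ∈ vertexPieces → proj₂ y ≡ not (proj₂ x)
    flips m with ∈.∈-map⁻ (vertexPiece G) m
    ... | h , _ , refl = refl
    base : ∀ x y → angle x ≡ angle y → y ≡ x ⊎ y ≡ mate x
    base (h , false) (h′ , false) eq =
        inj₁ (cong (_, false) (trans (sym (next-prev h′)) (trans (cong (Inverse.to next) (sym eq)) (next-prev h))))
    base (h , false) (h′ , true)  eq = inj₂ (cong (_, true) (sym eq))
    base (h , true)  (h′ , false) eq = inj₂ (cong (_, false) (trans (sym (next-prev h′)) (cong (Inverse.to next) (sym eq))))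
    base (h , true)  (h′ , true)  eq = inj₁ (cong (_, true) (sym eq))

  layerPaths : ∀ st {L} → Unique L → Paths (layers st L) (λ x → edge x ∉ L)
  layerPaths st {[]}    _           = paths-resp (λ _ ()) (λ _ → tt) vertexPaths
  layerPaths st {e ∷ L} (e∉ ∷ uniq) = paths-resp to from
      (paths-extend (_≟ᶜ_ G)
        (paths-extend (_≟ᶜ_ G) (layerPaths st uniq) fresh₂ fresh₂ (partner-≢ k y ∘ sym))
        (fresh , x≢y , x≢y′)
        (fresh , (λ eq → x≢y′ (trans (sym (partner-involutive k x)) (cong (partner k) eq)))
               , (λ eq → x≢y (trans (sym (partner-involutive k x)) (trans (cong (partner k) eq) (partner-involutive k y)))))
        (partner-≢ k x ∘ sym))
    where
    k = st e
    x y : Corner G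
    x = first e
    y = second k e
    x≢y = first-≢-second k e
    x≢y′ = first-≢-partner-second k e
    fresh : e ∉ L
    fresh e∈ = All.lookup e∉ e∈ refl
    fresh₂ : edge y ∉ L
    fresh₂ = fresh ∘ subst (_∈ L) (edge-second k e)
    to : ∀ {z} → (edge z ∉ L × z ≢ y × z ≢ partner k y) × z ≢ x × z ≢ partner k x → edge z ∉ e ∷ L
    to {z} ((_ , p , q) , r , s) (here refl) with corner-cases k z
    ... | inj₁ eq               = r eq
    ... | inj₂ (inj₁ eq)        = s eq
    ... | inj₂ (inj₂ (inj₁ eq)) = p eq
    ... | inj₂ (inj₂ (inj₂ eq)) = q eq
    to ((f , _) , _) (there m) = f m
    from : ∀ {z} → edge z ∉ e ∷ L → (edge z ∉ L × z ≢ y × z ≢ partner k y) × z ≢ x × z ≢ partner k x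
    from z∉ = (z∉ ∘ there , (λ { refl → z∉ (here (edge-second k e)) }) , (λ { refl → z∉ (here (edge-second k e)) }))
            , (λ { refl → z∉ (here refl) }) , (λ { refl → z∉ (here refl) })

-- Boundary components and Euler genus

subset-ascent : ∀ {m} (P : Subset m → Set) → P ⊥ →
                (∀ A e → lookup A e ≡ outside → P A → P (A [ e ]≔ inside)) → ∀ A → P A
subset-ascent P base step []            = base
subset-ascent P base step (outside ∷ A) =
  subset-ascent (P ∘ (outside ∷_)) base (λ A e → step (outside ∷ A) (suc e)) A
subset-ascent P base step (inside ∷ A)  =
  step (outside ∷ A) zero refl (subset-ascent (P ∘ (outside ∷_)) base (λ A e → step (outside ∷ A) (suc e)) A)

-- Ascent starts from the edgeless graph; descent serves where the information is given for the
-- whole graph.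
subset-descent : ∀ {m} (P : Subset m → Set) → P ⊤ →
                 (∀ A e → lookup A e ≡ outside → P (A [ e ]≔ inside) → P A) → ∀ A → P A
subset-descent P base step []            = base
subset-descent P base step (inside ∷ A)  =
  subset-descent (P ∘ (inside ∷_)) base (λ A e → step (inside ∷ A) (suc e)) A
subset-descent P base step (outside ∷ A) =
  step (outside ∷ A) zero refl (subset-descent (P ∘ (inside ∷_)) base (λ A e → step (inside ∷ A) (suc e)) A)

∣insert∣ : ∀ {m} (A : Subset m) e → lookup A e ≡ outside → ∣ A [ e ]≔ inside ∣ ≡ suc ∣ A ∣
∣insert∣ (outside ∷ A) zero    _  = refl
∣insert∣ (inside ∷ A)  (suc e) eq = cong suc (∣insert∣ A e eq)
∣insert∣ (outside ∷ A) (suc e) eq = ∣insert∣ A e eq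

partner-comm : ∀ {m} k l (x : HalfEdge m × Bool) → partner k (partner l x) ≡ partner l (partner k x)
partner-comm k l ((e , i) , s) = cong₂ (λ i s → (e , i) , s) (ends k l) (sides k l)
  where
  ends : ∀ k l → end-flip k (end-flip l i) ≡ end-flip l (end-flip k i)
  ends nothing  l        = refl
  ends (just _) nothing  = refl
  ends (just _) (just _) = refl
  sides : ∀ k l → side-flip k (side-flip l s) ≡ side-flip l (side-flip k s)
  sides nothing      nothing      = refl
  sides nothing      (just false) = refl
  sides nothing      (just true)  = refl
  sides (just false) nothing      = refl
  sides (just false) (just false) = refl
  sides (just false) (just true)  = refl
  sides (just true)  nothing      = refl
  sides (just true)  (just false) = refl
  sides (just true)  (just true)  = refl

partner-injective : ∀ {m} {k l} (x : HalfEdge m × Bool) → partner k x ≡ partner l x → k ≡ l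
partner-injective {k = nothing}    {nothing}    x eq = refl
partner-injective {k = nothing}    {just _}     ((e , i) , s) eq = ⊥-elim (Bool.not-¬ {i} refl (cong (proj₂ ∘ proj₁) eq))
partner-injective {k = just _}     {nothing}    ((e , i) , s) eq =
    ⊥-elim (Bool.not-¬ {i} refl (sym (cong (proj₂ ∘ proj₁) eq)))
partner-injective {k = just false} {just false} x eq = refl
partner-injective {k = just false} {just true}  ((e , i) , s) eq = ⊥-elim (Bool.not-¬ {s} refl (sym (cong proj₂ eq)))
partner-injective {k = just true}  {just false} ((e , i) , s) eq = ⊥-elim (Bool.not-¬ {s} refl (cong proj₂ eq))
partner-injective {k = just true}  {just true}  x eq = refl

kind-of : ∀ {m} (x y : HalfEdge m × Bool) → edge x ≡ edge y → x ≢ y → ∃ λ k → y ≡ partner k x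
kind-of ((e , false) , false) ((.e , false) , false) refl x≢y = ⊥-elim (x≢y refl)
kind-of ((e , false) , false) ((.e , false) , true)  refl x≢y = nothing , refl
kind-of ((e , false) , false) ((.e , true) , false)  refl x≢y = just true , refl
kind-of ((e , false) , false) ((.e , true) , true)   refl x≢y = just false , refl
kind-of ((e , false) , true)  ((.e , false) , false) refl x≢y = nothing , refl
kind-of ((e , false) , true)  ((.e , false) , true)  refl x≢y = ⊥-elim (x≢y refl)
kind-of ((e , false) , true)  ((.e , true) , false)  refl x≢y = just false , refl
kind-of ((e , false) , true)  ((.e , true) , true)   refl x≢y = just true , refl
kind-of ((e , true) , false)  ((.e , false) , false) refl x≢y = just true , refl
kind-of ((e , true) , false)  ((.e , false) , true)  refl x≢y = just false , refl
kind-of ((e , true) , false)  ((.e , true) , false)  refl x≢y = ⊥-elim (x≢y refl)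
kind-of ((e , true) , false)  ((.e , true) , true)   refl x≢y = nothing , refl
kind-of ((e , true) , true)   ((.e , false) , false) refl x≢y = just false , refl
kind-of ((e , true) , true)   ((.e , false) , true)  refl x≢y = just true , refl
kind-of ((e , true) , true)   ((.e , true) , false)  refl x≢y = nothing , refl
kind-of ((e , true) , true)   ((.e , true) , true)   refl x≢y = ⊥-elim (x≢y refl)

lookup-injective : ∀ {A : Set} {xs : List A} → Unique xs → ∀ i j → List.lookup xs i ≡ List.lookup xs j → i ≡ j
lookup-injective {xs = xs} uniq i j eq =
  trans (sym (index-unique sym trans i uniq (∈.∈-lookup i) refl))
        (index-unique sym trans j uniq (∈.∈-lookup i) eq)

-- The keys of the representatives and the entries of `vs` are disjoint families of distinct
-- elements of `Fin V`.
quotient-+-≤ : ∀ {A : Set} {_~_ : A → A → Set} {N V} → Quotient _~_ N → (key : A → Fin V) →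
               (∀ {x y} → key x ≡ key y → x ~ y) → ∀ {vs} → Unique vs → (∀ {x v} → v ∈ vs → key x ≢ v) →
               N ℕ.+ length vs ≤ V
quotient-+-≤ {N = N} Q key complete {vs} uniq avoids = Fin.injective⇒≤ {f = value ∘ splitAt N} λ {i} {j} eq →
  trans (sym (Fin.join-splitAt N (length vs) i))
    (trans (cong (Fin.join N (length vs)) (value-injective (splitAt N i) (splitAt N j) eq))
        (Fin.join-splitAt N (length vs) j))
  where
  value : Fin N ⊎ Fin (length vs) → Fin _
  value = Sum.[ key ∘ Quotient.rep Q , List.lookup vs ]
  value-injective : ∀ i j → value i ≡ value j → i ≡ j
  value-injective (inj₁ i) (inj₁ j) eq = cong inj₁ (trans (sym (Quotient.class-rep Q i))
    (trans (Quotient.sound Q (complete eq)) (Quotient.class-rep Q j)))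
  value-injective (inj₁ i) (inj₂ j) eq = ⊥-elim (avoids (∈.∈-lookup j) eq)
  value-injective (inj₂ i) (inj₁ j) eq = ⊥-elim (avoids (∈.∈-lookup i) (sym eq))
  value-injective (inj₂ i) (inj₂ j) eq = cong inj₂ (lookup-injective uniq i j eq)

-- Boundary circles under a change at one edge

module _ (G : RibbonGraph) where
  open RibbonGraph G

  loops : State G → ℕ
  loops st = #components (_≟ᶜ_ G) (corners G) (layers G st (allFin #E))

  others : Fin #E → List (Fin #E)
  others e = filter (λ e′ → ¬? (e′ Fin.≟ e)) (allFin #E)

  others-unique : ∀ e → Unique (others e)
  others-unique e = Unique.filter⁺ _ (Unique.allFin⁺ #E)

  ∈-others : ∀ {e e′} → e′ ≢ e → e′ ∈ others e
  ∈-others {e} {e′} e′≢e = ∈.∈-filter⁺ (λ e′ → ¬? (e′ Fin.≟ e)) (∈.∈-allFin e′) e′≢e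

  ∉-others : ∀ {e e′} → e′ ≡ e → e′ ∉ others e
  ∉-others {e} eq m = proj₂ (∈.∈-filter⁻ (λ e′ → ¬? (e′ Fin.≟ e)) {xs = allFin #E} m) eq

  rest : State G → Fin #E → List (Corner G × Corner G)
  rest st e = layers G st (others e)

  -- At an edge e, the remaining boundary pieces pair up the four corners of e
  -- in the way of exactly one kind.
  record Skein (st : State G) (e : Fin #E) : Set where
    field
      kind        : Kind
      rest-linked : ∀ {x} → edge x ≡ e → Linked (rest st e) x (partner kind x)
      rest-only   : ∀ {x y} → edge x ≡ e → edge y ≡ e → Linked (rest st e) x y → y ≡ x ⊎ y ≡ partner kind x

  -- All corners except the four of `e` are interior to the paths of `rest st e`, so `mate` pairs
  -- these four among themselves. Its value at one corner fixes the kind and forces the other pair.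
  skein : ∀ st e → Skein st e
  skein st e = record
    { kind        = k
    ; rest-linked = λ {x} ex → subst (Linked (rest st e) x) (mate-kind x ex) (mate-linked (∉-others ex))
    ; rest-only   = λ {x} ex ey l → Sum.map₂ (λ eq → trans eq (mate-kind x ex)) (free-linked (∉-others ex) (∉-others ey) l)
    }
    where
    open Paths (layerPaths G st (others-unique e))
    free-edge : ∀ {x} → edge x ∉ others e → edge x ≡ e
    free-edge {x} x∉ with edge x Fin.≟ e
    ... | yes eq = eq
    ... | no ≢e  = ⊥-elim (x∉ (∈-others ≢e))
    mate-edge : ∀ {x} → edge x ≡ e → edge (mate x) ≡ e
    mate-edge {x} ex = free-edge {mate x} (mate-free (∉-others ex))
    found : ∃ λ k → mate (first e) ≡ partner k (first e)
    found = kind-of (first e) (mate (first e)) (sym (mate-edge refl)) (mate-≢ (∉-others refl) ∘ sym)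
    k = proj₁ found
    x₀ = first e
    y₀ = second k e
    fx = ∉-others {e} {edge x₀} refl
    fy = ∉-others {e} {edge y₀} (edge-second k e)
    mate-x₀ : mate x₀ ≡ partner k x₀
    mate-x₀ = proj₂ found
    mate-px₀ : mate (partner k x₀) ≡ x₀
    mate-px₀ = sym (mate-swap fx (sym mate-x₀))
    -- The mate of `y₀` cannot be `x₀` or `partner k x₀`, which are mates of each other, nor `y₀`
    -- itself.
    mate-y₀ : mate y₀ ≡ partner k y₀
    mate-y₀ with subst (λ e′ → mate y₀ ≡ first e′ ⊎ mate y₀ ≡ partner k (first e′) ⊎ mate y₀ ≡ second k e′
        ⊎ mate y₀ ≡ partner k (second k e′))
                   (mate-edge (edge-second k e)) (corner-cases k (mate y₀))
    ... | inj₁ eq               = ⊥-elim (first-≢-partner-second k e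
            (trans (sym (partner-involutive k x₀)) (cong (partner k) (trans (sym mate-x₀) (sym (mate-swap fy (sym eq)))))))
    ... | inj₂ (inj₁ eq)        = ⊥-elim (first-≢-second k e (trans (sym mate-px₀) (sym (mate-swap fy (sym eq)))))
    ... | inj₂ (inj₂ (inj₁ eq)) = ⊥-elim (mate-≢ fy eq)
    ... | inj₂ (inj₂ (inj₂ eq)) = eq
    mate-kind : ∀ x → edge x ≡ e → mate x ≡ partner k x
    mate-kind x refl with corner-cases k x
    ... | inj₁ eq               = trans (cong mate eq) (trans mate-x₀ (cong (partner k) (sym eq)))
    ... | inj₂ (inj₁ eq)        =
            trans (cong mate eq) (trans mate-px₀ (trans (sym (partner-involutive k x₀)) (cong (partner k) (sym eq))))
    ... | inj₂ (inj₂ (inj₁ eq)) = trans (cong mate eq) (trans mate-y₀ (cong (partner k) (sym eq)))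
    ... | inj₂ (inj₂ (inj₂ eq)) =
            trans (cong mate eq) (trans (sym (mate-swap fy (sym mate-y₀)))
            (trans (sym (partner-involutive k y₀)) (cong (partner k) (sym eq))))

  record Agree (e : Fin #E) (st st′ : State G) : Set where
    constructor agrees
    field agree : ∀ e′ → e′ ≢ e → st′ e′ ≡ st e′

  open Agree

  ∈-rest⁺ : ∀ {st st′ e p} → Agree e st st′ → p ∈ layers G st′ (allFin #E) → p ∈ kindPieces (st′ e) e ++ rest st e
  ∈-rest⁺ {st} {st′} {e} {p} a m with ∈-layers⁻ G st′ (allFin #E) m
  ... | inj₁ v = ∈.∈-++⁺ʳ (kindPieces (st′ e) e) (∈-layers⁺ˡ G st (others e) v)
  ... | inj₂ (e′ , _ , q) with e′ Fin.≟ e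
  ...   | yes refl = ∈.∈-++⁺ˡ q
  ...   | no e′≢e  = ∈.∈-++⁺ʳ (kindPieces (st′ e) e)
                       (∈-layers⁺ʳ G st (∈-others e′≢e) (subst (λ k → p ∈ kindPieces k e′) (agree a e′ e′≢e) q))

  ∈-rest⁻ : ∀ {st st′ e p} → Agree e st st′ → p ∈ rest st e → p ∈ layers G st′ (allFin #E)
  ∈-rest⁻ {st} {st′} {e} {p} a m with ∈-layers⁻ G st (others e) m
  ... | inj₁ v = ∈-layers⁺ˡ G st′ (allFin #E) v
  ... | inj₂ (e′ , e′∈ , q) =
    ∈-layers⁺ʳ G st′ (∈.∈-allFin e′)
      (subst (λ k → p ∈ kindPieces k e′) (sym (agree a e′ (λ eq → ∉-others eq e′∈))) q)

  loops-rest : ∀ {st st′ e} → Agree e st st′ →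
               loops st′ ≡ #components (_≟ᶜ_ G) (corners G) (kindPieces (st′ e) e ++ rest st e)
  loops-rest {st} {st′} {e} a = components-cong (_≟ᶜ_ G) (corners-complete G)
    (linked-mono (∈-rest⁺ a))
    (linked-mono λ m → Sum.[ ∈-layers⁺ʳ G st′ (∈.∈-allFin e) , ∈-rest⁻ a ] (∈.∈-++⁻ (kindPieces (st′ e) e) m))

  loops-cong : ∀ {st st′} → (∀ e → st′ e ≡ st e) → loops st′ ≡ loops st
  loops-cong {st} {st′} eq = components-cong (_≟ᶜ_ G) (corners-complete G)
    (linked-mono (transfer st′ st eq)) (linked-mono (transfer st st′ (sym ∘ eq)))
    where
    transfer : ∀ st st′ → (∀ e → st e ≡ st′ e) → ∀ {p} → p ∈ layers G st (allFin #E) → p ∈ layers G st′ (allFin #E)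
    transfer st st′ eq {p} m with ∈-layers⁻ G st (allFin #E) m
    ... | inj₁ v = ∈-layers⁺ˡ G st′ (allFin #E) v
    ... | inj₂ (e , e∈ , q) = ∈-layers⁺ʳ G st′ e∈ (subst (λ k → p ∈ kindPieces k e) (eq e) q)

  module _ {st : State G} {e : Fin #E} (S : Skein st e) where
    open Skein S

    private N = #components (_≟ᶜ_ G) (corners G) (rest st e)

    -- Each of the two pieces closes a path whose ends were linked already, so neither changes the
    -- count.
    loops-same : ∀ {st′} → Agree e st st′ → st′ e ≡ kind → loops st′ ≡ N
    loops-same a refl = trans (loops-rest a) (trans
      (components-join (_≟ᶜ_ G) (corners-complete G) (linked-mono there (rest-linked refl)))
      (components-join (_≟ᶜ_ G) (corners-complete G) (rest-linked (edge-second kind e))))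

    -- The piece at `second` merges the two paths into one, and the piece at `first` closes that one
    -- into a circle.
    loops-other : ∀ {st′} → Agree e st st′ → st′ e ≢ kind → N ≡ suc (loops st′)
    loops-other {st′} a k≢ = trans
      (components-cut (_≟ᶜ_ G) (corners-complete G) cut)
      (cong suc (sym (trans (loops-rest a) (components-join (_≟ᶜ_ G) (corners-complete G) joined))))
      where
      k = st′ e
      x = first e
      y = second k e
      cut : ¬ Linked (rest st e) y (partner k y)
      cut l with rest-only (edge-second k e) (edge-second k e) l
      ... | inj₁ eq = partner-≢ k y eq
      ... | inj₂ eq = k≢ (partner-injective y eq)
      across : Linked ((y , partner k y) ∷ rest st e) y (partner k y)
      across = link (here refl)
      in-rest : ∀ {z} → edge z ≡ e → Linked ((y , partner k y) ∷ rest st e) z (partner kind z)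
      in-rest ez = linked-mono there (rest-linked ez)
      conj : ∀ z → partner kind (partner k (partner kind z)) ≡ partner k z
      conj z = trans (partner-comm kind k (partner kind z)) (cong (partner k) (partner-involutive kind z))
      -- From `x` the path follows the old pairing to the other piece, crosses it and returns along
      -- the old pairing; since the involutions commute, it ends at `partner k x`.
      joined : Linked ((y , partner k y) ∷ rest st e) x (partner k x)
      joined with corner-cases k (partner kind x)
      ... | inj₁ eq               = ⊥-elim (partner-≢ kind x eq)
      ... | inj₂ (inj₁ eq)        = ⊥-elim (k≢ (partner-injective x (sym eq)))
      ... | inj₂ (inj₂ (inj₁ eq)) = subst (Linked _ x) (trans (cong (partner kind ∘ partner k) (sym eq)) (conj x))
              (subst (Linked _ x) eq (in-rest refl) ◅◅ across ◅◅ in-rest (edge-second k e))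
      ... | inj₂ (inj₂ (inj₂ eq)) = subst (Linked _ x)
              (trans (cong (partner kind) (trans (sym (partner-involutive k y)) (cong (partner k) (sym eq)))) (conj x))
              (subst (Linked _ x) eq (in-rest refl) ◅◅ linked-sym across ◅◅ in-rest (edge-second k e))

    loops-≤-rest : ∀ {st′} → Agree e st st′ → loops st′ ≤ N
    loops-≤-rest {st′} a with Maybe.≡-dec Bool._≟_ (st′ e) kind
    ... | yes eq = ℕ.≤-reflexive (loops-same a eq)
    ... | no neq = subst (loops st′ ≤_) (sym (loops-other a neq)) (ℕ.n≤1+n _)

    rest-≤-loops : ∀ {st′} → Agree e st st′ → N ≤ suc (loops st′)
    rest-≤-loops {st′} a with Maybe.≡-dec Bool._≟_ (st′ e) kind
    ... | yes eq = subst (_≤ suc (loops st′)) (loops-same a eq) (ℕ.n≤1+n _)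
    ... | no neq = ℕ.≤-reflexive (loops-other a neq)

  ribbons : Subset #E → State G
  ribbons A e = if lookup A e then just (twisted e) else nothing

  edgePieces-ribbons : ∀ A e → edgePieces G A e ≡ kindPieces (ribbons A e) e
  edgePieces-ribbons A e with lookup A e | twisted e
  ... | false | _     = refl
  ... | true  | false = refl
  ... | true  | true  = refl

  bare : ℕ
  bare = length (bareVertices G)

  f-loops : ∀ A → f G A ≡ loops (ribbons A) ℕ.+ bare
  f-loops A = cong (ℕ._+ bare) (components-cong (_≟ᶜ_ G) (corners-complete G) (linked-mono to) (linked-mono from))
    where
    to : ∀ {p} → p ∈ boundary G A → p ∈ layers G (ribbons A) (allFin #E)
    to {p} m with ∈.∈-++⁻ (vertexPieces G) m
    ... | inj₁ v = ∈-layers⁺ˡ G (ribbons A) (allFin #E) v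
    ... | inj₂ q with ∈.∈-concatMap⁻ (edgePieces G A) {xs = allFin #E} q
    ...   | r with find r
    ...     | e , e∈ , s = ∈-layers⁺ʳ G (ribbons A) e∈ (subst (p ∈_) (edgePieces-ribbons A e) s)
    from : ∀ {p} → p ∈ layers G (ribbons A) (allFin #E) → p ∈ boundary G A
    from {p} m with ∈-layers⁻ G (ribbons A) (allFin #E) m
    ... | inj₁ v = ∈.∈-++⁺ˡ v
    ... | inj₂ (e , e∈ , q) = ∈.∈-++⁺ʳ (vertexPieces G)
            (∈.∈-concatMap⁺ (edgePieces G A) {xs = allFin #E} (lose e∈ (subst (p ∈_) (sym (edgePieces-ribbons A e)) q)))

  end-next : ∀ h → end (Inverse.to next h) ≡ end h
  end-next h = sym (Equivalence.from (cyclic h _) (fwd refl ◅ ε))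

  Adjacent : Subset #E → Fin #V → Fin #V → Set
  Adjacent A = Linked (adjacencies G A)

  ∈-adjacencies⁺ : ∀ A {e} → lookup A e ≡ inside → (end (e , false) , end (e , true)) ∈ adjacencies G A
  ∈-adjacencies⁺ A {e} eq = ∈.∈-map⁺ _ (∈.∈-filter⁺ (λ e → lookup A e Bool.≟ inside) (∈.∈-allFin e) eq)

  ∈-adjacencies⁻ : ∀ A {p} → p ∈ adjacencies G A → ∃ λ e → lookup A e ≡ inside × p ≡ (end (e , false) , end (e , true))
  ∈-adjacencies⁻ A m with ∈.∈-map⁻ _ m
  ... | e , e∈ , eq = e , proj₂ (∈.∈-filter⁻ (λ e → lookup A e Bool.≟ inside) {xs = allFin #E} e∈) , eq

  at : Corner G → Fin #V
  at (h , _) = end h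

  -- A piece along a vertex disc or along the arc of an absent ribbon stays at one vertex, and a
  -- side of a present ribbon follows an edge of `A`.
  linked-adjacent : ∀ A {L x y} → Linked (layers G (ribbons A) L) x y → Adjacent A (at x) (at y)
  linked-adjacent A {L} = EqC.gfold (EqC.isEquivalence _) at piece
    where
    piece : ∀ {x y} → (x , y) ∈ layers G (ribbons A) L → Adjacent A (at x) (at y)
    piece m with ∈-layers⁻ G (ribbons A) L m
    piece m | inj₁ v with ∈.∈-map⁻ (vertexPiece G) v
    ... | h , _ , refl = subst (Adjacent A (end h)) (sym (end-next h)) ε
    piece m | inj₂ (e , _ , q) with lookup A e in eq
    piece m | inj₂ (e , _ , here refl)         | false = ε
    piece m | inj₂ (e , _ , there (here refl)) | false = ε
    piece m | inj₂ (e , _ , here refl)         | true = link (∈-adjacencies⁺ A eq)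
    piece m | inj₂ (e , _ , there (here refl)) | true = link (∈-adjacencies⁺ A eq)

  module _ (A : Subset #E) (e : Fin #E) (e∉A : lookup A e ≡ outside) where

    private
      A⁺ = A [ e ]≔ inside
      u = end (e , false)
      v = end (e , true)

    insert-adjacent⁺ : ∀ {a b} → Linked ((u , v) ∷ adjacencies G A) a b → Adjacent A⁺ a b
    insert-adjacent⁺ = linked-mono λ where
        (here refl) → ∈-adjacencies⁺ A⁺ (Vec.lookup∘update e A inside)
        (there m)   → step m
      where
      step : ∀ {p} → p ∈ adjacencies G A → p ∈ adjacencies G A⁺
      step m with ∈-adjacencies⁻ A m
      ... | e′ , e′∈ , refl with e′ Fin.≟ e
      ...   | yes refl = ∈-adjacencies⁺ A⁺ (Vec.lookup∘update e A inside)
      ...   | no e′≢e  = ∈-adjacencies⁺ A⁺ (trans (Vec.lookup∘update′ e′≢e A inside) e′∈)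

    insert-adjacent⁻ : ∀ {a b} → Adjacent A⁺ a b → Linked ((u , v) ∷ adjacencies G A) a b
    insert-adjacent⁻ = linked-mono step
      where
      step : ∀ {p} → p ∈ adjacencies G A⁺ → p ∈ (u , v) ∷ adjacencies G A
      step m with ∈-adjacencies⁻ A⁺ m
      ... | e′ , e′∈ , refl with e′ Fin.≟ e
      ...   | yes refl = here refl
      ...   | no e′≢e  = there (∈-adjacencies⁺ A (trans (sym (Vec.lookup∘update′ e′≢e A inside)) e′∈))

    c-bridge : ¬ Adjacent A u v → c G A ≡ suc (c G A⁺)
    c-bridge u≁v = trans (components-cut Fin._≟_ ∈.∈-allFin u≁v)
      (cong suc (components-cong Fin._≟_ ∈.∈-allFin insert-adjacent⁺ insert-adjacent⁻))

    c-cycle : Adjacent A u v → c G A⁺ ≡ c G A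
    c-cycle u~v = trans (components-cong Fin._≟_ ∈.∈-allFin insert-adjacent⁻ insert-adjacent⁺)
      (components-join Fin._≟_ ∈.∈-allFin u~v)

    insert-agree : Agree e (ribbons A) (ribbons A⁺)
    insert-agree = agrees λ e′ e′≢e → cong (if_then just (twisted e′) else nothing) (Vec.lookup∘update′ e′≢e A inside)

    ribbons-e : ribbons A e ≡ nothing
    ribbons-e = cong (if_then just (twisted e) else nothing) e∉A

    ribbons⁺-e : ribbons A⁺ e ≡ just (twisted e)
    ribbons⁺-e = cong (if_then just (twisted e) else nothing) (Vec.lookup∘update e A inside)

    private
      local = skein (ribbons A) e
      open Skein local

    -- The other kinds would lead from one end of `e` to the other along the remaining boundary, and
    -- so through edges of `A`.
    bridge-kind : ¬ Adjacent A u v → kind ≡ nothing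
    bridge-kind u≁v with kind | rest-linked {first e} refl
    ... | nothing | _ = refl
    ... | just _  | l = ⊥-elim (u≁v (linked-adjacent A {others e} l))

    loops-bridge : ¬ Adjacent A u v → loops (ribbons A) ≡ suc (loops (ribbons A⁺))
    loops-bridge u≁v = trans (loops-same local (agrees λ _ _ → refl) (trans ribbons-e (sym (bridge-kind u≁v))))
      (loops-other local insert-agree λ eq → absurd (trans (sym ribbons⁺-e) (trans eq (bridge-kind u≁v))))
      where
      absurd : ¬ (just (twisted e) ≡ nothing)
      absurd ()

    loops-insert-≤ : loops (ribbons A⁺) ≤ suc (loops (ribbons A))
    loops-insert-≤ = ℕ.≤-trans (loops-≤-rest local insert-agree) (rest-≤-loops local (agrees λ _ _ → refl))

  -- With all ribbons absent, the boundary runs around the vertex disc past all half-edges of the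
  -- cycle of `next`.
  end-linked : ∀ {st L} → (∀ e → st e ≡ nothing) → (∀ e → e ∈ L) → ∀ {x y} → at x ≡ at y → Linked (layers G st L) x y
  end-linked {st} {L} absent full {h , s} {h′ , s′} eq =
      arc h s ◅◅ EqC.gfold (EqC.isEquivalence _) (_, true) step (Equivalence.to (cyclic h h′) eq) ◅◅ linked-sym (arc h′ s′)
    where
    arc′ : ∀ h → Linked (layers G st L) (h , false) (h , true)
    arc′ h@(e , _) = linked-mono (∈-layers⁺ʳ G st (full e))
      (subst (λ k → Linked (kindPieces k e) (h , false) (partner nothing (h , false))) (sym (absent e))
          (kindPieces-linked nothing (h , false)))
    arc : ∀ h s → Linked (layers G st L) (h , s) (h , true)
    arc h false = arc′ h
    arc h true  = ε
    step : ∀ {h h′} → Inverse.to next h ≡ h′ → Linked (layers G st L) (h , true) (h′ , true)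
    step {h} refl = link (∈-layers⁺ˡ G st L (vertexPiece-∈ G h)) ◅◅ arc′ _

  ribbons-⊥ : ∀ e → ribbons ⊥ e ≡ nothing
  ribbons-⊥ e = cong (if_then just (twisted e) else nothing) (Vec.lookup-replicate e outside)

  bareVertices-bare : ∀ {v h} → v ∈ bareVertices G → end h ≢ v
  bareVertices-bare {v} {h} v∈ refl =
    proj₂ (∈.∈-filter⁻ (λ v → ¬? (v ∈? map end (halfEdges G))) {xs = allFin #V} v∈)
      (∈.∈-map⁺ end (halfEdges-complete G h))
    where open import Data.List.Membership.DecPropositional Fin._≟_ using (_∈?_)

  bareVertices-unique : Unique (bareVertices G)
  bareVertices-unique = Unique.filter⁺ (λ v → ¬? (v ∈? map end (halfEdges G))) (Unique.allFin⁺ #V)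
    where open import Data.List.Membership.DecPropositional Fin._≟_ using (_∈?_)

  f-⊥ : f G ⊥ ≤ #V
  f-⊥ = subst (_≤ #V) (sym (f-loops ⊥))
    (quotient-+-≤ (components-quotient (_≟ᶜ_ G) (corners-complete G) (layers G (ribbons ⊥) (allFin #E))) at
      (end-linked ribbons-⊥ ∈.∈-allFin) bareVertices-unique λ {x} → bareVertices-bare {h = proj₁ x})

  c-⊥ : c G ⊥ ≡ #V
  c-⊥ = quotient-unique (components-quotient Fin._≟_ ∈.∈-allFin (adjacencies G ⊥)) identity
      (linked-respects id λ m → ⊥-elim (none m)) λ { refl → ε }
    where
    none : ∀ {p} → ¬ (p ∈ adjacencies G ⊥)
    none m with ∈-adjacencies⁻ ⊥ m
    ... | e , eq , _ with () ← trans (sym eq) (Vec.lookup-replicate e outside)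
    identity : Quotient _≡_ #V
    identity = record { class = id ; rep = id ; class-rep = λ _ → refl ; sound = id ; complete = id }

  adjacent? : ∀ A u v → Dec (Adjacent A u v)
  adjacent? A = linked? Fin._≟_ (adjacencies G A)

  f-insert : ∀ A e → lookup A e ≡ outside → f G (A [ e ]≔ inside) ≤ suc (f G A)
  f-insert A e e∉ = shift-≤ (f-loops (A [ e ]≔ inside)) (f-loops A) (loops-insert-≤ A e e∉)
    where
    shift-≤ : ∀ {f f′ l l′ b} → f′ ≡ l′ ℕ.+ b → f ≡ l ℕ.+ b → l′ ≤ suc l → f′ ≤ suc f
    shift-≤ {b = b} refl refl = ℕ.+-monoˡ-≤ b

  f-bridge : ∀ A e → lookup A e ≡ outside → ¬ Adjacent A (end (e , false)) (end (e , true)) →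
      f G A ≡ suc (f G (A [ e ]≔ inside))
  f-bridge A e e∉ u≁v = shift-≡ (f-loops (A [ e ]≔ inside)) (f-loops A) (loops-bridge A e e∉ u≁v)
    where
    shift-≡ : ∀ {f f′ l l′ b} → f′ ≡ l′ ℕ.+ b → f ≡ l ℕ.+ b → l ≡ suc l′ → f ≡ suc f′
    shift-≡ refl refl refl = refl

  -- The Euler genus of every spanning subgraph is nonnegative, with the
  -- negative terms moved to the other side.
  euler-≤ : ∀ A → #V ℕ.+ f G A ≤ c G A ℕ.+ c G A ℕ.+ ∣ A ∣
  euler-≤ = subset-ascent _ base step
    where
    base : #V ℕ.+ f G ⊥ ≤ c G ⊥ ℕ.+ c G ⊥ ℕ.+ ∣ ⊥ {#E} ∣
    base = bound c-⊥ (Subset.∣⊥∣≡0 #E) f-⊥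
      where
      bound : ∀ {v c f a} → c ≡ v → a ≡ 0 → f ≤ v → v ℕ.+ f ≤ c ℕ.+ c ℕ.+ a
      bound {v} refl refl f≤ = ℕ.≤-trans (ℕ.+-monoʳ-≤ v f≤) (ℕ.m≤m+n (v ℕ.+ v) 0)
    step : ∀ A e → lookup A e ≡ outside → #V ℕ.+ f G A ≤ c G A ℕ.+ c G A ℕ.+ ∣ A ∣ →
           let A⁺ = A [ e ]≔ inside in #V ℕ.+ f G A⁺ ≤ c G A⁺ ℕ.+ c G A⁺ ℕ.+ ∣ A⁺ ∣
    -- An edge within a component raises the right side by 1 and the left side by at most 1; a
    -- bridge lowers both sides by 1.
    step A e e∉ ih with adjacent? A (end (e , false)) (end (e , true))
    ... | yes u~v = cycle-step #V (c-cycle A e e∉ u~v) (f-insert A e e∉) (∣insert∣ A e e∉) ih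
      where
      cycle-step : ∀ v {c c′ f f′ a a′} → c′ ≡ c → f′ ≤ suc f → a′ ≡ suc a → v ℕ.+ f ≤ c ℕ.+ c ℕ.+ a →
          v ℕ.+ f′ ≤ c′ ℕ.+ c′ ℕ.+ a′
      cycle-step v {c} {f = f} {a = a} refl f′≤ refl ih = ℕ.≤-trans (ℕ.+-monoʳ-≤ v f′≤)
        (subst₂ _≤_ (sym (ℕ.+-suc v f)) (sym (ℕ.+-suc (c ℕ.+ c) a)) (s≤s ih))
    ... | no u≁v = bridge-step #V (c-bridge A e e∉ u≁v) (f-bridge A e e∉ u≁v) (∣insert∣ A e e∉) ih
      where
      bridge-step : ∀ v {c c′ f f′ a a′} → c ≡ suc c′ → f ≡ suc f′ → a′ ≡ suc a → v ℕ.+ f ≤ c ℕ.+ c ℕ.+ a →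
          v ℕ.+ f′ ≤ c′ ℕ.+ c′ ℕ.+ a′
      bridge-step v {c′ = c} {f′ = f} {a} refl refl refl ih = ℕ.s≤s⁻¹ (subst₂ _≤_ (ℕ.+-suc v f)
        (cong suc (trans (cong (ℕ._+ a) (ℕ.+-suc c c)) (sym (ℕ.+-suc (c ℕ.+ c) a)))) ih)

  -- Nonnegativity of the nullity n(A), by which the exponent of `y` in `R` is a natural number.
  rank-≤ : ∀ A → #V ≤ c G A ℕ.+ ∣ A ∣
  rank-≤ = subset-ascent _ (ℕ.≤-trans (ℕ.≤-reflexive (sym c-⊥)) (ℕ.m≤m+n (c G ⊥) _)) step
    where
    step : ∀ A e → lookup A e ≡ outside → #V ≤ c G A ℕ.+ ∣ A ∣ →
           let A⁺ = A [ e ]≔ inside in #V ≤ c G A⁺ ℕ.+ ∣ A⁺ ∣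
    step A e e∉ ih with adjacent? A (end (e , false)) (end (e , true))
    ... | yes u~v = cycle-step (c-cycle A e e∉ u~v) (∣insert∣ A e e∉) ih
      where
      cycle-step : ∀ {v c c′ a a′} → c′ ≡ c → a′ ≡ suc a → v ≤ c ℕ.+ a → v ≤ c′ ℕ.+ a′
      cycle-step {c = c} refl refl ih = ℕ.≤-trans ih (ℕ.+-monoʳ-≤ c (ℕ.n≤1+n _))
    ... | no u≁v = bridge-step (c-bridge A e e∉ u≁v) (∣insert∣ A e e∉) ih
      where
      bridge-step : ∀ {v c c′ a a′} → c ≡ suc c′ → a′ ≡ suc a → v ≤ c ℕ.+ a → v ≤ c′ ℕ.+ a′
      bridge-step {v} {c′ = c} {a} refl refl ih = subst (v ≤_) (sym (ℕ.+-suc c a)) ih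

  -- Deleting an edge does not raise the Euler genus, so a bound by 0 passes from G to every
  -- spanning subgraph. With `euler-≤` it becomes Euler's formula for all of them.
  euler-≥ : c G ⊤ ℕ.+ c G ⊤ ℕ.+ #E ≤ #V ℕ.+ f G ⊤ → ∀ A → c G A ℕ.+ c G A ℕ.+ ∣ A ∣ ≤ #V ℕ.+ f G A
  euler-≥ flat = subset-descent _ (subst (λ m → c G ⊤ ℕ.+ c G ⊤ ℕ.+ m ≤ #V ℕ.+ f G ⊤) (sym (Subset.∣⊤∣≡n #E)) flat) step
    where
    step : ∀ A e → lookup A e ≡ outside → let A⁺ = A [ e ]≔ inside in c G A⁺ ℕ.+ c G A⁺ ℕ.+ ∣ A⁺ ∣ ≤ #V ℕ.+ f G A⁺ →
           c G A ℕ.+ c G A ℕ.+ ∣ A ∣ ≤ #V ℕ.+ f G A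
    step A e e∉ ih with adjacent? A (end (e , false)) (end (e , true))
    ... | yes u~v = cycle-step #V (c-cycle A e e∉ u~v) (f-insert A e e∉) (∣insert∣ A e e∉) ih
      where
      cycle-step : ∀ v {c c′ f f′ a a′} → c′ ≡ c → f′ ≤ suc f → a′ ≡ suc a → c′ ℕ.+ c′ ℕ.+ a′ ≤ v ℕ.+ f′ →
          c ℕ.+ c ℕ.+ a ≤ v ℕ.+ f
      cycle-step v {c} {f = f} {a = a} refl f′≤ refl ih = ℕ.s≤s⁻¹
        (subst₂ _≤_ (ℕ.+-suc (c ℕ.+ c) a) (ℕ.+-suc v f) (ℕ.≤-trans ih (ℕ.+-monoʳ-≤ v f′≤)))
    ... | no u≁v = bridge-step #V (c-bridge A e e∉ u≁v) (f-bridge A e e∉ u≁v) (∣insert∣ A e e∉) ih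
      where
      bridge-step : ∀ v {c c′ f f′ a a′} → c ≡ suc c′ → f ≡ suc f′ → a′ ≡ suc a → c′ ℕ.+ c′ ℕ.+ a′ ≤ v ℕ.+ f′ →
          c ℕ.+ c ℕ.+ a ≤ v ℕ.+ f
      bridge-step v {c′ = c} {f′ = f} {a} refl refl refl ih = subst₂ _≤_
        (cong suc (trans (ℕ.+-suc (c ℕ.+ c) a) (cong (ℕ._+ a) (sym (ℕ.+-suc c c))))) (sym (ℕ.+-suc v f)) (s≤s ih)

-- Potentials on plane graphs

module _ {a} (M : CommutativeMonoid a a) where
  open CommutativeMonoid M using (Carrier; _≈_; ∙-congˡ; ∙-congʳ; identityˡ; identityʳ) renaming (ε to 0#; trans to ≈-trans)
  open Summation M

  sum-zero : ∀ {n} (t : Fin n → Carrier) → (∀ i → t i ≈ 0#) → sum t ≈ 0#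
  sum-zero {n} t zeros = ≈-trans (sum-cong-≋ zeros) (sum-replicate-zero n)

  sum-single : ∀ {n} (t : Fin n → Carrier) i → (∀ j → j ≢ i → t j ≈ 0#) → sum t ≈ t i
  sum-single t zero    off = ≈-trans (∙-congˡ (sum-zero (t ∘ suc) λ j → off (suc j) λ ())) (identityʳ (t zero))
  sum-single t (suc i) off = ≈-trans (∙-congʳ (off zero λ ()))
    (≈-trans (identityˡ _) (sum-single (t ∘ suc) i λ j j≢i → off (suc j) (j≢i ∘ Fin.suc-injective)))

Xor-monoid : CommutativeMonoid _ _
Xor-monoid = CommutativeRing.+-commutativeMonoid Bool.xor-∧-commutativeRing

module Xor = Summation Xor-monoid

xor≡false : ∀ {a b} → a xor b ≡ false → a ≡ b
xor≡false {false} {false} _ = refl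
xor≡false {true}  {true}  _ = refl

≡⇒xor : ∀ {a b} → a ≡ b → a xor b ≡ false
≡⇒xor {a} refl = Bool.xor-same a

module _ where
  open Bool.xor-∧-Solver

  xor-exchange : ∀ a b c d → (a xor b) xor (c xor d) ≡ (a xor d) xor (b xor c)
  xor-exchange = solve 4 (λ a b c d → (a :+ b) :+ (c :+ d) := (a :+ d) :+ (b :+ c)) refl

  xor-square : ∀ a b c d {s} → a xor d ≡ s → b xor c ≡ s → (a xor b) xor (c xor d) ≡ false
  xor-square a b c d p refl = trans (xor-exchange a b c d) (≡⇒xor p)

  xor-cancel : ∀ a b → a xor (a xor b) ≡ b
  xor-cancel = solve 2 (λ a b → a :+ (a :+ b) := b) refl

  xor-shift : ∀ a b d → (a xor d) xor (b xor d) ≡ a xor b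
  xor-shift = solve 3 (λ a b d → (a :+ d) :+ (b :+ d) := a :+ b) refl

  xor-transfer : ∀ {a b c d s} → a xor b ≡ s → c xor d ≡ s → a ≡ c → b ≡ d
  xor-transfer {a} {b} {d = d} refl q refl = trans (sym (xor-cancel a b)) (trans (cong (a xor_) (sym q)) (xor-cancel a d))

  xor-swap : ∀ a b k l → a xor b ≡ k xor l → a xor k ≡ b xor l
  xor-swap a b k l eq =
      xor≡false (trans (solve 4 (λ a b k l → (a :+ k) :+ (b :+ l) := (a :+ b) :+ (k :+ l)) refl a b k l) (≡⇒xor eq))

  xor-nots : ∀ a b → not a xor not b ≡ a xor b
  xor-nots = solve 2 (λ a b → (con true :+ a) :+ (con true :+ b) := a :+ b) refl

halves : ∀ m → Fin (m ℕ.* 2) ↔ HalfEdge m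
halves m = mk↔ₛ′ (λ i → let (e , b) = remQuot 2 i in e , Inverse.to Fin.2↔Bool b)
  (λ (e , b) → Fin.combine e (Inverse.from Fin.2↔Bool b))
  (λ (e , b) → trans (cong (λ (e , b) → e , Inverse.to Fin.2↔Bool b) (Fin.remQuot-combine e (Inverse.from Fin.2↔Bool b)))
                     (cong (e ,_) (Inverse.strictlyInverseˡ Fin.2↔Bool b)))
  (λ i → let (e , b) = remQuot {m} 2 i in
         trans (cong (Fin.combine e) (Inverse.strictlyInverseʳ Fin.2↔Bool b)) (Fin.combine-remQuot {m} 2 i))

xorSum-halves : ∀ m (t : HalfEdge m → Bool) →
                Xor.sum (t ∘ Inverse.to (halves m)) ≡ Xor.sum (λ e → t (e , false) xor t (e , true))
xorSum-halves zero    t = refl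
xorSum-halves (suc m) t = trans
  (cong (λ s → t (zero , false) xor (t (zero , true) xor s)) (xorSum-halves m (λ (e , b) → t (suc e , b))))
  (sym (Bool.xor-assoc (t (zero , false)) _ _))

-- `next` permutes the half-edges, so `g` and its composite with `next` have the same sum.
xorSum-next : ∀ {m} (next : HalfEdge m ↔ HalfEdge m) (g : HalfEdge m → Bool) →
              Xor.sum (λ e → (g (e , false) xor g (Inverse.to next (e , false)))
                         xor (g (e , true) xor g (Inverse.to next (e , true)))) ≡ false
xorSum-next {m} next g = begin
  Xor.sum (λ e → d (e , false) xor d (e , true))                       ≡⟨ xorSum-halves m d ⟨
  Xor.sum (d ∘ half)                                                   ≡⟨ Xor.∑-distrib-+ (g ∘ half)
      (g ∘ Inverse.to next ∘ half) ⟩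
  Xor.sum (g ∘ half) xor Xor.sum (g ∘ Inverse.to next ∘ half)          ≡⟨ cong
      (_xor Xor.sum (g ∘ Inverse.to next ∘ half)) (Xor.sum-permute (g ∘ half) π) ⟩
  Xor.sum (g ∘ half ∘ Inverse.to π) xor Xor.sum (g ∘ Inverse.to next ∘ half)
    ≡⟨ cong (_xor Xor.sum (g ∘ Inverse.to next ∘ half))
        (Xor.sum-cong-≗ λ i → cong g (Inverse.strictlyInverseˡ (halves m) (Inverse.to next (half i)))) ⟩
  Xor.sum (g ∘ Inverse.to next ∘ half) xor Xor.sum (g ∘ Inverse.to next ∘ half)
      ≡⟨ Bool.xor-same (Xor.sum (g ∘ Inverse.to next ∘ half)) ⟩
  false                                                                ∎
  where
  open ≡-Reasoning
  d = λ h → g h xor g (Inverse.to next h)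
  half = Inverse.to (halves m)
  π : Fin (m ℕ.* 2) ↔ Fin (m ℕ.* 2)
  π = ↔-sym (halves m) ↔-∘ (next ↔-∘ halves m)

-- The corners of a ribbon form a quadrilateral: equal changes along its two sides force equal
-- changes along its two ends.
sides-cancel : ∀ {m} (φ : HalfEdge m × Bool → Bool) e t {s} →
               φ ((e , false) , false) xor φ (partner (just t) ((e , false) , false)) ≡ s →
               φ ((e , false) , true) xor φ (partner (just t) ((e , false) , true)) ≡ s →
               (φ ((e , false) , false) xor φ ((e , false) , true)) xor
                   (φ ((e , true) , false) xor φ ((e , true) , true)) ≡ false
sides-cancel φ e false p q = xor-square (φ ((e , false) , false)) _ _ _ p q
sides-cancel φ e true  p q =
    trans (cong ((φ ((e , false) , false) xor φ ((e , false) , true)) xor_)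
    (Bool.xor-comm (φ ((e , true) , false)) _))
  (xor-square (φ ((e , false) , false)) _ _ _ p q)

arcs-even : ∀ {m} (φ : HalfEdge m × Bool → Bool) e t →
            φ ((e , false) , false) ≡ φ ((e , false) , true) →
            φ (partner (just t) ((e , false) , false)) ≡ φ (partner (just t) ((e , false) , true)) →
            ∀ i s → φ ((e , i) , s) xor φ ((e , i) , not s) ≡ false
arcs-even φ e t     p q false false = ≡⇒xor p
arcs-even φ e t     p q false true  = ≡⇒xor (sym p)
arcs-even φ e false p q true  false = ≡⇒xor (sym q)
arcs-even φ e false p q true  true  = ≡⇒xor q
arcs-even φ e true  p q true  false = ≡⇒xor q
arcs-even φ e true  p q true  true  = ≡⇒xor (sym q)

-- Tensions on boundary circles and potentials on vertices

module _ (G : RibbonGraph) where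
  open RibbonGraph G

  plane-flat : Plane G → c G ⊤ ℕ.+ c G ⊤ ℕ.+ #E ≡ #V ℕ.+ f G ⊤
  plane-flat (_ , genus) = flat (c G ⊤) #V #E (f G ⊤) genus
    where
    open import Data.Integer.Base using (+_)
    flat : ∀ c v e f → + 2 ℤ.* + c ℤ.- (+ v ℤ.- + e ℤ.+ + f) ≡ + 0 → c ℕ.+ c ℕ.+ e ≡ v ℕ.+ f
    flat c v e f eq = ℤ.+-injective (begin
      + c ℤ.+ + c ℤ.+ + e                      ≡⟨ rearrange₁ (+ c) (+ v) (+ e) (+ f) ⟩
      + 2 ℤ.* + c ℤ.- (+ v ℤ.- + e ℤ.+ + f) ℤ.+ (+ v ℤ.+ + f) ≡⟨ cong (ℤ._+ (+ v ℤ.+ + f)) eq ⟩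
      + 0 ℤ.+ (+ v ℤ.+ + f)                    ≡⟨ ℤ.+-identityˡ _ ⟩
      + v ℤ.+ + f                              ∎)
      where
      open ≡-Reasoning
      open ℤ.+-*-Solver renaming (solve to solveℤ; _:=_ to _:=ℤ_; _:+_ to _:+ℤ_; con to conℤ)
      rearrange₁ : ∀ c v e f → c ℤ.+ c ℤ.+ e ≡ + 2 ℤ.* c ℤ.- (v ℤ.- e ℤ.+ f) ℤ.+ (v ℤ.+ f)
      rearrange₁ = solveℤ 4 (λ c v e f → c :+ℤ c :+ℤ e :=ℤ conℤ (+ 2) :* c :- (v :- e :+ℤ f) :+ℤ (v :+ℤ f)) refl

  plane-euler : Plane G → ∀ A → #V ℕ.+ f G A ≡ c G A ℕ.+ c G A ℕ.+ ∣ A ∣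
  plane-euler plane A = ℕ.≤-antisym (euler-≤ G A) (euler-≥ G (ℕ.≤-reflexive (plane-flat plane)) A)

  absent : ∀ A e (φ : Corner G → Bool) x {b} → lookup A e ≡ outside → φ x xor φ (partner nothing x) ≡ false →
           φ x xor φ (partner (ribbons G A e) x) ≡ (if lookup A e then b else false)
  absent A e φ x eq p with lookup A e | eq
  ... | false | refl = p

  -- The existence of φ says that σ sums to zero around every boundary circle of (V(G) , A). Keeping
  -- the corners of absent ribbons, with φ constant along their arcs, leaves the domain of φ
  -- unchanged while `A` varies.
  record Tension (A : Subset #E) (σ : Fin #E → Bool) (φ : Corner G → Bool) : Set where
    field
      around : ∀ h → φ (h , true) ≡ φ (Inverse.to next h , false)
      across : ∀ x → φ x xor φ (partner (ribbons G A (edge x)) x) ≡ (if lookup A (edge x) then σ (edge x) else false)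

  open Tension

  Potential : (A : Subset #E) (σ : Fin #E → Bool) (κ : Fin #V → Bool) → Set
  Potential A σ κ = ∀ e → lookup A e ≡ inside → κ (end (e , false)) xor κ (end (e , true)) ≡ σ e

  potential-across : ∀ A κ {σ} → Potential A σ κ → ∀ x →
                     κ (at G x) xor κ (at G (partner (ribbons G A (edge x)) x)) ≡
                         (if lookup A (edge x) then σ (edge x) else false)
  potential-across A κ pot ((e , i) , s) with lookup A e in eq
  ... | false = Bool.xor-same (κ (end (e , i)))
  potential-across A κ pot ((e , false) , s) | true = pot e eq
  potential-across A κ pot ((e , true) , s)  | true = trans (Bool.xor-comm (κ (end (e , true))) _) (pot e eq)

  module _ (A : Subset #E) (e : Fin #E) (e∉A : lookup A e ≡ outside) {σ : Fin #E → Bool} {φ : Corner G → Bool} where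

    private
      A⁺ = A [ e ]≔ inside
      u = end (e , false)
      v = end (e , true)
      tw = just (twisted e)

    module _ (T : Tension A⁺ σ φ) where

      across-other : ∀ x → edge x ≢ e → φ x xor φ (partner (ribbons G A (edge x)) x) ≡
          (if lookup A (edge x) then σ (edge x) else false)
      across-other x x≢e = subst (λ b → φ x xor φ (partner (if b then just (twisted (edge x)) else nothing) x) ≡
          (if b then σ (edge x) else false))
        (Vec.lookup∘update′ x≢e A inside) (across T x)

      across-e : ∀ i s → φ ((e , i) , s) xor φ (partner tw ((e , i) , s)) ≡ σ e
      across-e i s = subst (λ b → φ ((e , i) , s) xor φ (partner (if b then tw else nothing) ((e , i) , s)) ≡
          (if b then σ e else false))
        (Vec.lookup∘update e A inside) (across T ((e , i) , s))

      -- Summing φ (h , false) + φ (h , true) over the half-edges h on one side of the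
      -- bridge e, everything cancels except the contribution of e.
      bridge-even : ¬ Adjacent G A u v → φ ((e , false) , false) xor φ ((e , false) , true) ≡ false
      bridge-even u≁v = begin
        φ ((e , false) , false) xor φ ((e , false) , true)      ≡⟨ sum-at-e ⟨
        d (e , false) xor d (e , true)                          ≡⟨ sum-single Xor-monoid
            (λ e′ → d (e′ , false) xor d (e′ , true)) e off ⟨
        Xor.sum (λ e′ → d (e′ , false) xor d (e′ , true))       ≡⟨ xorSum-next next g ⟩
        false                                                   ∎
        where
        open ≡-Reasoning
        side : HalfEdge #E → Bool
        side h = Dec.does (adjacent? G A u (end h))
        g : HalfEdge #E → Bool
        g h = if side h then φ (h , false) else false
        d : HalfEdge #E → Bool
        d h = g h xor g (Inverse.to next h)
        d-inside : ∀ h → Adjacent G A u (end h) → d h ≡ φ (h , false) xor φ (h , true)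
        d-inside h uh with adjacent? G A u (end h) | adjacent? G A u (end (Inverse.to next h))
        ... | yes _ | yes _ = cong (φ (h , false) xor_) (sym (around T h))
        ... | no ¬p | _     = ⊥-elim (¬p uh)
        ... | _     | no ¬q = ⊥-elim (¬q (subst (Adjacent G A u) (sym (end-next G h)) uh))
        d-outside : ∀ h → ¬ Adjacent G A u (end h) → d h ≡ false
        d-outside h u≁h with adjacent? G A u (end h) | adjacent? G A u (end (Inverse.to next h))
        ... | no _  | no _  = refl
        ... | yes p | _     = ⊥-elim (u≁h p)
        ... | _     | yes q = ⊥-elim (u≁h (subst (Adjacent G A u) (end-next G h) q))
        sum-at-e : d (e , false) xor d (e , true) ≡ φ ((e , false) , false) xor φ ((e , false) , true)
        sum-at-e = trans (cong₂ _xor_ (d-inside (e , false) ε) (d-outside (e , true) u≁v)) (Bool.xor-identityʳ _)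
        off : ∀ e′ → e′ ≢ e → d (e′ , false) xor d (e′ , true) ≡ false
        off e′ e′≢e with lookup A e′ in eq | (λ i s → across-other ((e′ , i) , s) e′≢e)
        ... | false | arcs = cong₂ _xor_ (d-half false (adjacent? G A u _)) (d-half true (adjacent? G A u _))
          where
          d-half : ∀ i → Dec (Adjacent G A u (end (e′ , i))) → d (e′ , i) ≡ false
          d-half i (yes p) = trans (d-inside (e′ , i) p) (arcs i false)
          d-half i (no ¬p) = d-outside (e′ , i) ¬p
        ... | true | sides = d-both (adjacent? G A u (end (e′ , false)))
          where
          d-both : Dec (Adjacent G A u (end (e′ , false))) → d (e′ , false) xor d (e′ , true) ≡ false
          d-both (no ¬p) = cong₂ _xor_ (d-outside (e′ , false) ¬p)
              (d-outside (e′ , true) (λ q → ¬p (q ◅◅ linked-sym (link (∈-adjacencies⁺ G A eq)))))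
          d-both (yes p) = trans
              (cong₂ _xor_ (d-inside (e′ , false) p) (d-inside (e′ , true) (p ◅◅ link (∈-adjacencies⁺ G A eq))))
              (sides-cancel φ e′ (twisted e′) (sides false false) (sides false true))

      -- By `bridge-even` φ is constant on both arcs of `e`, as the absence of the ribbon demands.
      bridge-tension : ¬ Adjacent G A u v → Tension A σ φ
      bridge-tension u≁v .around = around T
      bridge-tension u≁v .across x@((e′ , i) , s) with e′ Fin.≟ e
      ... | no e′≢e = across-other x e′≢e
      ... | yes refl = absent A e φ x e∉A (arcs-even φ e (twisted e) even
              (xor-transfer (across-e false false) (across-e false true) even) i s)
        where
        even = xor≡false (bridge-even u≁v)

      -- If κ has the wrong change along `e`, complementing it on the component of `u` in `A`
      -- repairs this and disturbs no edge of `A`.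
      bridge-potential : ¬ Adjacent G A u v → ∃ (Potential A σ) → ∃ (Potential A⁺ σ)
      bridge-potential u≁v (κ , pot) with (κ u xor κ v) Bool.≟ σ e
      ... | yes fits = κ , λ e′ → extend e′
        where
        extend : Potential A⁺ σ κ
        extend e′ e′∈ with e′ Fin.≟ e
        ... | yes refl = fits
        ... | no e′≢e  = pot e′ (trans (sym (Vec.lookup∘update′ e′≢e A inside)) e′∈)
      ... | no misfit = κ′ , extend
        where
        κ′ : Fin #V → Bool
        κ′ w = if Dec.does (adjacent? G A u w) then not (κ w) else κ w
        extend : Potential A⁺ σ κ′
        extend e′ e′∈ with e′ Fin.≟ e
        ... | yes refl with adjacent? G A u u | adjacent? G A u v
        ...   | no ¬p | _     = ⊥-elim (¬p ε)
        ...   | _     | yes q = ⊥-elim (u≁v q)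
        ...   | yes _ | no _  = trans (sym (Bool.not-distribˡ-xor (κ u) (κ v)))
                  (trans (cong not (Bool.¬-not misfit)) (Bool.not-involutive _))
        extend e′ e′∈ | no e′≢e with trans (sym (Vec.lookup∘update′ e′≢e A inside)) e′∈
        ... | e′∈A with adjacent? G A u (end (e′ , false)) | adjacent? G A u (end (e′ , true))
        ...   | no _  | no _  = pot e′ e′∈A
        ...   | yes p | no ¬q = ⊥-elim (¬q (p ◅◅ link (∈-adjacencies⁺ G A e′∈A)))
        ...   | no ¬p | yes q = ⊥-elim (¬p (q ◅◅ linked-sym (link (∈-adjacencies⁺ G A e′∈A))))
        ...   | yes _ | yes _ = trans (xor-nots (κ (end (e′ , false))) (κ (end (e′ , true)))) (pot e′ e′∈A)

      private
        S = skein G (ribbons G A) e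
        x₀ = first e
        y₀ : Corner G
        y₀ = (e , false) , true

      module _ (kind≡ : Skein.kind S ≡ tw) where

        private
          paired : ∀ {x} → edge x ≡ e → Linked (rest G (ribbons G A) e) x (partner tw x)
          paired {x} ex = subst (λ k → Linked (rest G (ribbons G A) e) x (partner k x)) kind≡ (Skein.rest-linked S ex)
          only : ∀ {x y} → edge x ≡ e → edge y ≡ e → Linked (rest G (ribbons G A) e) x y → y ≡ x ⊎ y ≡ partner tw x
          only {x} {y} ex ey l = subst (λ k → y ≡ x ⊎ y ≡ partner k x) kind≡ (Skein.rest-only S ex ey l)
          linked₀? = linked? (_≟ᶜ_ G) (rest G (ribbons G A) e) x₀
          δ = φ x₀ xor φ y₀

        -- Shifting φ by a constant along the path from x₀ makes it constant on
        -- the two arcs of e.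
        shifted : Corner G → Bool
        shifted x = if Dec.does (linked₀? x) then φ x xor δ else φ x

        shifted-in : ∀ {x} → Linked (rest G (ribbons G A) e) x₀ x → shifted x ≡ φ x xor δ
        shifted-in {x} l with linked₀? x
        ... | yes _ = refl
        ... | no ¬l = ⊥-elim (¬l l)

        shifted-out : ∀ {x} → ¬ Linked (rest G (ribbons G A) e) x₀ x → shifted x ≡ φ x
        shifted-out {x} ¬l with linked₀? x
        ... | yes l = ⊥-elim (¬l l)
        ... | no _  = refl

        shifted-xor : ∀ {x y} → Linked (rest G (ribbons G A) e) x y → shifted x xor shifted y ≡ φ x xor φ y
        shifted-xor {x} {y} xy with linked₀? x | linked₀? y
        ... | yes _ | yes _ = xor-shift (φ x) (φ y) δ
        ... | no _  | no _  = refl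
        ... | yes p | no ¬q = ⊥-elim (¬q (p ◅◅ xy))
        ... | no ¬p | yes q = ⊥-elim (¬p (q ◅◅ linked-sym xy))

        -- The shift by δ equalises `x₀` and `y₀`, since `y₀` is not on the path from `x₀`. The far
        -- ends follow because the changes along both sides are `σ e`.
        shifted-arc : shifted x₀ ≡ shifted y₀ × shifted (partner tw x₀) ≡ shifted (partner tw y₀)
        shifted-arc = first-arc , second-arc
          where
          first-arc = trans (shifted-in ε) (trans (xor-cancel (φ x₀) (φ y₀))
            (sym (shifted-out λ l → Sum.[ (λ ()) , y₀≢ (twisted e) ] (only refl refl l))))
            where
            y₀≢ : ∀ t → y₀ ≢ partner (just t) x₀
            y₀≢ true  ()
            y₀≢ false ()
          shifted-side : ∀ s → shifted ((e , false) , s) xor shifted (partner tw ((e , false) , s)) ≡ σ e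
          shifted-side s = trans (shifted-xor (paired refl)) (across-e false s)
          second-arc = xor-transfer (shifted-side false) (shifted-side true) first-arc

        cycle-tension : Tension A σ shifted
        cycle-tension .around h =
            xor≡false (trans (shifted-xor (link (∈-layers⁺ˡ G (ribbons G A) (others G e) (vertexPiece-∈ G h))))
            (≡⇒xor (around T h)))
        cycle-tension .across x@((e′ , i) , s) with e′ Fin.≟ e
        ... | no e′≢e = trans
                (shifted-xor (linked-mono (∈-layers⁺ʳ G (ribbons G A) (∈-others G e′≢e))
                (kindPieces-linked (ribbons G A e′) x))) (across-other x e′≢e)
        ... | yes refl = absent A e shifted x e∉A
                (arcs-even shifted e (twisted e) (proj₁ shifted-arc) (proj₂ shifted-arc) i s)

        -- The sum of φ and κ is constant along the remaining boundary, because both change alike on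
        -- every piece. That boundary joins the two ends of a side of `e`, so κ changes along `e` as
        -- φ does, by `σ e`.
        cycle-potential : ∀ {κ} → Potential A σ κ → Potential A⁺ σ κ
        cycle-potential {κ} pot e′ e′∈ with e′ Fin.≟ e
        ... | no e′≢e  = pot e′ (trans (sym (Vec.lookup∘update′ e′≢e A inside)) e′∈)
        ... | yes refl = trans (sym (xor-swap (φ x₀) (κ u) (φ (partner tw x₀)) (κ v) constant)) (across-e false false)
          where
          constant : φ x₀ xor κ u ≡ φ (partner tw x₀) xor κ v
          constant = linked-respects (λ x → φ x xor κ (at G x)) piece (paired {x₀} refl)
            where
            piece : ∀ {x y} → (x , y) ∈ rest G (ribbons G A) e → φ x xor κ (at G x) ≡ φ y xor κ (at G y)
            piece {x} m with ∈-layers⁻ G (ribbons G A) (others G e) m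
            piece m | inj₁ w with ∈.∈-map⁻ (vertexPiece G) w
            ... | h , _ , refl = cong₂ _xor_ (around T h) (cong κ (sym (end-next G h)))
            piece {x} m | inj₂ (e′ , e′∈ , q) with kindPieces-partner q
            ... | refl , refl = xor-swap (φ x) _ (κ (at G x)) _
              (trans (across-other x (λ eq → ∉-others G eq e′∈)) (sym (potential-across A κ pot x)))

  -- Euler's formula for `A` and `A⁺` gives one more boundary circle after the insertion. If the
  -- ribbon were not of the kind of the skein, the count for the rest would exceed that for `A` by
  -- 2, while it can exceed it by at most 1.
  cycle-kind : Plane G → ∀ A e → lookup A e ≡ outside → Adjacent G A (end (e , false)) (end (e , true)) →
               Skein.kind (skein G (ribbons G A) e) ≡ just (twisted e)
  cycle-kind plane A e e∉ u~v = face-kind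
    where
    A⁺ = A [ e ]≔ inside
    S = skein G (ribbons G A) e
    more : loops G (ribbons G A⁺) ≡ suc (loops G (ribbons G A))
    more = compare #V (bare G) (plane-euler plane A) (plane-euler plane A⁺) (c-cycle G A e e∉ u~v)
        (∣insert∣ A e e∉) (f-loops G A) (f-loops G A⁺)
      where
      compare : ∀ v b {f f′ c c′ a a′ l l′} → v ℕ.+ f ≡ c ℕ.+ c ℕ.+ a → v ℕ.+ f′ ≡ c′ ℕ.+ c′ ℕ.+ a′ → c′ ≡ c → a′ ≡ suc a →
                f ≡ l ℕ.+ b → f′ ≡ l′ ℕ.+ b → l′ ≡ suc l
      compare v b {c = c} {a = a} {l = l} {l′} p q refl refl refl refl = ℕ.+-cancelʳ-≡ b l′ (suc l) (ℕ.+-cancelˡ-≡ v _ _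
        (trans q (trans (ℕ.+-suc (c ℕ.+ c) a) (trans (cong suc (sym p)) (sym (ℕ.+-suc v (l ℕ.+ b)))))))
    face-kind : Skein.kind S ≡ just (twisted e)
    face-kind with Maybe.≡-dec Bool._≟_ (just (twisted e)) (Skein.kind S)
    ... | yes eq = sym eq
    ... | no neq = ⊥-elim
            (ℕ.1+n≰n (ℕ.≤-trans (ℕ.≤-reflexive
            (sym (trans (loops-other G S (insert-agree G A e e∉)
            (λ eq → neq (trans (sym (ribbons⁺-e G A e e∉)) eq))) (cong suc more))))
            (rest-≤-loops G S (agrees λ _ _ → refl))))

  potential : Plane G → ∀ A {σ φ} → Tension A σ φ → ∃ (Potential A σ)
  -- The induction ranges over all φ at once, since deleting an edge within a component replaces φ
  -- by a shifted function.
  potential plane A = subset-ascent (λ A → ∀ {σ φ} → Tension A σ φ → ∃ (Potential A σ))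
      (λ _ → (λ _ → false) , λ e e∈ → ⊥-elim (empty (trans (sym e∈) (Vec.lookup-replicate e outside)))) step A
    where
    empty : true ≢ false
    empty ()
    step : ∀ A e → lookup A e ≡ outside → (∀ {σ φ} → Tension A σ φ → ∃ (Potential A σ)) →
           ∀ {σ φ} → Tension (A [ e ]≔ inside) σ φ → ∃ (Potential (A [ e ]≔ inside) σ)
    step A e e∉ ih T with adjacent? G A (end (e , false)) (end (e , true))
    ... | no u≁v = bridge-potential A e e∉ T u≁v (ih (bridge-tension A e e∉ T u≁v))
    ... | yes u~v with (κ , pot) ← ih (cycle-tension A e e∉ T (cycle-kind plane A e e∉ u~v)) =
            κ , cycle-potential A e e∉ T (cycle-kind plane A e e∉ u~v) {κ} pot

-- The Penrose polynomial

open Exp (CommutativeRing.commutativeSemiring ℚ.+-*-commutativeRing) using (^-homo-*; ^-distrib-*)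

-1^_ : ℕ → ℚ
-1^ n = (- 1ℚ) ^ n

1^ : ∀ n → 1ℚ ^ n ≡ 1ℚ
1^ zero    = refl
1^ (suc n) = trans (ℚ.*-identityˡ _) (1^ n)

-1^-double : ∀ n → -1^ (n ℕ.+ n) ≡ 1ℚ
-1^-double n = trans (^-homo-* (- 1ℚ) n n) (trans (sym (^-distrib-* (- 1ℚ) (- 1ℚ) n)) (1^ n))

-1^-suc : ∀ n → - (-1^ suc n) ≡ -1^ n
-1^-suc n = trans (cong -_ (sym (ℚ.neg-distribˡ-* 1ℚ (-1^ n)))) (trans (neg-neg (1ℚ * (-1^ n))) (ℚ.*-identityˡ (-1^ n)))
  where
  open ℚ.+-*-Solver
  neg-neg : ∀ p → - (- p) ≡ p
  neg-neg = solve 1 (λ p → :- (:- p) := p) refl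

neg-^ : ∀ q n → (- q) ^ n ≡ (-1^ n) * q ^ n
neg-^ q n = trans (cong (_^ n) (trans (cong -_ (sym (ℚ.*-identityˡ q))) (ℚ.neg-distribˡ-* 1ℚ q))) (^-distrib-* (- 1ℚ) q n)

inverse-^ : ∀ {q z} → q * z ≡ 1ℚ → ∀ n → q ^ n * z ^ n ≡ 1ℚ
inverse-^ {q} {z} qz n = trans (sym (^-distrib-* q z n)) (trans (cong (_^ n) qz) (1^ n))

∑⊆-cong : ∀ m {s t : Subset m → ℚ} → (∀ A → s A ≡ t A) → ∑⊆ m s ≡ ∑⊆ m t
∑⊆-cong zero    eq = eq []
∑⊆-cong (suc m) eq = cong₂ _+_ (∑⊆-cong m (eq ∘ (outside ∷_))) (∑⊆-cong m (eq ∘ (inside ∷_)))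

∑⊆-* : ∀ m q (t : Subset m → ℚ) → q * ∑⊆ m t ≡ ∑⊆ m (λ A → q * t A)
∑⊆-* zero    q t = refl
∑⊆-* (suc m) q t = trans (ℚ.*-distribˡ-+ q _ _) (cong₂ _+_ (∑⊆-* m q _) (∑⊆-* m q _))

∑⊆-+ : ∀ m (s t : Subset m → ℚ) → ∑⊆ m s + ∑⊆ m t ≡ ∑⊆ m (λ A → s A + t A)
∑⊆-+ zero    s t = refl
∑⊆-+ (suc m) s t = trans (interchange (∑⊆ m (s ∘ (outside ∷_))) _ _ _)
  (cong₂ _+_ (∑⊆-+ m (s ∘ (outside ∷_)) (t ∘ (outside ∷_))) (∑⊆-+ m (s ∘ (inside ∷_)) (t ∘ (inside ∷_))))
  where
  open ℚ.+-*-Solver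
  interchange : ∀ a b c d → (a + b) + (c + d) ≡ (a + c) + (b + d)
  interchange = solve 4 (λ a b c d → (a :+ b) :+ (c :+ d) := (a :+ c) :+ (b :+ d)) refl

module _ {l q z : ℚ} (q≡ : q ≡ - l) (lz : l * z ≡ 1ℚ) where

  -- Here `suc C` is c(A), and `C`, `n`, `k` are the three exponents in `R`. The hypotheses give
  -- `suc (C + n) ≡ k + f`, so the powers of `l` and `z` collapse to `l ^ f`; modulo 2 they give
  -- that `v + C + n` and `suc a` agree, which settles the sign.
  term-value : ∀ v f a C n k → v ℕ.+ n ≡ a ℕ.+ suc C → k ℕ.+ (v ℕ.+ f) ≡ suc C ℕ.+ suc C ℕ.+ a →
               (-1^ v) * (l * (q ^ C * q ^ n * z ^ k)) ≡ - ((-1^ a) * l ^ f)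
  term-value v f a C n k vn kvf = begin
    (-1^ v) * (l * (q ^ C * q ^ n * z ^ k))           ≡⟨ cong (λ p → (-1^ v) * (l * (p * z ^ k))) q-power ⟩
    (-1^ v) * (l * (((-1^ (C ℕ.+ n)) * l ^ (C ℕ.+ n)) * z ^ k))
        ≡⟨ regroup (-1^ v) l (-1^ (C ℕ.+ n)) (l ^ (C ℕ.+ n)) (z ^ k) ⟩
    ((-1^ v) * (-1^ (C ℕ.+ n))) * (l ^ suc (C ℕ.+ n) * z ^ k)   ≡⟨ cong₂ _*_ (sym (^-homo-* (- 1ℚ) v (C ℕ.+ n))) l-power ⟩
    (-1^ (v ℕ.+ (C ℕ.+ n))) * l ^ f                            ≡⟨ cong (_* l ^ f) sign ⟩
    (- (-1^ a)) * l ^ f                                       ≡⟨ ℚ.neg-distribˡ-* (-1^ a) (l ^ f) ⟨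
    - ((-1^ a) * l ^ f)                                        ∎
    where
    open ≡-Reasoning
    regroup : ∀ a b c d e → a * (b * ((c * d) * e)) ≡ (a * c) * ((b * d) * e)
    regroup = solve 5 (λ a b c d e → a :* (b :* ((c :* d) :* e)) := (a :* c) :* ((b :* d) :* e)) refl
      where open ℚ.+-*-Solver
    q-power : q ^ C * q ^ n ≡ (-1^ (C ℕ.+ n)) * l ^ (C ℕ.+ n)
    q-power = trans (sym (^-homo-* q C n)) (trans (cong (_^ (C ℕ.+ n)) q≡) (neg-^ l (C ℕ.+ n)))
    exchange : ∀ v k f → v ℕ.+ (k ℕ.+ f) ≡ k ℕ.+ (v ℕ.+ f)
    exchange = solve-∀
    total : v ℕ.+ suc (C ℕ.+ n) ≡ v ℕ.+ (k ℕ.+ f)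
    total = begin
      v ℕ.+ suc (C ℕ.+ n)         ≡⟨ collect v C n ⟩
      v ℕ.+ n ℕ.+ suc C           ≡⟨ cong (ℕ._+ suc C) vn ⟩
      a ℕ.+ suc C ℕ.+ suc C       ≡⟨ commute a (suc C) ⟩
      suc C ℕ.+ suc C ℕ.+ a       ≡⟨ kvf ⟨
      k ℕ.+ (v ℕ.+ f)             ≡⟨ exchange v k f ⟨
      v ℕ.+ (k ℕ.+ f)             ∎
      where
      collect : ∀ v C n → v ℕ.+ suc (C ℕ.+ n) ≡ v ℕ.+ n ℕ.+ suc C
      collect = solve-∀
      commute : ∀ a c → a ℕ.+ c ℕ.+ c ≡ c ℕ.+ c ℕ.+ a
      commute = solve-∀
    l-power : l ^ suc (C ℕ.+ n) * z ^ k ≡ l ^ f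
    l-power = begin
      l ^ suc (C ℕ.+ n) * z ^ k     ≡⟨ cong (λ i → l ^ i * z ^ k) (ℕ.+-cancelˡ-≡ v _ _ total) ⟩
      l ^ (k ℕ.+ f) * z ^ k         ≡⟨ cong (_* z ^ k) (^-homo-* l k f) ⟩
      (l ^ k * l ^ f) * z ^ k       ≡⟨ swap (l ^ k) (l ^ f) (z ^ k) ⟩
      (l ^ k * z ^ k) * l ^ f       ≡⟨ cong (_* l ^ f) (inverse-^ lz k) ⟩
      1ℚ * l ^ f                    ≡⟨ ℚ.*-identityˡ _ ⟩
      l ^ f                         ∎
      where
      swap : ∀ a b c → (a * b) * c ≡ (a * c) * b
      swap = solve 3 (λ a b c → (a :* b) :* c := (a :* c) :* b) refl
        where open ℚ.+-*-Solver
    sign : -1^ (v ℕ.+ (C ℕ.+ n)) ≡ - (-1^ a)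
    sign = begin
      -1^ (v ℕ.+ (C ℕ.+ n))                   ≡⟨ -1^-suc (v ℕ.+ (C ℕ.+ n)) ⟨
      - (-1^ (suc (v ℕ.+ (C ℕ.+ n))))         ≡⟨ cong (λ i → - (-1^ i)) exponent ⟩
      - (-1^ (suc C ℕ.+ suc C ℕ.+ a))         ≡⟨ cong -_ (^-homo-* (- 1ℚ) (suc C ℕ.+ suc C) a) ⟩
      - ((-1^ (suc C ℕ.+ suc C)) * (-1^ a))   ≡⟨ cong (λ p → - (p * (-1^ a))) (-1^-double (suc C)) ⟩
      - (1ℚ * (-1^ a))                        ≡⟨ cong -_ (ℚ.*-identityˡ _) ⟩
      - (-1^ a)                               ∎
      where
      exponent : suc (v ℕ.+ (C ℕ.+ n)) ≡ suc C ℕ.+ suc C ℕ.+ a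
      exponent = trans (sym (ℕ.+-suc v (C ℕ.+ n))) (trans total (trans (exchange v k f) kvf))

penrose : RibbonGraph → ℚ → ℚ
penrose H l = ∑⊆ (RibbonGraph.#E H) λ A → (-1^ ∣ A ∣) * l ^ f H A

module _ (H : RibbonGraph) (conn : Connected H) where
  open RibbonGraph H

  open import Data.Integer.Base using (+_)

  exponent-r : ∀ {A C} → c H A ≡ suc C → r H ⊤ ℤ.- r H A ≡ + C
  exponent-r {A} {C} cA = trans (cong₂ (λ x y → (+ #V ℤ.- + x) ℤ.- (+ #V ℤ.- + y)) conn cA) (simplify (+ #V) (+ C))
    where
    open ℤ.+-*-Solver
    simplify : ∀ v C → (v ℤ.- + 1) ℤ.- (v ℤ.- (+ 1 ℤ.+ C)) ≡ C
    simplify = solve 2 (λ v C → (v :- con (+ 1)) :- (v :- (con (+ 1) :+ C)) := C) refl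

  exponent-n : ∀ {A n′} → #V ℕ.+ n′ ≡ ∣ A ∣ ℕ.+ c H A → n H A ≡ + n′
  exponent-n {A} {n′} eq = trans (expand (+ ∣ A ∣) (+ #V) (+ c H A))
      (trans (cong (λ s → + s ℤ.- + #V) (sym eq)) (simplify (+ #V) (+ n′)))
    where
    open ℤ.+-*-Solver
    expand : ∀ a v c → a ℤ.- (v ℤ.- c) ≡ (a ℤ.+ c) ℤ.- v
    expand = solve 3 (λ a v c → a :- (v :- c) := (a :+ c) :- v) refl
    simplify : ∀ v n → (v ℤ.+ n) ℤ.- v ≡ n
    simplify = solve 2 (λ v n → (v :+ n) :- v := n) refl

  exponent-k : ∀ {A k} → k ℕ.+ (#V ℕ.+ f H A) ≡ c H A ℕ.+ c H A ℕ.+ ∣ A ∣ → + c H A ℤ.- + f H A ℤ.+ n H A ≡ + k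
  exponent-k {A} {k} eq = trans (expand (+ c H A) (+ f H A) (+ ∣ A ∣) (+ #V))
      (trans (cong (λ s → + s ℤ.- (+ #V ℤ.+ + f H A)) (sym eq)) (simplify (+ k) (+ #V ℤ.+ + f H A)))
    where
    open ℤ.+-*-Solver
    expand : ∀ c f a v → c ℤ.- f ℤ.+ (a ℤ.- (v ℤ.- c)) ≡ (c ℤ.+ c ℤ.+ a) ℤ.- (v ℤ.+ f)
    expand = solve 4 (λ c f a v → c :- f :+ (a :- (v :- c)) := (c :+ c :+ a) :- (v :+ f)) refl
    simplify : ∀ k s → (k ℤ.+ s) ℤ.- s ≡ k
    simplify = solve 2 (λ k s → (k :+ s) :- s := k) refl

  vertex : Fin #V
  vertex = Quotient.rep (components-quotient Fin._≟_ ∈.∈-allFin (adjacencies H ⊤)) (subst Fin (sym conn) zero)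

  -- Connectedness supplies a vertex, so every spanning subgraph has a component and the exponent
  -- r(G) - r(A) = c(A) - 1 is a natural number.
  c-positive : ∀ A → ∃ λ C → c H A ≡ suc C
  c-positive A = positive (Quotient.class (components-quotient Fin._≟_ ∈.∈-allFin (adjacencies H A)) vertex)
    where
    positive : ∀ {n} → Fin n → ∃ λ C → n ≡ suc C
    positive {suc n} _ = n , refl

  -- Up to sign each term of `R` is the power of `l` with exponent f(A) - 1; the additional factor
  -- `l` completes it.
  R-penrose : ∀ {x l z} → x - 1ℚ ≡ - l → l * z ≡ 1ℚ → (-1^ #V) * (l * R H x (- l) z) ≡ - penrose H l
  R-penrose {x} {l} {z} x≡ lz = begin
    (-1^ #V) * (l * R H x (- l) z)  ≡⟨ cong ((-1^ #V) *_) (∑⊆-* #E l _) ⟩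
    (-1^ #V) * ∑⊆ #E _              ≡⟨ ∑⊆-* #E (-1^ #V) _ ⟩
    ∑⊆ #E _                         ≡⟨ ∑⊆-cong #E term ⟩
    ∑⊆ #E (λ A → - ((-1^ ∣ A ∣) * l ^ f H A)) ≡⟨ ∑⊆-cong #E (λ A → neg-1 _) ⟩
    ∑⊆ #E (λ A → (- 1ℚ) * ((-1^ ∣ A ∣) * l ^ f H A)) ≡⟨ ∑⊆-* #E (- 1ℚ) _ ⟨
    (- 1ℚ) * penrose H l            ≡⟨ neg-1 _ ⟨
    - penrose H l                   ∎
    where
    open ≡-Reasoning
    neg-1 : ∀ p → - p ≡ (- 1ℚ) * p
    neg-1 p = trans (cong -_ (sym (ℚ.*-identityˡ p))) (ℚ.neg-distribˡ-* 1ℚ p)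
    term : ∀ A → (-1^ #V) * (l * ((x - 1ℚ) ^ℤ (r H ⊤ ℤ.- r H A) * (- l) ^ℤ n H A * z ^ℤ (+ c H A ℤ.- + f H A ℤ.+ n H A)))
                 ≡ - ((-1^ ∣ A ∣) * l ^ f H A)
    term A with (C , cA) ← c-positive A = trans
      (cong (λ p → (-1^ #V) * (l * p))
          (cong₂ _*_ (cong₂ _*_ (cong₂ _^ℤ_ x≡ (exponent-r {A} cA)) (cong ((- l) ^ℤ_) (exponent-n {A} vn)))
          (cong (z ^ℤ_) (exponent-k {A} {c H A ℕ.+ c H A ℕ.+ ∣ A ∣ ℕ.∸ (#V ℕ.+ f H A)} kvf))))
      (term-value {l} refl lz #V (f H A) ∣ A ∣ C (∣ A ∣ ℕ.+ c H A ℕ.∸ #V)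
          (c H A ℕ.+ c H A ℕ.+ ∣ A ∣ ℕ.∸ (#V ℕ.+ f H A)) (trans vn (cong (∣ A ∣ ℕ.+_) cA))
          (trans kvf (cong (λ c → c ℕ.+ c ℕ.+ ∣ A ∣) cA)))
      where
      -- The truncated subtractions are exact: here because the nullity is nonnegative, in `kvf`
      -- because the Euler genus is.
      vn : #V ℕ.+ (∣ A ∣ ℕ.+ c H A ℕ.∸ #V) ≡ ∣ A ∣ ℕ.+ c H A
      vn = ℕ.m+[n∸m]≡n (ℕ.≤-trans (rank-≤ H A) (ℕ.≤-reflexive (ℕ.+-comm (c H A) ∣ A ∣)))
      kvf : (c H A ℕ.+ c H A ℕ.+ ∣ A ∣ ℕ.∸ (#V ℕ.+ f H A)) ℕ.+ (#V ℕ.+ f H A) ≡ c H A ℕ.+ c H A ℕ.+ ∣ A ∣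
      kvf = ℕ.m∸n+n≡m (euler-≤ H A)

-- Counting colourings

open Mult (CommutativeRing.semiring ℚ.+-*-commutativeRing) using (×1-homo-*) renaming (_×_ to _×ℚ_)

∑-monoid : CommutativeMonoid _ _
∑-monoid = CommutativeRing.+-commutativeMonoid ℚ.+-*-commutativeRing

module ∑ = SemiringSum (CommutativeRing.semiring ℚ.+-*-commutativeRing)
module ∏ = Summation (CommutativeRing.*-commutativeMonoid ℚ.+-*-commutativeRing)

∑⊆-∑ : ∀ m {n} (t : Subset m → Fin n → ℚ) → ∑⊆ m (λ A → ∑.sum (t A)) ≡ ∑.sum (λ i → ∑⊆ m (λ A → t A i))
∑⊆-∑ zero    t = refl
∑⊆-∑ (suc m) t = trans (cong₂ _+_ (∑⊆-∑ m (t ∘ (outside ∷_))) (∑⊆-∑ m (t ∘ (inside ∷_))))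
  (sym (∑.∑-distrib-+ (λ i → ∑⊆ m (λ A → t (outside ∷ A) i)) (λ i → ∑⊆ m (λ A → t (inside ∷ A) i))))

-- The product is multiplied out, with `A` the set of factors from which `- u e` is taken.
∑⊆-signed : ∀ m (u w : Fin m → ℚ) →
            ∑⊆ m (λ A → (-1^ ∣ A ∣) * ∏.sum (λ e → if lookup A e then u e else w e)) ≡ ∏.sum (λ e → w e - u e)
∑⊆-signed zero    u w = refl
∑⊆-signed (suc m) u w = begin
  ∑⊆ m (λ A → (-1^ ∣ A ∣) * (w zero * P A)) + ∑⊆ m (λ A → ((- 1ℚ) * (-1^ ∣ A ∣)) * (u zero * P A))
    ≡⟨ cong₂ _+_ (∑⊆-cong m λ A → pull (w zero) (-1^ ∣ A ∣) (P A)) (∑⊆-cong m λ A → pull′ (u zero) (-1^ ∣ A ∣) (P A)) ⟩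
  ∑⊆ m (λ A → w zero * ((-1^ ∣ A ∣) * P A)) + ∑⊆ m (λ A → (- u zero) * ((-1^ ∣ A ∣) * P A))
    ≡⟨ cong₂ _+_ (∑⊆-* m (w zero) _) (∑⊆-* m (- u zero) _) ⟨
  w zero * S + (- u zero) * S                 ≡⟨ ℚ.*-distribʳ-+ S (w zero) (- u zero) ⟨
  (w zero - u zero) * S                       ≡⟨ cong ((w zero - u zero) *_) (∑⊆-signed m (u ∘ suc) (w ∘ suc)) ⟩
  (w zero - u zero) * ∏.sum (λ e → w (suc e) - u (suc e)) ∎
  where
  open ≡-Reasoning
  P : Subset m → ℚ
  P A = ∏.sum (λ e → if lookup A e then u (suc e) else w (suc e))
  S = ∑⊆ m (λ A → (-1^ ∣ A ∣) * P A)
  open ℚ.+-*-Solver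
  pull : ∀ w s p → s * (w * p) ≡ w * (s * p)
  pull = solve 3 (λ w s p → s :* (w :* p) := w :* (s :* p)) refl
  pull′ : ∀ u s p → ((- 1ℚ) * s) * (u * p) ≡ (- u) * (s * p)
  pull′ = solve 3 (λ u s p → (con (- 1ℚ) :* s) :* (u :* p) := (:- u) :* (s :* p)) refl

𝟙 : ∀ {P : Set} → Dec P → ℚ
𝟙 d = if does d then 1ℚ else 0ℚ

𝟙-yes : ∀ {P : Set} (d : Dec P) → P → 𝟙 d ≡ 1ℚ
𝟙-yes (yes _) p = refl
𝟙-yes (no ¬p) p = ⊥-elim (¬p p)

𝟙-no : ∀ {P : Set} (d : Dec P) → ¬ P → 𝟙 d ≡ 0ℚ
𝟙-no (yes p) ¬p = ⊥-elim (¬p p)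
𝟙-no (no _)  ¬p = refl

module _ {X : Set} {k : ℕ} (φ : X → Fin k) where

  agreement : List (X × X) → ℚ
  agreement []             = 1ℚ
  agreement ((x , y) ∷ es) = 𝟙 (φ x Fin.≟ φ y) * agreement es

  agreement-++ : ∀ es es′ → agreement (es ++ es′) ≡ agreement es * agreement es′
  agreement-++ []             es′ = sym (ℚ.*-identityˡ _)
  agreement-++ ((x , y) ∷ es) es′ = trans (cong (𝟙 (φ x Fin.≟ φ y) *_) (agreement-++ es es′))
      (sym (ℚ.*-assoc (𝟙 (φ x Fin.≟ φ y)) (agreement es) (agreement es′)))

  Respects : List (X × X) → Set
  Respects es = ∀ {x y} → (x , y) ∈ es → φ x ≡ φ y

  agreement-cases : ∀ es → (Respects es × agreement es ≡ 1ℚ) ⊎ (¬ Respects es × agreement es ≡ 0ℚ)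
  agreement-cases [] = inj₁ ((λ ()) , refl)
  agreement-cases ((x , y) ∷ es) with φ x Fin.≟ φ y | agreement-cases es
  ... | no neq | _                = inj₂ ((λ r → neq (r (here refl))) , ℚ.*-zeroˡ (agreement es))
  ... | yes eq | inj₁ (r , is1)   = inj₁ ((λ { (here refl) → eq ; (there m) → r m }) , trans (ℚ.*-identityˡ _) is1)
  ... | yes eq | inj₂ (¬r , is0)  = inj₂ ((λ r → ¬r (r ∘ there)) , trans (ℚ.*-identityˡ _) is0)

funToFin-cong : ∀ {m n} {f g : Fin m → Fin n} → f ≗ g → funToFin f ≡ funToFin g
funToFin-cong {zero}  eq = refl
funToFin-cong {suc m} eq = cong₂ Fin.combine (eq zero) (funToFin-cong (eq ∘ suc))

ones-^ : ∀ k N → ∑.sum {k ℕ.^ N} (λ _ → 1ℚ) ≡ (k ×ℚ 1ℚ) ^ N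
ones-^ k N = trans (∑.sum-replicate (k ℕ.^ N)) (power N)
  where
  power : ∀ N → (k ℕ.^ N) ×ℚ 1ℚ ≡ (k ×ℚ 1ℚ) ^ N
  power zero    = refl
  power (suc N) = trans (×1-homo-* k (k ℕ.^ N)) (cong ((k ×ℚ 1ℚ) *_) (power N))

module _ {X : Set} {n : ℕ} (X↔ : X ↔ Fin n) (k : ℕ) where
  open Inverse X↔ using (to; from)

  colouring : Fin (k ℕ.^ n) → X → Fin k
  colouring i = finToFun i ∘ to

  colouring-surjective : ∀ φ → ∃ λ i → ∀ x → colouring i x ≡ φ x
  colouring-surjective φ = funToFin (φ ∘ from) , λ x →
    trans (Fin.finToFun-funToFin (φ ∘ from) (to x)) (cong φ (Inverse.strictlyInverseʳ X↔ x))

  -- A colouring constant on the components factors uniquely through the quotient.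
  count-colourings : ∀ {es N} → Quotient (Linked es) N → ∑.sum (λ i → agreement (colouring i) es) ≡ (k ×ℚ 1ℚ) ^ N
  count-colourings {es} {N} Q = begin
    ∑.sum (λ i → agreement (colouring i) es)                   ≡⟨ ∑.sum-cong-≗ factor ⟩
    ∑.sum (λ i → ∑.sum (λ j → 𝟙 (i Fin.≟ lift j)))             ≡⟨ ∑.∑-comm (λ i j → 𝟙 (i Fin.≟ lift j)) ⟩
    ∑.sum (λ j → ∑.sum (λ i → 𝟙 (i Fin.≟ lift j)))             ≡⟨ ∑.sum-cong-≗
        (λ j → trans (sum-single ∑-monoid (λ i → 𝟙 (i Fin.≟ lift j)) (lift j) λ i → 𝟙-no (i Fin.≟ lift j))
        (𝟙-yes (lift j Fin.≟ lift j) refl)) ⟩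
    ∑.sum {k ℕ.^ N} (λ j → 1ℚ)                                 ≡⟨ ones-^ k N ⟩
    (k ×ℚ 1ℚ) ^ N                                              ∎
    where
    open ≡-Reasoning
    open Quotient Q
    lift : Fin (k ℕ.^ N) → Fin (k ℕ.^ n)
    lift j = funToFin (finToFun j ∘ class ∘ from)
    colouring-lift : ∀ j x → colouring (lift j) x ≡ finToFun {k} j (class x)
    colouring-lift j x = trans (Fin.finToFun-funToFin (finToFun j ∘ class ∘ from) (to x))
      (cong (finToFun {k} j ∘ class) (Inverse.strictlyInverseʳ X↔ x))
    factor : ∀ i → agreement (colouring i) es ≡ ∑.sum (λ j → 𝟙 (i Fin.≟ lift j))
    factor i with agreement-cases (colouring i) es
    ... | inj₂ (¬r , is0) = trans is0 (sym (sum-zero ∑-monoid _ λ j → 𝟙-no (i Fin.≟ lift j) λ { refl →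
            ¬r λ {x} {y} m → trans (colouring-lift j x)
                (trans (cong (finToFun {k} j) (sound (link m))) (sym (colouring-lift j y))) }))
    ... | inj₁ (r , is1)  =
            trans is1 (sym (trans (sum-single ∑-monoid _ j₀ unmatched) (𝟙-yes (i Fin.≟ lift j₀) (sym lift-j₀))))
      where
      j₀ = funToFin (colouring i ∘ rep)
      lift-j₀ : lift j₀ ≡ i
      lift-j₀ = trans (funToFin-cong λ p → trans (Fin.finToFun-funToFin (colouring i ∘ rep) (class (from p)))
          (trans (linked-respects (colouring i) r (complete (class-rep (class (from p)))))
              (cong (finToFun i) (Inverse.strictlyInverseˡ X↔ p))))
        (Fin.funToFin-finToFin {n} {k} i)
      unmatched : ∀ j → j ≢ j₀ → 𝟙 (i Fin.≟ lift j) ≡ 0ℚ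
      unmatched j j≢j₀ = 𝟙-no (i Fin.≟ lift j) λ eq → j≢j₀ (trans (sym (Fin.funToFin-finToFin {N} {k} j))
        (funToFin-cong λ q → trans (cong (finToFun {k} j) (sym (class-rep q)))
          (trans (sym (colouring-lift j (rep q))) (cong (λ i → colouring i (rep q)) (sym eq)))))

agreement-adjacencies : ∀ (G : RibbonGraph) {k} (κ : Fin (RibbonGraph.#V G) → Fin k) A → let open RibbonGraph G in
  agreement κ (adjacencies G A) ≡ ∏.sum (λ e → if lookup A e then 𝟙 (κ (end (e , false)) Fin.≟ κ (end (e , true))) else 1ℚ)
agreement-adjacencies G κ A = over #E id
  where
  open RibbonGraph G
  over : ∀ n (g : Fin n → Fin #E) →
         agreement κ (map (λ e → end (e , false) , end (e , true)) (filter (λ e → lookup A e Bool.≟ inside) (tabulate g)))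
         ≡ ∏.sum (λ i → if lookup A (g i) then 𝟙 (κ (end (g i , false)) Fin.≟ κ (end (g i , true))) else 1ℚ)
  over zero    g = refl
  over (suc n) g with lookup A (g zero)
  ... | true  = cong (𝟙 (κ (end (g zero , false)) Fin.≟ κ (end (g zero , true))) *_) (over n (g ∘ suc))
  ... | false = trans (over n (g ∘ suc)) (sym (ℚ.*-identityˡ _))

module _ (G : RibbonGraph) where
  open RibbonGraph G

  -- Whitney's subset expansion of the chromatic polynomial: each product is the indicator of a
  -- proper colouring, and k^c(A) counts the colourings constant along the edges of `A`.
  chromatic : ∀ k → ∑⊆ #E (λ A → (-1^ ∣ A ∣) * (k ×ℚ 1ℚ) ^ c G A)
              ≡ ∑.sum (λ i → let κ = finToFun {k} {#V} i in ∏.sum (λ e → 1ℚ - 𝟙 (κ (end (e , false)) Fin.≟ κ (end (e , true)))))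
  chromatic k = begin
    ∑⊆ #E (λ A → (-1^ ∣ A ∣) * (k ×ℚ 1ℚ) ^ c G A)
      ≡⟨ ∑⊆-cong #E (λ A → cong ((-1^ ∣ A ∣) *_)
          (sym (count-colourings (↔-id (Fin #V)) k (components-quotient Fin._≟_ ∈.∈-allFin (adjacencies G A))))) ⟩
    ∑⊆ #E (λ A → (-1^ ∣ A ∣) * ∑.sum (λ i → agreement (finToFun {k} {#V} i) (adjacencies G A)))
      ≡⟨ ∑⊆-cong #E (λ A → ∑.*-distribˡ-sum (-1^ ∣ A ∣) (λ i → agreement (finToFun {k} {#V} i) (adjacencies G A))) ⟩
    ∑⊆ #E (λ A → ∑.sum (λ i → (-1^ ∣ A ∣) * agreement (finToFun {k} {#V} i) (adjacencies G A)))
      ≡⟨ ∑⊆-∑ #E (λ A i → (-1^ ∣ A ∣) * agreement (finToFun {k} {#V} i) (adjacencies G A)) ⟩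
    ∑.sum (λ i → ∑⊆ #E (λ A → (-1^ ∣ A ∣) * agreement (finToFun {k} {#V} i) (adjacencies G A)))
      ≡⟨ ∑.sum-cong-≗ (λ i →
          trans (∑⊆-cong #E λ A → cong ((-1^ ∣ A ∣) *_) (agreement-adjacencies G (finToFun {k} {#V} i) A))
          (∑⊆-signed #E _ (λ _ → 1ℚ))) ⟩
    ∑.sum (λ i → ∏.sum (λ e → 1ℚ - 𝟙 (finToFun {k} {#V} i (end (e , false)) Fin.≟ finToFun {k} {#V} i (end (e , true))))) ∎
    where
    open ≡-Reasoning

  corners↔ : Corner G ↔ Fin ((#E ℕ.* 2) ℕ.* 2)
  corners↔ = mk (halves #E)
    where
    mk : Fin (#E ℕ.* 2) ↔ HalfEdge #E → Corner G ↔ Fin ((#E ℕ.* 2) ℕ.* 2)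
    mk h = ↔-sym (Fin.*↔× {#E ℕ.* 2} {2}) ↔-∘ (↔-sym h ×-↔ ↔-sym Fin.2↔Bool)

  agreement-layers : ∀ {k} (φ : Corner G → Fin k) st →
    agreement φ (layers G st (allFin #E)) ≡ agreement φ (vertexPieces G) * ∏.sum (λ e → agreement φ (kindPieces (st e) e))
  agreement-layers φ st = over #E id
    where
    over : ∀ n (g : Fin n → Fin #E) → agreement φ (layers G st (tabulate g)) ≡
           agreement φ (vertexPieces G) * ∏.sum (λ i → agreement φ (kindPieces (st (g i)) (g i)))
    over zero    g = sym (ℚ.*-identityʳ _)
    over (suc n) g = trans (agreement-++ φ (kindPieces (st (g zero)) (g zero)) (layers G st (tabulate (g ∘ suc))))
      (trans (cong (agreement φ (kindPieces (st (g zero)) (g zero)) *_) (over n (g ∘ suc)))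
          (swap (agreement φ (kindPieces (st (g zero)) (g zero))) (agreement φ (vertexPieces G)) _))
      where
      open ℚ.+-*-Solver
      swap : ∀ a b c → a * (b * c) ≡ b * (a * c)
      swap = solve 3 (λ a b c → a :* (b :* c) := b :* (a :* c)) refl

  -- Multiplying out the product recovers the sum over `A`: an edge outside `A` contributes its two
  -- arcs, an edge of `A` its ribbon with a minus sign.
  weight : ∀ {k} → (Corner G → Fin k) → ℚ
  weight φ = agreement φ (vertexPieces G) *
    ∏.sum (λ e → agreement φ (kindPieces nothing e) - agreement φ (kindPieces (just (twisted e)) e))

  -- The circles of bare vertices carry no corner; their free choice of colour is the factor in
  -- front.
  penrose-weights : ∀ k → penrose G (k ×ℚ 1ℚ) ≡ (k ×ℚ 1ℚ) ^ bare G * ∑.sum (λ i → weight (colouring corners↔ k i))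
  penrose-weights k = begin
    ∑⊆ #E (λ A → (-1^ ∣ A ∣) * K ^ f G A)                       ≡⟨ ∑⊆-cong #E split ⟩
    ∑⊆ #E (λ A → K ^ bare G * ∑.sum (λ i → (-1^ ∣ A ∣) * agreement (φ i) (L A))) ≡⟨ ∑⊆-* #E (K ^ bare G) _ ⟨
    K ^ bare G * ∑⊆ #E (λ A → ∑.sum (λ i → (-1^ ∣ A ∣) * agreement (φ i) (L A)))
        ≡⟨ cong (K ^ bare G *_) (∑⊆-∑ #E (λ A i → (-1^ ∣ A ∣) * agreement (φ i) (L A))) ⟩
    K ^ bare G * ∑.sum (λ i → ∑⊆ #E (λ A → (-1^ ∣ A ∣) * agreement (φ i) (L A)))
        ≡⟨ cong (K ^ bare G *_) (∑.sum-cong-≗ expand) ⟩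
    K ^ bare G * ∑.sum (λ i → weight (φ i))                     ∎
    where
    open ≡-Reasoning
    K = k ×ℚ 1ℚ
    φ = colouring corners↔ k
    L : Subset #E → List (Corner G × Corner G)
    L A = layers G (ribbons G A) (allFin #E)
    open ℚ.+-*-Solver
    rotate : ∀ s l b → s * (l * b) ≡ b * (s * l)
    rotate = solve 3 (λ s l b → s :* (l :* b) := b :* (s :* l)) refl
    split : ∀ A → (-1^ ∣ A ∣) * K ^ f G A ≡ K ^ bare G * ∑.sum (λ i → (-1^ ∣ A ∣) * agreement (φ i) (L A))
    split A = trans (cong (λ x → (-1^ ∣ A ∣) * K ^ x) (f-loops G A))
      (trans (cong ((-1^ ∣ A ∣) *_) (^-homo-* K (loops G (ribbons G A)) (bare G)))
      (trans (rotate (-1^ ∣ A ∣) (K ^ loops G (ribbons G A)) (K ^ bare G)) (cong (K ^ bare G *_)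
      (trans (cong ((-1^ ∣ A ∣) *_)
          (sym (count-colourings corners↔ k (components-quotient (_≟ᶜ_ G) (corners-complete G) (L A)))))
        (∑.*-distribˡ-sum (-1^ ∣ A ∣) (λ i → agreement (φ i) (L A)))))))
    pull : ∀ s v p → s * (v * p) ≡ v * (s * p)
    pull = solve 3 (λ s v p → s :* (v :* p) := v :* (s :* p)) refl
    expand : ∀ i → ∑⊆ #E (λ A → (-1^ ∣ A ∣) * agreement (φ i) (L A)) ≡ weight (φ i)
    expand i = begin
      ∑⊆ #E (λ A → (-1^ ∣ A ∣) * agreement (φ i) (L A))
        ≡⟨ ∑⊆-cong #E (λ A → trans (cong ((-1^ ∣ A ∣) *_) (agreement-layers (φ i) (ribbons G A))) (pull (-1^ ∣ A ∣) V _)) ⟩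
      ∑⊆ #E (λ A → V * ((-1^ ∣ A ∣) * ∏.sum (λ e → agreement (φ i) (kindPieces (ribbons G A e) e))))
        ≡⟨ ∑⊆-* #E V _ ⟨
      V * ∑⊆ #E (λ A → (-1^ ∣ A ∣) * ∏.sum (λ e → agreement (φ i) (kindPieces (ribbons G A e) e)))
        ≡⟨ cong (V *_) (∑⊆-cong #E λ A → cong ((-1^ ∣ A ∣) *_) (∏.sum-cong-≗ (choose A))) ⟩
      V * ∑⊆ #E (λ A → (-1^ ∣ A ∣) * ∏.sum (λ e → if lookup A e then u e else w e))
        ≡⟨ cong (V *_) (∑⊆-signed #E u w) ⟩
      weight (φ i) ∎
      where
      V = agreement (φ i) (vertexPieces G)
      u w : Fin #E → ℚ
      u e = agreement (φ i) (kindPieces (just (twisted e)) e)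
      w e = agreement (φ i) (kindPieces nothing e)
      choose : ∀ A e → agreement (φ i) (kindPieces (ribbons G A e) e) ≡ (if lookup A e then u e else w e)
      choose A e with lookup A e
      ... | true  = refl
      ... | false = refl

-- The evaluation at -2

2ℚ -2ℚ : ℚ
2ℚ  = ℤ.+ 2 / 1
-2ℚ = - 2ℚ

kinds : ∀ {m} → Vec Bool m → Subset m → Vec Kind m
kinds []       []      = []
kinds (t ∷ ts) (a ∷ A) = (if a then just t else nothing) ∷ kinds ts A

lookup-kinds : ∀ {m} (ts : Vec Bool m) A e → lookup (kinds ts A) e ≡ (if lookup A e then just (lookup ts e) else nothing)
lookup-kinds (t ∷ ts) (a ∷ A) zero    = refl
lookup-kinds (t ∷ ts) (a ∷ A) (suc e) = lookup-kinds ts A e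

-- The skein relation of L eliminates each twisted ribbon in favour of the
-- absent and the untwisted one.
∑⊆-untwist : ∀ {m} (L : Vec Kind m → ℚ) (ts : Vec Bool m) →
             (∀ v e t → L (v [ e ]≔ nothing) + (L (v [ e ]≔ just t) + L (v [ e ]≔ just (not t))) ≡ 0ℚ) →
             ∑⊆ m (λ A → (-1^ ∣ A ∣) * L (kinds (Vec.map not ts) A)) ≡ ∑⊆ m (λ A → 2ℚ ^ ∣ ∁ A ∣ * L (kinds ts A))
∑⊆-untwist {zero}  L []       rel = refl
∑⊆-untwist {suc m} L (t ∷ ts) rel = begin
  ∑⊆ m (λ A → (-1^ ∣ A ∣) * N (kinds nts A)) + ∑⊆ m (λ A → ((- 1ℚ) * (-1^ ∣ A ∣)) * X (kinds nts A))
    ≡⟨ cong₂ _+_ (∑⊆-untwist N ts λ v e → rel (nothing ∷ v) (suc e))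
        (trans (∑⊆-cong m λ A → ℚ.*-assoc (- 1ℚ) (-1^ ∣ A ∣) (X (kinds nts A)))
         (trans (sym (∑⊆-* m (- 1ℚ) (λ A → (-1^ ∣ A ∣) * X (kinds nts A))))
             (cong ((- 1ℚ) *_) (∑⊆-untwist X ts λ v e → rel (just (not t) ∷ v) (suc e))))) ⟩
  ∑⊆ m (λ A → W A * N (kinds ts A)) + (- 1ℚ) * ∑⊆ m (λ A → W A * X (kinds ts A))
    ≡⟨ cong (∑⊆ m (λ A → W A * N (kinds ts A)) +_) (∑⊆-* m (- 1ℚ) (λ A → W A * X (kinds ts A))) ⟩
  ∑⊆ m (λ A → W A * N (kinds ts A)) + ∑⊆ m (λ A → (- 1ℚ) * (W A * X (kinds ts A)))
    ≡⟨ ∑⊆-+ m (λ A → W A * N (kinds ts A)) (λ A → (- 1ℚ) * (W A * X (kinds ts A))) ⟩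
  ∑⊆ m (λ A → W A * N (kinds ts A) + (- 1ℚ) * (W A * X (kinds ts A)))
    ≡⟨ ∑⊆-cong m (λ A → exchange (W A) (N (kinds ts A)) (S (kinds ts A)) (X (kinds ts A))
        (rel (nothing ∷ kinds ts A) zero t)) ⟩
  ∑⊆ m (λ A → (2ℚ * W A) * N (kinds ts A) + W A * S (kinds ts A))
    ≡⟨ ∑⊆-+ m (λ A → (2ℚ * W A) * N (kinds ts A)) (λ A → W A * S (kinds ts A)) ⟨
  ∑⊆ m (λ A → (2ℚ * W A) * N (kinds ts A)) + ∑⊆ m (λ A → W A * S (kinds ts A)) ∎
  where
  open ≡-Reasoning
  nts = Vec.map not ts
  N S X : Vec Kind m → ℚ
  N v = L (nothing ∷ v)
  S v = L (just t ∷ v)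
  X v = L (just (not t) ∷ v)
  W : Subset m → ℚ
  W A = 2ℚ ^ ∣ ∁ A ∣
  -- The relation replaces `- x` by `n + s`, so the absent ribbon is counted twice and the untwisted
  -- one once; this is the source of the weight `2ℚ ^ ∣ ∁ A ∣`.
  exchange : ∀ w n s x → n + (s + x) ≡ 0ℚ → w * n + (- 1ℚ) * (w * x) ≡ (2ℚ * w) * n + w * s
  exchange w n s x eq =
      trans (rearrange w n s x)
      (trans (cong (λ z → (2ℚ * w) * n + w * s + (- 1ℚ) * (w * z)) eq) (drop ((2ℚ * w) * n + w * s) w))
    where
    open ℚ.+-*-Solver
    rearrange : ∀ w n s x → w * n + (- 1ℚ) * (w * x) ≡ (2ℚ * w) * n + w * s + (- 1ℚ) * (w * (n + (s + x)))
    rearrange = solve 4 (λ w n s x → w :* n :+ con (- 1ℚ) :* (w :* x) :=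
      (con 2ℚ :* w) :* n :+ w :* s :+ con (- 1ℚ) :* (w :* (n :+ (s :+ x)))) refl
    drop : ∀ p w → p + (- 1ℚ) * (w * 0ℚ) ≡ p
    drop = solve 2 (λ p w → p :+ con (- 1ℚ) :* (w :* con 0ℚ) := p) refl

module _ (G : RibbonGraph) where
  open RibbonGraph G

  -- Twists enter `layers` only through the state, so G and its Petrie dual can be compared on the
  -- same states.
  layers-petrie : ∀ st L → layers (petrieDual G) st L ≡ layers G st L
  layers-petrie st []      = refl
  layers-petrie st (e ∷ L) = cong (kindPieces (st e) e ++_) (layers-petrie st L)

  loops-petrie : ∀ st → loops (petrieDual G) st ≡ loops G st
  loops-petrie st = cong (#components (_≟ᶜ_ G) (corners G)) (layers-petrie st (allFin #E))

  -- Of the three states one has N circles and the other two have N - 1. The sum is thus (-2)^(N-1)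
  -- times (-2 + 2).
  loops-skein : ∀ (v : Vec Kind #E) e t → -2ℚ ^ loops G (lookup (v [ e ]≔ nothing))
    + (-2ℚ ^ loops G (lookup (v [ e ]≔ just t)) + -2ℚ ^ loops G (lookup (v [ e ]≔ just (not t)))) ≡ 0ℚ
  loops-skein v e t = by-kind (Skein.kind S) t same other
    where
    S = skein G (lookup v) e
    N = #components (_≟ᶜ_ G) (corners G) (rest G (lookup v) e)
    agree : ∀ k → Agree G e (lookup v) (lookup (v [ e ]≔ k))
    agree k = agrees λ e′ e′≢e → Vec.lookup∘update′ e′≢e v k
    same : ∀ {k} → k ≡ Skein.kind S → loops G (lookup (v [ e ]≔ k)) ≡ N
    same {k} eq = loops-same G S (agree k) (trans (Vec.lookup∘update e v k) eq)
    other : ∀ {k} → k ≢ Skein.kind S → N ≡ suc (loops G (lookup (v [ e ]≔ k)))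
    other {k} neq = loops-other G S (agree k) λ eq → neq (trans (sym (Vec.lookup∘update e v k)) eq)
    open ℚ.+-*-Solver
    total₁ : ∀ {x y z} N → x ≡ N → N ≡ suc y → N ≡ suc z → -2ℚ ^ x + (-2ℚ ^ y + -2ℚ ^ z) ≡ 0ℚ
    total₁ {y = y} _ refl refl refl = solve 1 (λ p → con -2ℚ :* p :+ (p :+ p) := con 0ℚ) refl (-2ℚ ^ y)
    total₂ : ∀ {x y z} N → N ≡ suc x → y ≡ N → N ≡ suc z → -2ℚ ^ x + (-2ℚ ^ y + -2ℚ ^ z) ≡ 0ℚ
    total₂ {x} _ refl refl refl = solve 1 (λ p → p :+ (con -2ℚ :* p :+ p) := con 0ℚ) refl (-2ℚ ^ x)
    total₃ : ∀ {x y z} N → N ≡ suc x → N ≡ suc y → z ≡ N → -2ℚ ^ x + (-2ℚ ^ y + -2ℚ ^ z) ≡ 0ℚ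
    total₃ {x} _ refl refl refl = solve 1 (λ p → p :+ (p :+ con -2ℚ :* p) := con 0ℚ) refl (-2ℚ ^ x)
    L : Kind → ℕ
    L k = loops G (lookup (v [ e ]≔ k))
    by-kind : ∀ K t → (∀ {k} → k ≡ K → L k ≡ N) → (∀ {k} → k ≢ K → N ≡ suc (L k)) →
              -2ℚ ^ L nothing + (-2ℚ ^ L (just t) + -2ℚ ^ L (just (not t))) ≡ 0ℚ
    by-kind nothing      t     s o = total₁ N (s refl) (o λ ()) (o λ ())
    by-kind (just false) false s o = total₂ N (o λ ()) (s refl) (o λ ())
    by-kind (just false) true  s o = total₃ N (o λ ()) (o λ ()) (s refl)
    by-kind (just true)  true  s o = total₂ N (o λ ()) (s refl) (o λ ())
    by-kind (just true)  false s o = total₃ N (o λ ()) (o λ ()) (s refl)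

  penrose-untwist : penrose (petrieDual G) -2ℚ ≡ ∑⊆ #E (λ A → 2ℚ ^ ∣ ∁ A ∣ * -2ℚ ^ f G A)
  penrose-untwist = begin
    ∑⊆ #E (λ A → (-1^ ∣ A ∣) * -2ℚ ^ f (petrieDual G) A)      ≡⟨ ∑⊆-cong #E (λ A → factor (-1^ ∣ A ∣) (twist A)) ⟩
    ∑⊆ #E (λ A → B * ((-1^ ∣ A ∣) * L (kinds (Vec.map not ts) A)))
        ≡⟨ ∑⊆-* #E B (λ A → (-1^ ∣ A ∣) * L (kinds (Vec.map not ts) A)) ⟨
    B * ∑⊆ #E (λ A → (-1^ ∣ A ∣) * L (kinds (Vec.map not ts) A)) ≡⟨ cong (B *_) (∑⊆-untwist L ts loops-skein) ⟩
    B * ∑⊆ #E (λ A → 2ℚ ^ ∣ ∁ A ∣ * L (kinds ts A))           ≡⟨ ∑⊆-* #E B (λ A → 2ℚ ^ ∣ ∁ A ∣ * L (kinds ts A)) ⟩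
    ∑⊆ #E (λ A → B * (2ℚ ^ ∣ ∁ A ∣ * L (kinds ts A)))         ≡⟨ ∑⊆-cong #E (λ A → factor (2ℚ ^ ∣ ∁ A ∣) (untwist A)) ⟨
    ∑⊆ #E (λ A → 2ℚ ^ ∣ ∁ A ∣ * -2ℚ ^ f G A)                  ∎
    where
    open ≡-Reasoning
    ts = Vec.tabulate twisted
    L : Vec Kind #E → ℚ
    L v = -2ℚ ^ loops G (lookup v)
    B = -2ℚ ^ bare G
    untwist : ∀ A → f G A ≡ loops G (lookup (kinds ts A)) ℕ.+ bare G
    untwist A = trans (f-loops G A) (cong (ℕ._+ bare G) (loops-cong G {lookup (kinds ts A)} {ribbons G A} λ e →
      trans (cong (λ t → if lookup A e then just t else nothing) (sym (Vec.lookup∘tabulate twisted e)))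
          (sym (lookup-kinds ts A e))))
    twist : ∀ A → f (petrieDual G) A ≡ loops G (lookup (kinds (Vec.map not ts) A)) ℕ.+ bare G
    twist A = trans (f-loops (petrieDual G) A)
        (cong (ℕ._+ bare G) (trans (loops-petrie (ribbons (petrieDual G) A))
        (loops-cong G {lookup (kinds (Vec.map not ts) A)} {ribbons (petrieDual G) A} λ e →
      trans (cong (λ t → if lookup A e then just t else nothing)
          (sym (trans (Vec.lookup-map e not ts) (cong not (Vec.lookup∘tabulate twisted e)))))
          (sym (lookup-kinds (Vec.map not ts) A e)))))
    open ℚ.+-*-Solver
    rotate : ∀ s l b → s * (l * b) ≡ b * (s * l)
    rotate = solve 3 (λ s l b → s :* (l :* b) := b :* (s :* l)) refl
    factor : ∀ s {x l} → x ≡ l ℕ.+ bare G → s * -2ℚ ^ x ≡ B * (s * -2ℚ ^ l)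
    factor s {l = l} refl = trans (cong (s *_) (^-homo-* -2ℚ l (bare G))) (rotate s (-2ℚ ^ l) B)

  -- Euler's formula replaces v + f(A) by 2c(A) + |A|. The square of -2 is the 4 of the colours, the
  -- sign (-1)^|A| comes from (-2)^|A|, and its remaining 2^|A| combines with the weight of the
  -- complement to 2^|E|.
  penrose-chromatic : Plane G → -2ℚ ^ #V * penrose (petrieDual G) -2ℚ ≡ 2ℚ ^ #E * ∑⊆ #E
      (λ A → (-1^ ∣ A ∣) * (ℤ.+ 4 / 1) ^ c G A)
  penrose-chromatic plane = begin
    -2ℚ ^ #V * penrose (petrieDual G) -2ℚ                       ≡⟨ cong (-2ℚ ^ #V *_) penrose-untwist ⟩
    -2ℚ ^ #V * ∑⊆ #E (λ A → 2ℚ ^ ∣ ∁ A ∣ * -2ℚ ^ f G A)         ≡⟨ ∑⊆-* #E (-2ℚ ^ #V) (λ A → 2ℚ ^ ∣ ∁ A ∣ * -2ℚ ^ f G A) ⟩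
    ∑⊆ #E (λ A → -2ℚ ^ #V * (2ℚ ^ ∣ ∁ A ∣ * -2ℚ ^ f G A))       ≡⟨ ∑⊆-cong #E
        (λ A → term #V (f G A) (c G A) ∣ A ∣ ∣ ∁ A ∣ #E (plane-euler G plane A) (complement A)) ⟩
    ∑⊆ #E (λ A → 2ℚ ^ #E * ((-1^ ∣ A ∣) * (ℤ.+ 4 / 1) ^ c G A))   ≡⟨ ∑⊆-* #E (2ℚ ^ #E)
        (λ A → (-1^ ∣ A ∣) * (ℤ.+ 4 / 1) ^ c G A) ⟨
    2ℚ ^ #E * ∑⊆ #E (λ A → (-1^ ∣ A ∣) * (ℤ.+ 4 / 1) ^ c G A)     ∎
    where
    open ≡-Reasoning
    complement : ∀ A → ∣ ∁ A ∣ ℕ.+ ∣ A ∣ ≡ #E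
    complement A = trans (cong (ℕ._+ ∣ A ∣) (Subset.∣∁p∣≡n∸∣p∣ A)) (ℕ.m∸n+n≡m (Subset.∣p∣≤n A))
    term : ∀ v f c a b m → v ℕ.+ f ≡ c ℕ.+ c ℕ.+ a → b ℕ.+ a ≡ m →
           -2ℚ ^ v * (2ℚ ^ b * -2ℚ ^ f) ≡ 2ℚ ^ m * ((-1^ a) * (ℤ.+ 4 / 1) ^ c)
    term v f c a b _ eq refl = begin
      -2ℚ ^ v * (2ℚ ^ b * -2ℚ ^ f)                         ≡⟨ swap (-2ℚ ^ v) (2ℚ ^ b) (-2ℚ ^ f) ⟩
      2ℚ ^ b * (-2ℚ ^ v * -2ℚ ^ f)                         ≡⟨ cong (2ℚ ^ b *_)
          (trans (sym (^-homo-* -2ℚ v f)) (cong (-2ℚ ^_) eq)) ⟩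
      2ℚ ^ b * -2ℚ ^ (c ℕ.+ c ℕ.+ a)                       ≡⟨ cong (2ℚ ^ b *_)
          (trans (^-homo-* -2ℚ (c ℕ.+ c) a)
          (cong₂ _*_ (trans (^-homo-* -2ℚ c c) (sym (^-distrib-* -2ℚ -2ℚ c))) (neg-^ 2ℚ a))) ⟩
      2ℚ ^ b * ((ℤ.+ 4 / 1) ^ c * ((-1^ a) * 2ℚ ^ a))        ≡⟨ regroup (2ℚ ^ b) ((ℤ.+ 4 / 1) ^ c) (-1^ a) (2ℚ ^ a) ⟩
      (2ℚ ^ b * 2ℚ ^ a) * ((-1^ a) * (ℤ.+ 4 / 1) ^ c)        ≡⟨ cong (_* ((-1^ a) * (ℤ.+ 4 / 1) ^ c))
          (sym (^-homo-* 2ℚ b a)) ⟩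
      2ℚ ^ (b ℕ.+ a) * ((-1^ a) * (ℤ.+ 4 / 1) ^ c)           ∎
      where
      open ℚ.+-*-Solver
      swap : ∀ x y z → x * (y * z) ≡ y * (x * z)
      swap = solve 3 (λ x y z → x :* (y :* z) := y :* (x :* z)) refl
      regroup : ∀ p q s t → p * (q * (s * t)) ≡ (p * t) * (s * q)
      regroup = solve 4 (λ p q s t → p :* (q :* (s :* t)) := (p :* t) :* (s :* q)) refl

-- Colourings of corners

sgn : Bool → ℚ
sgn false = 1ℚ
sgn true  = - 1ℚ

sgn-xor : ∀ a b → sgn (a xor b) ≡ sgn a * sgn b
sgn-xor false b     = sym (ℚ.*-identityˡ (sgn b))
sgn-xor true  false = refl
sgn-xor true  true  = refl

∏-sgn : ∀ {m} (t : Fin m → Bool) → ∏.sum (sgn ∘ t) ≡ sgn (Xor.sum t)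
∏-sgn {zero}  t = refl
∏-sgn {suc m} t = trans (cong (sgn (t zero) *_) (∏-sgn (t ∘ suc))) (sym (sgn-xor (t zero) (Xor.sum (t ∘ suc))))

∏-zero : ∀ {m} (t : Fin m → ℚ) e → t e ≡ 0ℚ → ∏.sum t ≡ 0ℚ
∏-zero t zero    eq = trans (cong (_* ∏.sum (t ∘ suc)) eq) (ℚ.*-zeroˡ (∏.sum (t ∘ suc)))
∏-zero t (suc e) eq = trans (cong (t zero *_) (∏-zero (t ∘ suc) e eq)) (ℚ.*-zeroʳ (t zero))

-- The possible values of (split - cross) at four corners coloured a, b (at one
-- end of the edge) and c, d (at the other one).
data EdgeCase {k} (a b c d : Fin k) : ℚ → Set where
  split : a ≡ b → c ≡ d → a ≢ c → EdgeCase a b c d 1ℚ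
  cross : a ≡ c → b ≡ d → a ≢ b → EdgeCase a b c d (- 1ℚ)
  none  : (a ≡ b → c ≡ d → a ≡ c) → (a ≡ c → b ≡ d → a ≡ b) → EdgeCase a b c d 0ℚ

edge-case : ∀ {k} (a b c d : Fin k) →
            EdgeCase a b c d (𝟙 (a Fin.≟ b) * (𝟙 (c Fin.≟ d) * 1ℚ) - 𝟙 (a Fin.≟ c) * (𝟙 (b Fin.≟ d) * 1ℚ))
edge-case a b c d with a Fin.≟ b | c Fin.≟ d | a Fin.≟ c | b Fin.≟ d
... | yes p | yes q | no r  | yes s = split p q r
... | yes p | yes q | no r  | no s  = split p q r
... | yes p | yes q | yes r | yes s = none (λ _ _ → r) (λ _ _ → p)
... | yes p | yes q | yes r | no s  = ⊥-elim (s (trans (sym p) (trans r q)))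
... | yes p | no q  | yes r | yes s = ⊥-elim (q (trans (sym r) (trans p s)))
... | yes p | no q  | yes r | no s  = none (λ _ x → ⊥-elim (q x)) (λ _ _ → p)
... | yes p | no q  | no r  | yes s = none (λ _ x → ⊥-elim (q x)) (λ _ _ → p)
... | yes p | no q  | no r  | no s  = none (λ _ x → ⊥-elim (q x)) (λ _ _ → p)
... | no p  | yes q | yes r | yes s = ⊥-elim (p (trans r (trans q (sym s))))
... | no p  | yes q | yes r | no s  = none (λ x _ → ⊥-elim (p x)) (λ _ x → ⊥-elim (s x))
... | no p  | yes q | no r  | yes s = none (λ x _ → ⊥-elim (p x)) (λ x _ → ⊥-elim (r x))
... | no p  | yes q | no r  | no s  = none (λ x _ → ⊥-elim (p x)) (λ x _ → ⊥-elim (r x))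
... | no p  | no q  | yes r | yes s = cross r s p
... | no p  | no q  | yes r | no s  = none (λ x _ → ⊥-elim (p x)) (λ _ x → ⊥-elim (s x))
... | no p  | no q  | no r  | yes s = none (λ x _ → ⊥-elim (p x)) (λ x _ → ⊥-elim (r x))
... | no p  | no q  | no r  | no s  = none (λ x _ → ⊥-elim (p x)) (λ x _ → ⊥-elim (r x))

edge-case-nonzero : ∀ {k} {a b c d : Fin k} {w} → EdgeCase a b c d w →
                    (a ≡ b × c ≡ d × a ≢ c) ⊎ (a ≡ c × b ≡ d × a ≢ b) → w ≢ 0ℚ
edge-case-nonzero (split _ _ _) _ ()
edge-case-nonzero (cross _ _ _) _ ()
edge-case-nonzero (none h _) (inj₁ (p , q , r)) _ = r (h p q)
edge-case-nonzero (none _ h) (inj₂ (p , q , r)) _ = r (h p q)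

𝟙-sym : ∀ {k} (a b : Fin k) → 𝟙 (a Fin.≟ b) ≡ 𝟙 (b Fin.≟ a)
𝟙-sym a b with a Fin.≟ b
... | yes eq = sym (𝟙-yes (b Fin.≟ a) (sym eq))
... | no neq = sym (𝟙-no (b Fin.≟ a) (neq ∘ sym))

-- A bilinear form on 𝔽₂² with form x x ≡ true for every x other than zero.
form : Bool → Bool → Bool → Bool → Bool
form s₁ s₂ t₁ t₂ = ((s₁ ∧ t₁) xor (s₂ ∧ t₂)) xor (s₁ ∧ t₂)

-- On the diagonal this is the anisotropic quadratic form s² + st + t². The hypothesis only excludes
-- the zero vector, in a shape that suits case analysis.
form-diagonal : ∀ s t → (s ≡ false → t ≡ false → false ≡ true) → form s t s t ≡ true
form-diagonal false false h = h refl refl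
form-diagonal false true  _ = refl
form-diagonal true  false _ = refl
form-diagonal true  true  _ = refl

form-zeroʳ : ∀ s t → form s t false false ≡ false
form-zeroʳ false false = refl
form-zeroʳ false true  = refl
form-zeroʳ true  false = refl
form-zeroʳ true  true  = refl

form-xorˡ : ∀ k₁ k₂ l₁ l₂ t₁ t₂ → form (k₁ xor l₁) (k₂ xor l₂) t₁ t₂ ≡ form k₁ k₂ t₁ t₂ xor form l₁ l₂ t₁ t₂
form-xorˡ = solve 6 (λ k₁ k₂ l₁ l₂ t₁ t₂ →
    ((k₁ :+ l₁) :* t₁ :+ (k₂ :+ l₂) :* t₂) :+ (k₁ :+ l₁) :* t₂ :=
    ((k₁ :* t₁ :+ k₂ :* t₂) :+ k₁ :* t₂) :+ ((l₁ :* t₁ :+ l₂ :* t₂) :+ l₁ :* t₂)) refl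
  where open Bool.xor-∧-Solver

form-xorʳ : ∀ k₁ k₂ s₁ s₂ t₁ t₂ → form k₁ k₂ (s₁ xor t₁) (s₂ xor t₂) ≡ form k₁ k₂ s₁ s₂ xor form k₁ k₂ t₁ t₂
form-xorʳ = solve 6 (λ k₁ k₂ s₁ s₂ t₁ t₂ →
    (k₁ :* (s₁ :+ t₁) :+ k₂ :* (s₂ :+ t₂)) :+ k₁ :* (s₂ :+ t₂) :=
    ((k₁ :* s₁ :+ k₂ :* s₂) :+ k₁ :* s₂) :+ ((k₁ :* t₁ :+ k₂ :* t₂) :+ k₁ :* t₂)) refl
  where open Bool.xor-∧-Solver

Fin4↔ : Fin 4 ↔ (Bool × Bool)
Fin4↔ = (Fin.2↔Bool ×-↔ Fin.2↔Bool) ↔-∘ Fin.*↔× {2} {2}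

Fin4-injective : ∀ {a b} → Inverse.to Fin4↔ a ≡ Inverse.to Fin4↔ b → a ≡ b
Fin4-injective {a} {b} eq = trans (sym (Inverse.strictlyInverseʳ Fin4↔ a))
    (trans (cong (Inverse.from Fin4↔) eq) (Inverse.strictlyInverseʳ Fin4↔ b))

all-sides : ∀ {m} (φ : HalfEdge m × Bool → Bool) e t {s} →
            φ ((e , false) , false) xor φ (partner (just t) ((e , false) , false)) ≡ s →
            φ ((e , false) , true) xor φ (partner (just t) ((e , false) , true)) ≡ s →
            ∀ i r → φ ((e , i) , r) xor φ (partner (just t) ((e , i) , r)) ≡ s
all-sides φ e t     p q false false = p
all-sides φ e t     p q false true  = q
all-sides φ e false p q true  false = trans (Bool.xor-comm (φ ((e , true) , false)) _) q
all-sides φ e false p q true  true  = trans (Bool.xor-comm (φ ((e , true) , true)) _) p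
all-sides φ e true  p q true  false = trans (Bool.xor-comm (φ ((e , true) , false)) _) p
all-sides φ e true  p q true  true  = trans (Bool.xor-comm (φ ((e , true) , true)) _) q

-- Signed corner colourings of the Petrie dual of a plane graph

module _ (G : RibbonGraph) where
  open RibbonGraph G

  across-edge : Fin #E → Corner G → Corner G
  across-edge e = partner (just (not (twisted e)))

  edgeWeight : ∀ {k} → (Corner G → Fin k) → Fin #E → ℚ
  edgeWeight φ e = agreement φ (kindPieces nothing e) - agreement φ (kindPieces (just (not (twisted e))) e)

  edgeWeight-case : ∀ {k} (φ : Corner G → Fin k) e →
    EdgeCase (φ ((e , false) , false)) (φ ((e , false) , true))
      (φ (across-edge e ((e , false) , false))) (φ (across-edge e ((e , false) , true))) (edgeWeight φ e)
  edgeWeight-case φ e = by-twist (not (twisted e))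
    where
    by-twist : ∀ t → EdgeCase (φ ((e , false) , false)) (φ ((e , false) , true))
      (φ (partner (just t) ((e , false) , false))) (φ (partner (just t) ((e , false) , true)))
      (agreement φ (kindPieces nothing e) - agreement φ (kindPieces (just t) e))
    by-twist true  = edge-case (φ ((e , false) , false)) (φ ((e , false) , true)) (φ ((e , true) , false))
        (φ ((e , true) , true))
    by-twist false = subst (EdgeCase _ _ _ _)
      (cong (λ p → 𝟙 (φ ((e , false) , false) Fin.≟ φ ((e , false) , true)) * (p * 1ℚ)
                 - 𝟙 (φ ((e , false) , false) Fin.≟ φ ((e , true) , true)) *
                     (𝟙 (φ ((e , false) , true) Fin.≟ φ ((e , true) , false)) * 1ℚ))
            (𝟙-sym (φ ((e , true) , true)) (φ ((e , true) , false))))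
      (edge-case (φ ((e , false) , false)) (φ ((e , false) , true)) (φ ((e , true) , true)) (φ ((e , true) , false)))

  -- The product of two of the three involutions is the third: a side of the ribbon in G leads where
  -- the arc followed by a side in the Petrie dual leads.
  face-partners : ∀ e → partner (just (twisted e)) ((e , false) , false) ≡ across-edge e ((e , false) , true)
                      × partner (just (twisted e)) ((e , false) , true) ≡ across-edge e ((e , false) , false)
  face-partners e with twisted e
  ... | false = refl , refl
  ... | true  = refl , refl

  present : ∀ A e (φ : Corner G → Bool) x {b} → lookup A e ≡ inside → φ x xor φ (partner (just (twisted e)) x) ≡ b →
            φ x xor φ (partner (ribbons G A e) x) ≡ (if lookup A e then b else false)
  present A e φ x eq p with lookup A e | eq
  ... | true | refl = p

  module _ {k} (φ : Corner G → Fin k) (respects : Respects φ (vertexPieces G)) (nonzero : ∀ e → edgeWeight φ e ≢ 0ℚ) where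

    private
      X Y : Fin #E → Corner G
      X e = (e , false) , false
      Y e = (e , false) , true

    module _ (bit : Fin k → Bool) where

      private
        α : Corner G → Bool
        α = bit ∘ φ

      tension : Fin #E → Bool
      tension e = α (X e) xor α (partner (just (twisted e)) (X e))

      -- Along the sides of the ribbon of G, `a` faces `d` and `b` faces `c`. In a split as in a
      -- cross, both changes are the sum of the two colours that occur at the edge.
      second-side : ∀ e → α (Y e) xor α (partner (just (twisted e)) (Y e)) ≡ tension e
      second-side e = subst₂ (λ y x → α (Y e) xor α y ≡ α (X e) xor α x) (sym (proj₂ (face-partners e)))
          (sym (proj₁ (face-partners e)))
        (opposite (edgeWeight-case φ e) (nonzero e))
        where
        opposite : ∀ {a b c d w} → EdgeCase a b c d w → w ≢ 0ℚ → bit b xor bit c ≡ bit a xor bit d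
        opposite (split refl refl _) _ = refl
        opposite {a} {b} (cross refl refl _) _ = Bool.xor-comm (bit b) (bit a)
        opposite (none _ _) w = ⊥-elim (w refl)

      φ-tension : Tension G ⊤ tension α
      φ-tension = record
        { around = λ h → cong bit (respects (vertexPiece-∈ G h))
        ; across = λ { x@((e , i) , s) → present ⊤ e α x (Vec.lookup-replicate e inside)
            (all-sides α e (twisted e) refl (second-side e) i s) }
        }

    module _ (plane : Plane G) (bits : Fin k → Bool × Bool) (bits-injective : ∀ {a b} → bits a ≡ bits b → a ≡ b) where

      private
        bit₁ = proj₁ ∘ bits
        bit₂ = proj₂ ∘ bits
        pot₁ = potential G plane ⊤ (φ-tension bit₁)
        pot₂ = potential G plane ⊤ (φ-tension bit₂)
        κ₁ = proj₁ pot₁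
        κ₂ = proj₁ pot₂
        on₁ : ∀ e → κ₁ (end (e , false)) xor κ₁ (end (e , true)) ≡ tension bit₁ e
        on₁ e = proj₂ pot₁ e (Vec.lookup-replicate e inside)
        on₂ : ∀ e → κ₂ (end (e , false)) xor κ₂ (end (e , true)) ≡ tension bit₂ e
        on₂ e = proj₂ pot₂ e (Vec.lookup-replicate e inside)

      -- The two bits give two potentials and together a map of the vertices to 𝔽₂². Its change
      -- along an edge is the sum of the two different colours at that edge, hence nonzero.
      weight-colourable : Colourable G 4
      weight-colourable = (λ v → Inverse.from Fin4↔ (κ₁ v , κ₂ v)) , proper
        where
        distinct : ∀ {a b c d : Fin k} {w} → EdgeCase a b c d w → w ≢ 0ℚ → a ≢ d
        distinct (split _ refl a≢c) _ = a≢c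
        distinct (cross _ refl a≢b) _ = a≢b
        distinct (none _ _) w _ = w refl
        proper : ∀ e → Inverse.from Fin4↔ (κ₁ (end (e , false)) , κ₂ (end (e , false))) ≢ Inverse.from Fin4↔
            (κ₁ (end (e , true)) , κ₂ (end (e , true)))
        proper e eq = distinct (edgeWeight-case φ e) (nonzero e) (trans (bits-injective (cong₂ _,_
            (xor≡false (trans (sym (on₁ e)) (≡⇒xor (cong proj₁ same))))
                (xor≡false (trans (sym (on₂ e)) (≡⇒xor (cong proj₂ same))))))
            (cong φ (proj₁ (face-partners e))))
          where
          same : (κ₁ (end (e , false)) , κ₂ (end (e , false))) ≡ (κ₁ (end (e , true)) , κ₂ (end (e , true)))
          same = trans (sym (Inverse.strictlyInverseˡ Fin4↔ _))
              (trans (cong (Inverse.to Fin4↔) eq) (Inverse.strictlyInverseˡ Fin4↔ _))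

      private
        turn : (Fin k → Bool) → Fin #E → Bool
        turn bit e = bit (φ (X e)) xor bit (φ (Y e))

        crossing : Fin #E → Bool
        crossing e = form (tension bit₁ e) (tension bit₂ e) (turn bit₁ e) (turn bit₂ e)

      -- At a split the turn is zero. At a cross it equals the tension, which is nonzero there, so
      -- `form` takes the value true.
      edgeWeight-sgn : ∀ e → edgeWeight φ e ≡ sgn (crossing e)
      edgeWeight-sgn e = subst₂ (λ x y → edgeWeight φ e ≡ sgn (form x y (turn bit₁ e) (turn bit₂ e)))
          (cong (λ x → bit₁ (φ (X e)) xor bit₁ (φ x)) (sym (proj₁ (face-partners e))))
          (cong (λ x → bit₂ (φ (X e)) xor bit₂ (φ x)) (sym (proj₁ (face-partners e))))
          (by-case (edgeWeight-case φ e) (nonzero e))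
        where
        by-case : ∀ {a b c d w} → EdgeCase a b c d w → w ≢ 0ℚ →
                  w ≡ sgn (form (bit₁ a xor bit₁ d) (bit₂ a xor bit₂ d) (bit₁ a xor bit₁ b) (bit₂ a xor bit₂ b))
        by-case {a} {d = d} (split refl refl _) _ = cong sgn (sym (trans
          (cong₂ (form (bit₁ a xor bit₁ d) (bit₂ a xor bit₂ d)) (Bool.xor-same (bit₁ a)) (Bool.xor-same (bit₂ a)))
          (form-zeroʳ (bit₁ a xor bit₁ d) (bit₂ a xor bit₂ d))))
        by-case {a} {b} (cross refl refl a≢b) _ = cong sgn (sym (form-diagonal (bit₁ a xor bit₁ b) (bit₂ a xor bit₂ b)
          λ p q → ⊥-elim (a≢b (bits-injective (cong₂ _,_ (xor≡false p) (xor≡false q))))))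
        by-case (none _ _) w = ⊥-elim (w refl)

      -- Moving κ onto one factor turns the number of crossings into a sum over
      -- half-edges that telescopes around every vertex.
      crossing-even : Xor.sum crossing ≡ false
      crossing-even = trans (Xor.sum-cong-≗ regroup) (xorSum-next next g)
        where
        g : HalfEdge #E → Bool
        g h = form (κ₁ (end h)) (κ₂ (end h)) (bit₁ (φ (h , false))) (bit₂ (φ (h , false)))
        half : ∀ h → form (κ₁ (end h)) (κ₂ (end h)) (bit₁ (φ (h , false)) xor bit₁ (φ (h , true)))
            (bit₂ (φ (h , false)) xor bit₂ (φ (h , true)))
                     ≡ g h xor g (Inverse.to next h)
        half h = trans (form-xorʳ (κ₁ (end h)) (κ₂ (end h)) _ _ _ _) (cong (g h xor_)
          (trans (cong (λ v → form (κ₁ v) (κ₂ v) (bit₁ (φ (h , true))) (bit₂ (φ (h , true)))) (sym (end-next G h)))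
                 (cong (λ x → form (κ₁ (end (Inverse.to next h))) (κ₂ (end (Inverse.to next h))) (bit₁ x)
                     (bit₂ x)) (respects (vertexPiece-∈ G h)))))
        -- Equal tension along the two sides makes the turn the same at both ends of the edge, so
        -- each summand of `form-xorˡ` can use the turn at its own end.
        far : ∀ bit e → turn bit e ≡ bit (φ ((e , true) , false)) xor bit (φ ((e , true) , true))
        far bit e = xor≡false (sides-cancel (bit ∘ φ) e (twisted e) refl (second-side bit e))
        regroup : ∀ e → crossing e ≡ (g (e , false) xor g (Inverse.to next (e , false))) xor
            (g (e , true) xor g (Inverse.to next (e , true)))
        regroup e = trans (cong₂ (λ s t → form s t (turn bit₁ e) (turn bit₂ e)) (sym (on₁ e)) (sym (on₂ e)))
          (trans (form-xorˡ (κ₁ (end (e , false))) (κ₂ (end (e , false))) (κ₁ (end (e , true)))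
              (κ₂ (end (e , true))) (turn bit₁ e) (turn bit₂ e))
          (cong₂ _xor_ (half (e , false))
              (trans (cong₂ (form (κ₁ (end (e , true))) (κ₂ (end (e , true)))) (far bit₁ e) (far bit₂ e))
              (half (e , true)))))

      weight-one : ∏.sum (edgeWeight φ) ≡ 1ℚ
      weight-one = trans (∏.sum-cong-≗ edgeWeight-sgn) (trans (∏-sgn crossing) (cong sgn crossing-even))

  weight-cases : Plane G → ∀ {k} (bits : Fin k → Bool × Bool) → (∀ {a b} → bits a ≡ bits b → a ≡ b) →
      (φ : Corner G → Fin k) →
                 weight (petrieDual G) φ ≡ 0ℚ ⊎ (weight (petrieDual G) φ ≡ 1ℚ × Colourable G 4)
  weight-cases plane bits inj φ with agreement-cases φ (vertexPieces G)
  ... | inj₂ (_ , is0) = inj₁ (trans (cong (_* ∏.sum (edgeWeight φ)) is0) (ℚ.*-zeroˡ (∏.sum (edgeWeight φ))))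
  ... | inj₁ (r , is1) with Fin.any? (λ e → edgeWeight φ e ℚ.≟ 0ℚ)
  ...   | yes (e , eq) =
          inj₁ (trans (cong (agreement φ (vertexPieces G) *_) (∏-zero (edgeWeight φ) e eq))
          (ℚ.*-zeroʳ (agreement φ (vertexPieces G))))
  ...   | no none≡0    = inj₂ (trans (cong₂ _*_ is1 (weight-one φ r nonzero plane bits inj)) (ℚ.*-identityˡ 1ℚ)
                              , weight-colourable φ r nonzero plane bits inj)
    where
    nonzero : ∀ e → edgeWeight φ e ≢ 0ℚ
    nonzero e eq = none≡0 (e , eq)

  weight-one-of : Plane G → ∀ {k} (bits : Fin k → Bool × Bool) → (∀ {a b} → bits a ≡ bits b → a ≡ b) →
      (φ : Corner G → Fin k) →
                  Respects φ (vertexPieces G) → (∀ e → edgeWeight φ e ≢ 0ℚ) → weight (petrieDual G) φ ≡ 1ℚ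
  weight-one-of plane bits inj φ r nonzero with agreement-cases φ (vertexPieces G)
  ... | inj₁ (_ , is1) = trans (cong₂ _*_ is1 (weight-one φ r nonzero plane bits inj)) (ℚ.*-identityˡ 1ℚ)
  ... | inj₂ (¬r , _)  = ⊥-elim (¬r r)

-- The stellation

partner-flips : ∀ {m} (side : HalfEdge m × Bool → Bool) k x →
                (∀ {y z} → (y , z) ∈ kindPieces k (edge x) → side z ≡ not (side y)) →
                side (partner k x) ≡ not (side x)
partner-flips side k x flips = by-cases (corner-cases k x)
  where
  forth : ∀ {z} → x ≡ z → side (partner k z) ≡ not (side z) → side (partner k x) ≡ not (side x)
  forth refl eq = eq
  back : ∀ {z} → x ≡ partner k z → side (partner k z) ≡ not (side z) → side (partner k x) ≡ not (side x)
  back {z} refl eq = trans (cong side (partner-involutive k z))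
      (trans (sym (Bool.not-involutive (side z))) (cong not (sym eq)))
  by-cases : let e = edge x in
             x ≡ first e ⊎ x ≡ partner k (first e) ⊎ x ≡ second k e ⊎ x ≡ partner k (second k e) →
             side (partner k x) ≡ not (side x)
  by-cases (inj₁ eq)               = forth eq (flips (here refl))
  by-cases (inj₂ (inj₁ eq))        = back eq (flips (here refl))
  by-cases (inj₂ (inj₂ (inj₁ eq))) = forth eq (flips (there (here refl)))
  by-cases (inj₂ (inj₂ (inj₂ eq))) = back eq (flips (there (here refl)))

-- An invariant of the relation that takes `M` different values separates `M` classes.
quotient-≥ : ∀ {A B : Set} {_~_ : A → A → Set} {M N} → Quotient _~_ N → (label : A → B) →
    (∀ {x y} → x ~ y → label x ≡ label y) →
             (pick : Fin M → A) → (∀ {i j} → label (pick i) ≡ label (pick j) → i ≡ j) → M ≤ N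
quotient-≥ Q label respects pick inj = Fin.injective⇒≤ {f = Quotient.class Q ∘ pick} λ eq →
    inj (respects (Quotient.complete Q eq))

ribbons-⊤ : ∀ G e → ribbons G ⊤ e ≡ just (RibbonGraph.twisted G e)
ribbons-⊤ G e = cong (if_then just (RibbonGraph.twisted G e) else nothing) (Vec.lookup-replicate e inside)

module _ (G : RibbonGraph) where
  open RibbonGraph G

  connected-linked : Connected G → ∀ u v → Adjacent G ⊤ u v
  connected-linked conn = all-linked conn (components-quotient Fin._≟_ ∈.∈-allFin (adjacencies G ⊤))
    where
    all-linked : ∀ {N} → N ≡ 1 → Quotient (Adjacent G ⊤) N → ∀ u v → Adjacent G ⊤ u v
    all-linked refl Q u v = Quotient.complete Q (single (Quotient.class Q u) (Quotient.class Q v))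
      where
      single : (i j : Fin 1) → i ≡ j
      single zero zero = refl

  linked-incident : ∀ {A u v} → Adjacent G A u v → u ≡ v ⊎ ∃ λ h → end h ≡ u
  linked-incident ε = inj₁ refl
  linked-incident {A} (fwd m ◅ _) with ∈-adjacencies⁻ G A m
  ... | e , _ , refl = inj₂ ((e , false) , refl)
  linked-incident {A} (bwd m ◅ _) with ∈-adjacencies⁻ G A m
  ... | e , _ , refl = inj₂ ((e , true) , refl)

  bare-zero : Connected G → HalfEdge #E → bare G ≡ 0
  bare-zero conn h = empty (bareVertices G) λ v v∈ → isolated v v∈ (linked-incident {⊤} (connected-linked conn v (end h)))
    where
    isolated : ∀ v → v ∈ bareVertices G → ¬ (v ≡ end h ⊎ ∃ λ h′ → end h′ ≡ v)
    isolated v v∈ (inj₁ eq)        = bareVertices-bare G {h = h} v∈ (sym eq)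
    isolated v v∈ (inj₂ (h′ , eq)) = bareVertices-bare G {h = h′} v∈ eq
    empty : ∀ vs → (∀ v → v ∉ vs) → length vs ≡ 0
    empty []       _ = refl
    empty (v ∷ vs) h = ⊥-elim (h v (here refl))

  full : State G
  full = just ∘ twisted

  private
    pieces : List (Corner G × Corner G)
    pieces = layers G full (allFin #E)
    faces = #components (_≟ᶜ_ G) (corners G) pieces
    Q : Quotient (Linked pieces) faces
    Q = components-quotient (_≟ᶜ_ G) (corners-complete G) pieces
    P = layerPaths G full (Unique.allFin⁺ #E)

    side : Corner G → Bool
    side = Paths.side P

    to-next prev : HalfEdge #E → HalfEdge #E
    to-next = Inverse.to next
    prev = Inverse.from next
    next-prev : ∀ h → to-next (prev h) ≡ h
    next-prev h = Inverse.strictlyInverseˡ next h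
    prev-next : ∀ h → prev (to-next h) ≡ h
    prev-next h = Inverse.strictlyInverseʳ next h

    opp : Corner G → Corner G
    opp x = partner (full (edge x)) x

    opp-opp : ∀ x → opp (opp x) ≡ x
    opp-opp x = partner-involutive (full (edge x)) x

    side-opp : ∀ x → side (opp x) ≡ not (side x)
    side-opp x = partner-flips side (full (edge x)) x λ m → Paths.side-flips P (∈-layers⁺ʳ G full (∈.∈-allFin (edge x)) m)

    opp-linked : ∀ x → Linked pieces x (opp x)
    opp-linked x = linked-mono (∈-layers⁺ʳ G full (∈.∈-allFin (edge x))) (kindPieces-linked (full (edge x)) x)

    vertex-∈ : ∀ h → vertexPiece G h ∈ pieces
    vertex-∈ h = ∈-layers⁺ˡ G full (allFin #E) (vertexPiece-∈ G h)

    side-next : ∀ h → side (to-next h , false) ≡ not (side (h , true))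
    side-next h = Paths.side-flips P (vertex-∈ h)

    angle : Corner G → HalfEdge #E
    angle (h , true)  = h
    angle (h , false) = prev h

    angle-linked : ∀ x → Linked pieces x (angle x , true)
    angle-linked (h , true)  = ε
    angle-linked (h , false) = subst (λ h′ → Linked pieces (h′ , false) (prev h , true)) (next-prev h)
        (linked-sym (link (vertex-∈ (prev h))))

    end-angle : ∀ x → end (angle x) ≡ at G x
    end-angle (h , true)  = refl
    end-angle (h , false) = trans (sym (end-next G (prev h))) (cong end (next-prev h))

    -- The boundary of each face is oriented so that it passes an angle from its
    -- corner with side false to its corner with side true.
    corner-of : Bool → HalfEdge #E → Corner G
    corner-of b h = if side (h , true) xor b then (to-next h , false) else (h , true)

    corner-of-true : ∀ b h → side (h , true) ≡ b → corner-of b h ≡ (h , true)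
    corner-of-true b h eq with side (h , true) | b | eq
    ... | true  | true  | _ = refl
    ... | false | false | _ = refl

    corner-of-false : ∀ b h → side (h , true) ≡ not b → corner-of b h ≡ (to-next h , false)
    corner-of-false b h eq with side (h , true) | b | eq
    ... | true  | false | _ = refl
    ... | false | true  | _ = refl

    angle-corner-of : ∀ b h → angle (corner-of b h) ≡ h
    angle-corner-of b h with side (h , true) | b
    ... | true  | true  = refl
    ... | false | false = refl
    ... | true  | false = prev-next h
    ... | false | true  = prev-next h

    side-corner-of : ∀ b h → side (corner-of b h) ≡ b
    side-corner-of b h with side (h , true) Bool.≟ b
    ... | yes eq = trans (cong side (corner-of-true b h eq)) eq
    ... | no neq = trans (cong side (corner-of-false b h (Bool.¬-not neq))) (trans (side-next h)
                     (trans (cong not (Bool.¬-not neq)) (Bool.not-involutive b)))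

    corner-of-angle : ∀ b x → side x ≡ b → corner-of b (angle x) ≡ x
    corner-of-angle b (h , true)  eq = corner-of-true b h eq
    corner-of-angle b (h , false) eq = trans (corner-of-false b (prev h)
      (trans (sym (Bool.not-involutive _))
          (cong not (trans (sym (side-next (prev h))) (trans (cong (λ h → side (h , false)) (next-prev h)) eq)))))
      (cong (_, false) (next-prev h))

    -- One step around a face: leave the angle at its corner of side `b` and follow the edge to the
    -- next angle. The two values of `b` give opposite directions.
    walk : Bool → HalfEdge #E → HalfEdge #E
    walk b h = angle (opp (corner-of b h))

    walk-corner : ∀ b h → corner-of (not b) (walk b h) ≡ opp (corner-of b h)
    walk-corner b h = corner-of-angle (not b) (opp (corner-of b h))
        (trans (side-opp (corner-of b h)) (cong not (side-corner-of b h)))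

    walk-walk : ∀ b h → walk (not b) (walk b h) ≡ h
    walk-walk b h = trans (cong (angle ∘ opp) (walk-corner b h))
        (trans (cong angle (opp-opp (corner-of b h))) (angle-corner-of b h))

    -- Edges of the stellation: those of G, and one spoke for each angle of G, which
    -- is named by the half-edge preceding it.  A spoke has its end false at the
    -- vertex and its end true at the face.
    Edge₊ : Set
    Edge₊ = Fin #E ⊎ HalfEdge #E

    Half₊ : Set
    Half₊ = Edge₊ × Bool

    pattern orig h i = (inj₁ h , i)
    pattern inner h  = (inj₂ h , false)
    pattern outer h  = (inj₂ h , true)

    -- At an old vertex each half-edge is followed by the spoke of the angle after it; at the vertex
    -- inside a face the spokes are ordered by the oriented boundary.
    next₊ : Half₊ → Half₊
    next₊ (orig e i) = inner (e , i)
    next₊ (inner h)  = inj₁ (proj₁ (to-next h)) , proj₂ (to-next h)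
    next₊ (outer h)  = outer (walk true h)

    prev₊ : Half₊ → Half₊
    prev₊ (orig e i) = inner (prev (e , i))
    prev₊ (inner h)  = inj₁ (proj₁ h) , proj₂ h
    prev₊ (outer h)  = outer (walk false h)

    end₊ : Half₊ → Fin #V ⊎ Fin faces
    end₊ (orig e i) = inj₁ (end (e , i))
    end₊ (inner h)  = inj₁ (end h)
    end₊ (outer h)  = inj₂ (Quotient.class Q (h , true))

    -- The disc inside a face is oriented by `side`. If `side (h , true)` holds, the boundary of the
    -- face passes the angle from `next h` to `h`, as it does around a face oriented like the vertex
    -- disc, and the spoke is untwisted.
    twisted₊ : Edge₊ → Bool
    twisted₊ (inj₁ e) = twisted e
    twisted₊ (inj₂ h) = not (side (h , true))

    next↔ : Half₊ ↔ Half₊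
    next↔ = mk↔ₛ′ next₊ prev₊ next-prev₊ prev-next₊
      where
      next-prev₊ : ∀ h → next₊ (prev₊ h) ≡ h
      next-prev₊ (orig e i) = cong (λ h → inj₁ (proj₁ h) , proj₂ h) (next-prev (e , i))
      next-prev₊ (inner h)  = refl
      next-prev₊ (outer h)  = cong outer (walk-walk false h)
      prev-next₊ : ∀ h → prev₊ (next₊ h) ≡ h
      prev-next₊ (orig e i) = refl
      prev-next₊ (inner h)  = cong inner (prev-next h)
      prev-next₊ (outer h)  = cong outer (walk-walk true h)

    Step₊ : Half₊ → Half₊ → Set
    Step₊ a b = next₊ a ≡ b

    class-angle : ∀ x → Quotient.class Q (angle x , true) ≡ Quotient.class Q x
    class-angle x = Quotient.sound Q (linked-sym (angle-linked x))

    class-opp : ∀ x → Quotient.class Q (opp x) ≡ Quotient.class Q x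
    class-opp x = Quotient.sound Q (linked-sym (opp-linked x))

    end-next₊ : ∀ h → end₊ h ≡ end₊ (next₊ h)
    end-next₊ (orig e i) = refl
    end-next₊ (inner h)  = cong inj₁ (sym (end-next G h))
    end-next₊ (outer h)  = cong inj₂ (sym (trans (class-angle (opp (corner-of true h))) (trans (class-opp (corner-of true h))
      (trans (sym (class-angle (corner-of true h))) (cong (λ h → Quotient.class Q (h , true)) (angle-corner-of true h))))))

    vertex-cycle : ∀ {h h′} → end h ≡ end h′ → EqClosure Step₊ (inner h) (inner h′)
    vertex-cycle {h} {h′} eq = EqC.gfold (EqC.isEquivalence Step₊) inner
      (λ { refl → fwd refl ◅ fwd refl ◅ ε }) (Equivalence.to (cyclic h h′) eq)

    -- A side of an edge is one step of `walk true`, taken forwards or backwards according to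
    -- `side`; a piece at a vertex stays within one angle.
    face-cycle : ∀ {x y} → Linked pieces x y → EqClosure Step₊ (outer (angle x)) (outer (angle y))
    face-cycle = EqC.gfold (EqC.isEquivalence Step₊) (outer ∘ angle) step
      where
      along : ∀ x → EqClosure Step₊ (outer (angle x)) (outer (angle (opp x)))
      along x with side x in eq
      ... | true  = fwd (cong (outer ∘ angle ∘ opp) (corner-of-angle true x eq)) ◅ ε
      ... | false = bwd (cong outer
              (trans (cong (angle ∘ opp) (corner-of-angle true (opp x) (trans (side-opp x) (cong not eq))))
              (cong angle (opp-opp x)))) ◅ ε
      step : ∀ {x y} → (x , y) ∈ pieces → EqClosure Step₊ (outer (angle x)) (outer (angle y))
      step m with ∈-layers⁻ G full (allFin #E) m
      step m | inj₁ v with ∈.∈-map⁻ (vertexPiece G) v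
      ... | h , _ , refl = subst (λ h′ → EqClosure Step₊ (outer h) (outer h′)) (sym (prev-next h)) ε
      step {x} m | inj₂ (e , _ , q) with kindPieces-partner {k = full e} q
      ... | refl , refl = along x

    cyclic₊ : ∀ h h′ → end₊ h ≡ end₊ h′ → EqClosure Step₊ h h′
    cyclic₊ (orig e i) (orig e′ i′) eq = (fwd refl ◅ ε) ◅◅ vertex-cycle (Sum.inj₁-injective eq) ◅◅ (bwd refl ◅ ε)
    cyclic₊ (orig e i) (inner h)    eq = (fwd refl ◅ ε) ◅◅ vertex-cycle (Sum.inj₁-injective eq)
    cyclic₊ (inner h)  (orig e i)   eq = vertex-cycle (Sum.inj₁-injective eq) ◅◅ (bwd refl ◅ ε)
    cyclic₊ (inner h)  (inner h′)   eq = vertex-cycle (Sum.inj₁-injective eq)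
    cyclic₊ (outer h)  (outer h′)   eq = face-cycle (Quotient.complete Q (Sum.inj₂-injective eq))
    cyclic₊ (orig _ _) (outer _)    ()
    cyclic₊ (inner _)  (outer _)    ()
    cyclic₊ (outer _)  (orig _ _)   ()
    cyclic₊ (outer _)  (inner _)    ()

    -- The triangle of the stellation containing a given corner, named by the
    -- angle after which the boundary of a face of G runs along the base.
    triangle : Corner G → HalfEdge #E
    triangle x = angle (if side x then x else opp x)

    triangle-true : ∀ x → side x ≡ true → triangle x ≡ angle x
    triangle-true x eq with side x | eq
    ... | true | refl = refl

    triangle-false : ∀ x → side x ≡ false → triangle x ≡ angle (opp x)
    triangle-false x eq with side x | eq
    ... | false | refl = refl

    triangle-opp : ∀ x → triangle (opp x) ≡ triangle x
    triangle-opp x with side x in eq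
    ... | true  = trans (triangle-false (opp x) (trans (side-opp x) (cong not eq))) (cong angle (opp-opp x))
    ... | false = triangle-true (opp x) (trans (side-opp x) (cong not eq))

    triangle-corner-of : ∀ h → triangle (corner-of true h) ≡ h
    triangle-corner-of h = trans (triangle-true _ (side-corner-of true h)) (angle-corner-of true h)

    -- A spoke separates the two triangles at the two corners of its angle, and its own corners at
    -- either end are labelled accordingly.
    triangle₊ : Half₊ × Bool → HalfEdge #E
    triangle₊ (orig e i , s)    = triangle ((e , i) , s)
    triangle₊ (inner h , false) = triangle (h , true)
    triangle₊ (inner h , true)  = triangle (to-next h , false)
    triangle₊ (outer h , s)     = triangle (corner-of s h)

    triangle₊-next : ∀ h → triangle₊ (h , true) ≡ triangle₊ (next₊ h , false)
    triangle₊-next (orig e i) = refl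
    triangle₊-next (inner h)  = refl
    triangle₊-next (outer h)  = sym (trans (cong triangle (walk-corner true h)) (triangle-opp (corner-of true h)))

    -- At the vertex a spoke meets its two triangles in positional order, at the face in the order
    -- of `side`; the twist of the spoke is what matches the two orders.
    triangle₊-across : ∀ E i s → triangle₊ ((E , i) , s) ≡ triangle₊ ((E , not i) , side-flip (just (twisted₊ E)) s)
    triangle₊-across (inj₁ e) i s = sym (triangle-opp ((e , i) , s))
    triangle₊-across (inj₂ h) i s with side (h , true) in eq
    triangle₊-across (inj₂ h) false false | true  = cong triangle (sym (corner-of-true true h eq))
    triangle₊-across (inj₂ h) false true  | true  = cong triangle (sym (corner-of-false false h eq))
    triangle₊-across (inj₂ h) true  false | true  = cong triangle (corner-of-false false h eq)
    triangle₊-across (inj₂ h) true  true  | true  = cong triangle (corner-of-true true h eq)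
    triangle₊-across (inj₂ h) false false | false = cong triangle (sym (corner-of-true false h eq))
    triangle₊-across (inj₂ h) false true  | false = cong triangle (sym (corner-of-false true h eq))
    triangle₊-across (inj₂ h) true  false | false = cong triangle (corner-of-true false h eq)
    triangle₊-across (inj₂ h) true  true  | false = cong triangle (corner-of-false true h eq)

    Edge₊↔ : Fin (#E ℕ.+ #E ℕ.* 2) ↔ Edge₊
    Edge₊↔ = (↔-id (Fin #E) ⊎-↔ halves #E) ↔-∘ Fin.+↔⊎

    Half₊↔ : HalfEdge (#E ℕ.+ #E ℕ.* 2) ↔ Half₊
    Half₊↔ = Edge₊↔ ×-↔ ↔-id Bool

    Vertex₊↔ : Fin (#V ℕ.+ faces) ↔ (Fin #V ⊎ Fin faces)
    Vertex₊↔ = Fin.+↔⊎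

    vertex₊ : Fin #V ⊎ Fin faces → Fin (#V ℕ.+ faces)
    vertex₊ = Inverse.from Vertex₊↔

    vertex₊-injective : ∀ {x y} → vertex₊ x ≡ vertex₊ y → x ≡ y
    vertex₊-injective {x} {y} eq = trans (sym (Inverse.strictlyInverseˡ Vertex₊↔ x))
        (trans (cong (Inverse.to Vertex₊↔) eq) (Inverse.strictlyInverseˡ Vertex₊↔ y))

    open Inverse Half₊↔ using () renaming
        (to to to₊; from to from₊; strictlyInverseˡ to to-from₊; strictlyInverseʳ to from-to₊)

  stellation : RibbonGraph
  stellation = record
    { #V      = #V ℕ.+ faces
    ; #E      = #E ℕ.+ #E ℕ.* 2
    ; end     = vertex₊ ∘ end₊ ∘ to₊
    ; next    = ↔-sym Half₊↔ ↔-∘ (next↔ ↔-∘ Half₊↔)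
    ; cyclic  = λ h h′ → mk⇔ (joined h h′) (EqC.gfold isEquivalence (vertex₊ ∘ end₊ ∘ to₊) (same-end _))
    ; twisted = twisted₊ ∘ Inverse.to Edge₊↔
    }
    where
    Step : HalfEdge (#E ℕ.+ #E ℕ.* 2) → HalfEdge (#E ℕ.+ #E ℕ.* 2) → Set
    Step a b = from₊ (next₊ (to₊ a)) ≡ b
    joined : ∀ h h′ → vertex₊ (end₊ (to₊ h)) ≡ vertex₊ (end₊ (to₊ h′)) → EqClosure Step h h′
    joined h h′ eq = subst₂ (EqClosure Step) (from-to₊ h) (from-to₊ h′)
      (EqC.gmap from₊ (λ { {a} refl → cong (from₊ ∘ next₊) (to-from₊ a) }) (cyclic₊ (to₊ h) (to₊ h′) (vertex₊-injective eq)))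
    same-end : ∀ a {b} → Step a b → vertex₊ (end₊ (to₊ a)) ≡ vertex₊ (end₊ (to₊ b))
    same-end a refl = cong vertex₊ (trans (end-next₊ (to₊ a)) (cong end₊ (sym (to-from₊ (next₊ (to₊ a))))))

  private
    S = stellation
    module S = RibbonGraph stellation

    edge-end : ∀ E i → S.end (Inverse.from Edge₊↔ E , i) ≡ vertex₊ (end₊ (E , i))
    edge-end E i = cong (λ E → vertex₊ (end₊ (E , i))) (Inverse.strictlyInverseˡ Edge₊↔ E)

  stellation-loopless : Loopless G → Loopless S
  stellation-loopless loopless e eq = distinct (Inverse.to Edge₊↔ e) (vertex₊-injective eq)
    where
    distinct : ∀ E → end₊ (E , false) ≢ end₊ (E , true)
    distinct (inj₁ e) eq = loopless e (Sum.inj₁-injective eq)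
    distinct (inj₂ h) ()

  -- The triangle is an invariant of the boundary circles, and each of the 2|E| triangles occurs.
  stellation-loops : #E ℕ.* 2 ≤ loops S (ribbons S ⊤)
  stellation-loops = quotient-≥ (components-quotient (_≟ᶜ_ S) (corners-complete S) (layers S (ribbons S ⊤) (allFin S.#E)))
      label (linked-respects label respects) (pick ∘ Inverse.to (halves #E))
      λ {i} {j} eq → trans (sym (Inverse.strictlyInverseʳ (halves #E) i)) (trans (cong (Inverse.from (halves #E))
        (trans (sym (label-pick _)) (trans eq (label-pick _)))) (Inverse.strictlyInverseʳ (halves #E) j))
    where
    label : Corner S → HalfEdge #E
    label (h , s) = triangle₊ (to₊ h , s)
    pick : HalfEdge #E → Corner S
    pick h = let ((e , i) , s) = corner-of true h in from₊ (orig e i) , s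
    label-pick : ∀ h → label (pick h) ≡ h
    label-pick h = let ((e , i) , s) = corner-of true h in
      trans (cong (λ h → triangle₊ (h , s)) (to-from₊ (orig e i))) (triangle-corner-of h)
    respects : ∀ {x y} → (x , y) ∈ layers S (ribbons S ⊤) (allFin S.#E) → label x ≡ label y
    respects m with ∈-layers⁻ S (ribbons S ⊤) (allFin S.#E) m
    respects m | inj₁ v with ∈.∈-map⁻ (vertexPiece S) v
    ... | h , _ , refl = trans (triangle₊-next (to₊ h)) (cong (λ h → triangle₊ (h , false)) (sym (to-from₊ (next₊ (to₊ h)))))
    respects {x@((e , i) , s)} m | inj₂ (e′ , _ , q) with kindPieces-partner {k = ribbons S ⊤ e′} q
    ... | refl , eq = trans (triangle₊-across (Inverse.to Edge₊↔ e) i s)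
            (cong label (sym (trans eq (cong (λ k → partner k x) (ribbons-⊤ S e)))))

  stellation-connected : Connected G → Connected S
  stellation-connected conn = quotient-unique (components-quotient Fin._≟_ ∈.∈-allFin (adjacencies S ⊤)) single id id
    where
    spoke : ∀ E → Adjacent S ⊤ (vertex₊ (end₊ (E , false))) (vertex₊ (end₊ (E , true)))
    spoke E = subst₂ (Adjacent S ⊤) (edge-end E false) (edge-end E true)
        (link (∈-adjacencies⁺ S ⊤ (Vec.lookup-replicate (Inverse.from Edge₊↔ E) inside)))
    originals : ∀ {u v} → Adjacent G ⊤ u v → Adjacent S ⊤ (vertex₊ (inj₁ u)) (vertex₊ (inj₁ v))
    originals = EqC.gfold (EqC.isEquivalence _) (vertex₊ ∘ inj₁) step
      where
      step : ∀ {u v} → (u , v) ∈ adjacencies G ⊤ → Adjacent S ⊤ (vertex₊ (inj₁ u)) (vertex₊ (inj₁ v))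
      step m with ∈-adjacencies⁻ G ⊤ m
      ... | e , _ , refl = spoke (inj₁ e)
    v₀ : Fin #V
    v₀ = Quotient.rep (components-quotient Fin._≟_ ∈.∈-allFin (adjacencies G ⊤)) (subst Fin (sym conn) zero)
    reach₊ : ∀ x → Adjacent S ⊤ (vertex₊ (inj₁ v₀)) (vertex₊ x)
    reach₊ (inj₁ v) = originals (connected-linked conn v₀ v)
    reach₊ (inj₂ i) = originals (connected-linked conn v₀ (end (angle x))) ◅◅
        subst (λ i → Adjacent S ⊤ (vertex₊ (inj₁ (end (angle x)))) (vertex₊ (inj₂ i)))
            (trans (class-angle x) (Quotient.class-rep Q i)) (spoke (inj₂ (angle x)))
      where x = Quotient.rep Q i
    reach : ∀ w → Adjacent S ⊤ (vertex₊ (inj₁ v₀)) w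
    reach w = subst (Adjacent S ⊤ (vertex₊ (inj₁ v₀))) (Inverse.strictlyInverseʳ Vertex₊↔ w) (reach₊ (Inverse.to Vertex₊↔ w))
    single : Quotient (Adjacent S ⊤) 1
    single = record
      { class     = λ _ → zero
      ; rep       = λ _ → vertex₊ (inj₁ v₀)
      ; class-rep = λ { zero → refl }
      ; sound     = λ _ → refl
      ; complete  = λ {x} {y} _ → linked-sym (reach x) ◅◅ reach y
      }

  -- With F faces in G, the stellation has v + F vertices, 3|E| edges and at least 2|E| faces, so
  -- its Euler characteristic is at least that of G; `euler-≤` bounds it from above. The half-edge
  -- ensures that every face of G carries a corner: without edges `faces` is 0 although f is 1.
  stellation-plane : Plane G → HalfEdge #E → Plane S
  stellation-plane plane@(conn , _) h = conn₊ ,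
      genus (c S ⊤) S.#V S.#E (f S ⊤) (ℕ.≤-antisym upper lower)
    where
    conn₊ = stellation-connected conn
    open import Data.Integer.Base using (+_)
    genus : ∀ c v e f → c ℕ.+ c ℕ.+ e ≡ v ℕ.+ f → + 2 ℤ.* + c ℤ.- (+ v ℤ.- + e ℤ.+ + f) ≡ + 0
    genus c v e f eq = trans (rearrange (+ c) (+ v) (+ e) (+ f))
        (trans (cong (ℤ._- (+ v ℤ.+ + f)) (cong +_ eq)) (ℤ.+-inverseʳ (+ v ℤ.+ + f)))
      where
      open ℤ.+-*-Solver
      rearrange : ∀ c v e f → + 2 ℤ.* c ℤ.- (v ℤ.- e ℤ.+ f) ≡ c ℤ.+ c ℤ.+ e ℤ.- (v ℤ.+ f)
      rearrange = solve 4 (λ c v e f → con (+ 2) :* c :- (v :- e :+ f) := c :+ c :+ e :- (v :+ f)) refl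
    faces≡ : f G ⊤ ≡ faces
    faces≡ = trans (f-loops G ⊤)
        (trans (cong₂ ℕ._+_ (loops-cong G {full} {ribbons G ⊤} (ribbons-⊤ G)) (bare-zero conn h))
        (ℕ.+-identityʳ faces))
    upper : c S ⊤ ℕ.+ c S ⊤ ℕ.+ S.#E ≤ S.#V ℕ.+ f S ⊤
    upper = bound #V faces #E conn conn₊ faces≡ (plane-flat G plane)
        (ℕ.≤-trans stellation-loops (ℕ.≤-trans (ℕ.m≤m+n _ (bare S)) (ℕ.≤-reflexive (sym (f-loops S ⊤)))))
      where
      bound : ∀ v F m {c c′ f f′} → c ≡ 1 → c′ ≡ 1 → f ≡ F → c ℕ.+ c ℕ.+ m ≡ v ℕ.+ f → m ℕ.* 2 ≤ f′ →
              c′ ℕ.+ c′ ℕ.+ (m ℕ.+ m ℕ.* 2) ≤ v ℕ.+ F ℕ.+ f′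
      bound v F m {f′ = f′} refl refl refl eq le = ℕ.≤-trans (ℕ.≤-reflexive (sym (ℕ.+-assoc 2 m (m ℕ.* 2))))
        (ℕ.≤-trans (ℕ.≤-reflexive (cong (ℕ._+ m ℕ.* 2) eq)) (ℕ.+-monoʳ-≤ (v ℕ.+ F) le))
    lower : S.#V ℕ.+ f S ⊤ ≤ c S ⊤ ℕ.+ c S ⊤ ℕ.+ S.#E
    lower = subst (λ m → S.#V ℕ.+ f S ⊤ ≤ c S ⊤ ℕ.+ c S ⊤ ℕ.+ m) (Subset.∣⊤∣≡n S.#E) (euler-≤ S ⊤)

  -- A colour of a face is recorded at each corner on its boundary, so colours of vertices and faces
  -- live on G without reference to the stellation.
  record FaceColouring (k : ℕ) : Set where
    field
      κ         : Fin #V → Fin k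
      τ         : Corner G → Fin k
      κ-proper  : ∀ e → κ (end (e , false)) ≢ κ (end (e , true))
      τ-proper  : ∀ x → κ (at G x) ≢ τ x
      τ-around  : ∀ h → τ (h , true) ≡ τ (Inverse.to next h , false)
      τ-across  : ∀ x → τ (partner (just (twisted (edge x))) x) ≡ τ x

  face-colouring : ∀ {k} → Colourable S k → FaceColouring k
  face-colouring (χ , proper) = record
    { κ        = χ ∘ vertex₊ ∘ inj₁
    ; τ        = λ x → χ (vertex₊ (inj₂ (Quotient.class Q x)))
    ; κ-proper = λ e → proper₊ (inj₁ e)
    ; τ-proper = λ x eq → proper₊ (inj₂ (angle x)) (trans (cong (χ ∘ vertex₊ ∘ inj₁) (end-angle x))
        (trans eq (cong (χ ∘ vertex₊ ∘ inj₂) (sym (class-angle x)))))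
    ; τ-around = λ h → cong (χ ∘ vertex₊ ∘ inj₂) (Quotient.sound Q (link (vertex-∈ h)))
    ; τ-across = λ x → cong (χ ∘ vertex₊ ∘ inj₂) (class-opp x)
    }
    where
    proper₊ : ∀ E → χ (vertex₊ (end₊ (E , false))) ≢ χ (vertex₊ (end₊ (E , true)))
    proper₊ E eq = proper (Inverse.from Edge₊↔ E)
        (trans (cong χ (edge-end E false)) (trans eq (cong χ (sym (edge-end E true)))))

-- Positivity and the equivalences

0<1 : 0ℚ < 1ℚ
0<1 = ℚ.positive⁻¹ 1ℚ

module _ {P : Set} {n} (t : Fin n → ℚ) (cases : ∀ i → t i ≡ 0ℚ ⊎ (t i ≡ 1ℚ × P)) where

  ∑-witness : ∑.sum t ≢ 0ℚ → P
  ∑-witness ≢0 with Fin.any? (λ i → ¬? (t i ℚ.≟ 0ℚ))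
  ... | no all-zero = ⊥-elim (≢0 (sum-zero ∑-monoid t λ i → zero-at i (cases i)))
    where
    zero-at : ∀ i → t i ≡ 0ℚ ⊎ (t i ≡ 1ℚ × P) → t i ≡ 0ℚ
    zero-at i (inj₁ eq) = eq
    zero-at i (inj₂ (eq , _)) = ⊥-elim (all-zero (i , λ eq′ → ℚ.<⇒≢ 0<1 (trans (sym eq′) eq)))
  ... | yes (i , neq) with cases i
  ...   | inj₁ eq      = ⊥-elim (neq eq)
  ...   | inj₂ (_ , p) = p

∑-nonneg : ∀ {n} (t : Fin n → ℚ) → (∀ i → 0ℚ ℚ.≤ t i) → 0ℚ ℚ.≤ ∑.sum t
∑-nonneg {zero}  t le = ℚ.≤-refl
∑-nonneg {suc n} t le = ℚ.+-mono-≤ (le zero) (∑-nonneg (t ∘ suc) (le ∘ suc))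

∑-positive : ∀ {n} (t : Fin n → ℚ) → (∀ i → 0ℚ ℚ.≤ t i) → ∀ i → 0ℚ < t i → 0ℚ < ∑.sum t
∑-positive t le zero    lt = ℚ.+-mono-<-≤ lt (∑-nonneg (t ∘ suc) (le ∘ suc))
∑-positive t le (suc i) lt = ℚ.+-mono-≤-< (le zero) (∑-positive (t ∘ suc) (le ∘ suc) i lt)

zero-one-nonneg : ∀ {P : Set} {q} → q ≡ 0ℚ ⊎ (q ≡ 1ℚ × P) → 0ℚ ℚ.≤ q
zero-one-nonneg (inj₁ refl)       = ℚ.≤-refl
zero-one-nonneg (inj₂ (refl , _)) = ℚ.<⇒≤ 0<1

*-positive : ∀ {p q} → 0ℚ < p → 0ℚ < q → 0ℚ < p * q
*-positive {p} {q} p>0 q>0 = ℚ.positive⁻¹ (p * q) {{ℚ.pos*pos⇒pos p {{ℚ.positive p>0}} q {{ℚ.positive q>0}}}}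

^-positive : ∀ q → 0ℚ < q → ∀ n → 0ℚ < q ^ n
^-positive q q>0 zero    = 0<1
^-positive q q>0 (suc n) = *-positive q>0 (^-positive q q>0 n)

agreement-cong : ∀ {X : Set} {k} {φ ψ : X → Fin k} → (∀ x → φ x ≡ ψ x) → ∀ es → agreement φ es ≡ agreement ψ es
agreement-cong eq []             = refl
agreement-cong eq ((x , y) ∷ es) = cong₂ _*_ (cong₂ (λ a b → 𝟙 (a Fin.≟ b)) (eq x) (eq y)) (agreement-cong eq es)

weight-cong : ∀ (G : RibbonGraph) {k} {φ ψ : Corner G → Fin k} → (∀ x → φ x ≡ ψ x) → weight G φ ≡ weight G ψ
weight-cong G eq = cong₂ _*_ (agreement-cong eq (vertexPieces G)) (∏.sum-cong-≗ λ e →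
  cong₂ _-_ (agreement-cong eq (kindPieces nothing e)) (agreement-cong eq (kindPieces (just (RibbonGraph.twisted G e)) e)))

-- Three colours are read as the nonzero elements of 𝔽₂², the possible sums of the colours of a
-- vertex and an incident face.
nonzero-bits : Fin 3 → Bool × Bool
nonzero-bits zero             = true , false
nonzero-bits (suc zero)       = false , true
nonzero-bits (suc (suc zero)) = true , true

nonzero-bits-injective : ∀ {a b} → nonzero-bits a ≡ nonzero-bits b → a ≡ b
nonzero-bits-injective {zero}           {zero}           _ = refl
nonzero-bits-injective {suc zero}       {suc zero}       _ = refl
nonzero-bits-injective {suc (suc zero)} {suc (suc zero)} _ = refl
nonzero-bits-injective {zero}           {suc zero}       ()
nonzero-bits-injective {zero}           {suc (suc zero)} ()
nonzero-bits-injective {suc zero}       {zero}           ()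
nonzero-bits-injective {suc zero}       {suc (suc zero)} ()
nonzero-bits-injective {suc (suc zero)} {zero}           ()
nonzero-bits-injective {suc (suc zero)} {suc zero}       ()

-- The sum of two distinct colours in 𝔽₂², a nonzero element (the value for
-- equal colours is irrelevant).
mix : Fin 4 → Fin 4 → Fin 3
mix i j = decode (proj₁ a xor proj₁ b) (proj₂ a xor proj₂ b)
  where
  a = Inverse.to Fin4↔ i
  b = Inverse.to Fin4↔ j
  decode : Bool → Bool → Fin 3
  decode false true  = suc zero
  decode true  true  = suc (suc zero)
  decode _     false = zero

-- If `s ≡ t`, the sums depend only on the vertex and the edge splits. If `s ≢ t`, then `u`, `v`,
-- `s`, `t` are all four elements of 𝔽₂², whose sum is zero, so u + s = v + t and u + t = v + s and
-- the edge crosses.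
mix-cases : ∀ u v s t → u ≢ v → u ≢ s → u ≢ t → v ≢ s → v ≢ t →
            (mix u s ≡ mix u t × mix v t ≡ mix v s × mix u s ≢ mix v t)
                ⊎ (mix u s ≡ mix v t × mix u t ≡ mix v s × mix u s ≢ mix u t)
mix-cases = from-yes (Fin.all? λ u → Fin.all? λ v → Fin.all? λ s → Fin.all? λ t →
  ¬? (u Fin.≟ v) →-dec (¬? (u Fin.≟ s) →-dec (¬? (u Fin.≟ t) →-dec (¬? (v Fin.≟ s) →-dec (¬? (v Fin.≟ t) →-dec
    ((mix u s Fin.≟ mix u t) ×-dec ((mix v t Fin.≟ mix v s) ×-dec ¬? (mix u s Fin.≟ mix v t))
     ⊎-dec (mix u s Fin.≟ mix v t) ×-dec ((mix u t Fin.≟ mix v s) ×-dec ¬? (mix u s Fin.≟ mix u t))))))))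

module _ (G : RibbonGraph) where
  open RibbonGraph G

  vertexPieces-respect : ∀ {k} {φ : Corner G → Fin k} → (∀ h → φ (h , true) ≡ φ (Inverse.to next h , false)) →
      Respects φ (vertexPieces G)
  vertexPieces-respect around m with ∈.∈-map⁻ (vertexPiece G) m
  ... | h , _ , refl = around h

  colouring-weight : Plane G → Colourable G 4 → ∃ λ (φ : Corner G → Fin 4) → weight (petrieDual G) φ ≡ 1ℚ
  colouring-weight plane (κ , proper) = φ , weight-one-of G plane (Inverse.to Fin4↔) Fin4-injective φ
      (vertexPieces-respect λ h → cong κ (sym (end-next G h)))
      λ e → edge-case-nonzero (edgeWeight-case G φ e) (inj₁ (refl , refl , proper e))
    where
    φ = κ ∘ at G

  face-colouring-weight : Plane G → FaceColouring G 4 → ∃ λ (φ : Corner G → Fin 3) → weight (petrieDual G) φ ≡ 1ℚ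
  face-colouring-weight plane F = φ , weight-one-of G plane nonzero-bits nonzero-bits-injective φ
      (vertexPieces-respect λ h → cong₂ mix (cong κ (sym (end-next G h))) (τ-around h))
      λ e → edge-case-nonzero (edgeWeight-case G φ e) (at-edge e)
    where
    open FaceColouring F
    φ : Corner G → Fin 3
    φ x = mix (κ (at G x)) (τ x)
    at-edge : ∀ e → let X = (e , false) , false ; Y = (e , false) , true ; X′ = across-edge G e X ; Y′ = across-edge G e Y in
              (φ X ≡ φ Y × φ X′ ≡ φ Y′ × φ X ≢ φ X′) ⊎ (φ X ≡ φ X′ × φ Y ≡ φ Y′ × φ X ≢ φ Y)
    at-edge e = subst₂ (λ s t → let u = κ (end (e , false)) ; v = κ (end (e , true)) in
        (φ X ≡ φ Y × mix v t ≡ mix v s × φ X ≢ mix v t) ⊎ (φ X ≡ mix v t × φ Y ≡ mix v s × φ X ≢ φ Y))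
        (sym Y′≡) (sym X′≡)
        (mix-cases (κ (end (e , false))) (κ (end (e , true))) (τ X) (τ Y) (κ-proper e) (τ-proper X) (τ-proper Y)
          (subst (κ (end (e , true)) ≢_) Y′≡ (τ-proper Y′)) (subst (κ (end (e , true)) ≢_) X′≡ (τ-proper X′)))
      where
      X Y X′ Y′ : Corner G
      X = (e , false) , false
      Y = (e , false) , true
      X′ = across-edge G e X
      Y′ = across-edge G e Y
      Y′≡ : τ Y′ ≡ τ X
      Y′≡ = trans (cong τ (sym (proj₁ (face-partners G e)))) (τ-across X)
      X′≡ : τ X′ ≡ τ Y
      X′≡ = trans (cong τ (sym (proj₂ (face-partners G e)))) (τ-across Y)

  four-colour-faces : FourColourTheorem → Plane G → Loopless G → FaceColouring G 4
  four-colour-faces fct plane loopless = by-size #E refl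
    where
    by-size : ∀ m → #E ≡ m → FaceColouring G 4
    -- An edgeless graph has no corners, so constants suffice; it is treated apart because
    -- `stellation-plane` asks for a half-edge.
    by-size zero eq = record
      { κ        = λ _ → zero
      ; τ        = λ _ → zero
      ; κ-proper = λ e → no-edge e
      ; τ-proper = λ x → no-edge (edge x)
      ; τ-around = λ _ → refl
      ; τ-across = λ _ → refl
      }
      where
      no-edge : ∀ {A : Set} → Fin #E → A
      no-edge e with () ← subst Fin eq e
    by-size (suc m) eq = face-colouring G
        (fct (stellation G) (stellation-plane G plane (subst Fin (sym eq) zero , false))
        (stellation-loopless G loopless))

  module _ (plane : Plane G) {k} (bits : Fin k → Bool × Bool) (bits-injective : ∀ {a b} → bits a ≡ bits b → a ≡ b) where

    private
      K = k ×ℚ 1ℚ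
      t : Fin (k ℕ.^ ((#E ℕ.* 2) ℕ.* 2)) → ℚ
      t i = weight (petrieDual G) (colouring (corners↔ (petrieDual G)) k i)
      cases : ∀ i → t i ≡ 0ℚ ⊎ (t i ≡ 1ℚ × Colourable G 4)
      cases i = weight-cases G plane bits bits-injective (colouring (corners↔ (petrieDual G)) k i)

    penrose-colourable : penrose (petrieDual G) K ≢ 0ℚ → Colourable G 4
    penrose-colourable ≢0 = ∑-witness t cases λ eq → ≢0 (trans (penrose-weights (petrieDual G) k)
      (trans (cong (K ^ bare (petrieDual G) *_) eq) (ℚ.*-zeroʳ (K ^ bare (petrieDual G)))))

    -- All weights are 0 or 1, so nothing can cancel the given colouring of weight 1.
    penrose-positive : 0ℚ < K → (∃ λ (φ : Corner G → Fin k) → weight (petrieDual G) φ ≡ 1ℚ) → 0ℚ < penrose (petrieDual G) K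
    penrose-positive K>0 (φ , one) = subst (0ℚ <_) (sym (penrose-weights (petrieDual G) k))
      (*-positive (^-positive K K>0 (bare (petrieDual G)))
          (∑-positive t (λ i → zero-one-nonneg (cases i)) i₀ (subst (0ℚ <_) (sym t₀) 0<1)))
      where
      found = colouring-surjective (corners↔ (petrieDual G)) k φ
      i₀ = proj₁ found
      t₀ : t i₀ ≡ 1ℚ
      t₀ = trans (weight-cong (petrieDual G) {k} {_} {φ} (proj₂ found)) one

  chromatic-sum : ℚ
  chromatic-sum = ∑⊆ #E λ A → (-1^ ∣ A ∣) * (ℤ.+ 4 / 1) ^ c G A

  chromatic-cases : ∀ i → let κ = finToFun {4} {#V} i in
    ∏.sum (λ e → 1ℚ - 𝟙 (κ (end (e , false)) Fin.≟ κ (end (e , true)))) ≡ 0ℚ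
    ⊎ (∏.sum (λ e → 1ℚ - 𝟙 (κ (end (e , false)) Fin.≟ κ (end (e , true)))) ≡ 1ℚ × Colourable G 4)
  chromatic-cases i with Fin.any? (λ e → finToFun {4} {#V} i (end (e , false)) Fin.≟ finToFun {4} {#V} i (end (e , true)))
  ... | yes (e , eq) = inj₁ (∏-zero _ e (cong (λ q → 1ℚ - q) (𝟙-yes (_ Fin.≟ _) eq)))
  ... | no proper    = inj₂ (properly , finToFun i , λ e eq → proper (e , eq))
    where
    properly : ∏.sum (λ e → 1ℚ - 𝟙 (finToFun {4} {#V} i (end (e , false)) Fin.≟ finToFun {4} {#V} i (end (e , true)))) ≡ 1ℚ
    properly = trans (∏.sum-cong-≗ λ e →
        cong (λ q → 1ℚ - q) (𝟙-no
        (finToFun {4} {#V} i (end (e , false)) Fin.≟ finToFun {4} {#V} i (end (e , true))) λ eq → proper (e , eq)))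
      (∏.sum-replicate-zero #E)

  chromatic-colourable : chromatic-sum ≢ 0ℚ → Colourable G 4
  chromatic-colourable ≢0 = ∑-witness _ chromatic-cases λ eq → ≢0 (trans (chromatic G 4) eq)

  colourable-chromatic : Colourable G 4 → 0ℚ < chromatic-sum
  colourable-chromatic (κ , proper) = subst (0ℚ <_) (sym (chromatic G 4))
      (∑-positive t (λ i → zero-one-nonneg (chromatic-cases i)) i₀ (positive (chromatic-cases i₀)))
    where
    t : Fin (4 ℕ.^ #V) → ℚ
    t i = ∏.sum (λ e → 1ℚ - 𝟙 (finToFun {4} {#V} i (end (e , false)) Fin.≟ finToFun {4} {#V} i (end (e , true))))
    i₀ : Fin (4 ℕ.^ #V)
    i₀ = funToFin κ
    t₀ : t i₀ ≡ 1ℚ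
    t₀ = trans (∏.sum-cong-≗ λ e →
        cong (λ q → 1ℚ - q) (𝟙-no (finToFun {4} {#V} i₀ (end (e , false)) Fin.≟ finToFun {4} {#V} i₀ (end (e , true)))
        λ eq → proper e (trans (sym (Fin.finToFun-funToFin κ (end (e , false))))
            (trans eq (Fin.finToFun-funToFin κ (end (e , true)))))))
      (∏.sum-replicate-zero #E)
    positive : t i₀ ≡ 0ℚ ⊎ (t i₀ ≡ 1ℚ × Colourable G 4) → 0ℚ < t i₀
    positive _ = subst (0ℚ <_) (sym t₀) 0<1

negative-value : ∀ s {l r p} → 0ℚ < l → s * (l * r) ≡ - p → 0ℚ < p → s * r < 0ℚ
negative-value s {l} {r} {p} l>0 eq p>0 = ℚ.*-cancelˡ-<-nonNeg l {{ℚ.pos⇒nonNeg l {{ℚ.positive l>0}}}}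
  (subst₂ _<_ (trans (sym eq) (swap s l r)) (sym (ℚ.*-zeroʳ l)) (ℚ.neg-antimono-< p>0))
  where
  open ℚ.+-*-Solver
  swap : ∀ s l r → s * (l * r) ≡ l * (s * r)
  swap = solve 3 (λ s l r → s :* (l :* r) := l :* (s :* r)) refl

nonzero-value : ∀ s {l z r p} → l * z ≡ 1ℚ → s * (l * r) ≡ - p → s * r ≢ 0ℚ → p ≢ 0ℚ
nonzero-value s {l} {z} {r} lz eq ≢0 refl = ≢0 (begin
  s * r                 ≡⟨ ℚ.*-identityˡ (s * r) ⟨
  1ℚ * (s * r)          ≡⟨ cong (_* (s * r)) lz ⟨
  (l * z) * (s * r)     ≡⟨ swap l z s r ⟩
  z * (s * (l * r))     ≡⟨ cong (z *_) eq ⟩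
  z * 0ℚ                ≡⟨ ℚ.*-zeroʳ z ⟩
  0ℚ                    ∎)
  where
  open ≡-Reasoning
  open ℚ.+-*-Solver
  swap : ∀ l z s r → (l * z) * (s * r) ≡ z * (s * (l * r))
  swap = solve 4 (λ l z s r → (l :* z) :* (s :* r) := z :* (s :* (l :* r))) refl

unit-cancel-zero : ∀ {u w p} → u * w ≡ 1ℚ → u * p ≡ 0ℚ → p ≡ 0ℚ
unit-cancel-zero {u} {w} {p} uw eq =
    trans (sym (ℚ.*-identityˡ p))
    (trans (cong (_* p) (sym uw)) (trans (swap u w p) (trans (cong (w *_) eq) (ℚ.*-zeroʳ w))))
  where
  open ℚ.+-*-Solver
  swap : ∀ u w p → (u * w) * p ≡ w * (u * p)
  swap = solve 3 (λ u w p → (u :* w) :* p := w :* (u :* p)) refl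

module _ {k} (bits : Fin k → Bool × Bool) (bits-injective : ∀ {a b} → bits a ≡ bits b → a ≡ b)
         (existence : FourColourTheorem → ∀ G → Plane G → Loopless G → ∃ λ (φ : Corner G → Fin k) →
             weight (petrieDual G) φ ≡ 1ℚ)
         x z (K>0 : 0ℚ < k ×ℚ 1ℚ) (x≡ : x - 1ℚ ≡ - (k ×ℚ 1ℚ)) (Kz : (k ×ℚ 1ℚ) * z ≡ 1ℚ) where

  -- By `R-penrose` the signed value of `R` is -P(k)/k, where P is the Penrose polynomial of the
  -- Petrie dual and k is positive.
  negative⇔4CT : FourColourTheorem ⇔ (∀ G → Connected G → Loopless G → Plane G →
    (- 1ℚ) ^ RibbonGraph.#V G * R (petrieDual G) x (- (k ×ℚ 1ℚ)) z < 0ℚ)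
  negative⇔4CT = mk⇔
    (λ fct G conn loopless plane →
        negative-value (-1^ RibbonGraph.#V G) {k ×ℚ 1ℚ} {R (petrieDual G) x (- (k ×ℚ 1ℚ)) z} K>0
        (R-penrose (petrieDual G) conn {x} {k ×ℚ 1ℚ} {z} x≡ Kz)
      (penrose-positive G plane bits bits-injective K>0 (existence fct G plane loopless)))
    (λ neg G plane loopless → penrose-colourable G plane bits bits-injective
      (nonzero-value (-1^ RibbonGraph.#V G) {k ×ℚ 1ℚ} {z} {R (petrieDual G) x (- (k ×ℚ 1ℚ)) z} Kz
          (R-penrose (petrieDual G) (proj₁ plane) {x} {k ×ℚ 1ℚ} {z} x≡ Kz)
        λ eq → ℚ.<-irrefl eq (neg G (proj₁ plane) loopless plane)))

open import Data.Integer.Base using (+_)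

theorem5p4 : (FourColourTheorem ⇔
    (∀ G → Connected G → Loopless G → Plane G →
    (- 1ℚ) ^ RibbonGraph.#V G * R (petrieDual G) (- (+ 2 / 1)) (- (+ 3 / 1)) (+ 1 / 3) < 0ℚ))
    × (FourColourTheorem ⇔
    (∀ G → Connected G → Loopless G → Plane G →
    (- 1ℚ) ^ RibbonGraph.#V G * R (petrieDual G) (- (+ 3 / 1)) (- (+ 4 / 1)) (+ 1 / 4) < 0ℚ))
    × (FourColourTheorem ⇔
    (∀ G → Connected G → Loopless G → Plane G →
    R (petrieDual G) (+ 3 / 1) (+ 2 / 1) (- (+ 1 / 2)) ≢ 0ℚ))
theorem5p4 =
    negative⇔4CT nonzero-bits nonzero-bits-injective
      (λ fct G plane loopless → face-colouring-weight G plane (four-colour-faces G fct plane loopless))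
          (- (+ 2 / 1)) (+ 1 / 3) (ℚ.positive⁻¹ (+ 3 / 1)) refl refl
  , negative⇔4CT (Inverse.to Fin4↔) Fin4-injective
      (λ fct G plane loopless → colouring-weight G plane (fct G plane loopless)) (- (+ 3 / 1)) (+ 1 / 4)
          (ℚ.positive⁻¹ (+ 4 / 1)) refl refl
  , mk⇔ nonvanishing colourable
  where
  R× : RibbonGraph → ℚ
  R× G = R (petrieDual G) (+ 3 / 1) (+ 2 / 1) (- (+ 1 / 2))
  value : ∀ G → Connected G → (-1^ RibbonGraph.#V G) * (-2ℚ * R× G) ≡ - penrose (petrieDual G) -2ℚ
  -- The evaluation point has l = -2: both 3 - 1 and the second argument are - l, and -1/2 is the
  -- inverse of l.
  value G conn = R-penrose (petrieDual G) conn {+ 3 / 1} { -2ℚ} { - (+ 1 / 2)} refl refl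
  -- By `value` and `penrose-chromatic`, `R× G` is a nonzero multiple of the number of proper
  -- 4-colourings.
  nonvanishing : FourColourTheorem → ∀ G → Connected G → Loopless G → Plane G → R× G ≢ 0ℚ
  nonvanishing fct G conn loopless plane R≡0 = ℚ.<⇒≢ (colourable-chromatic G (fct G plane loopless)) (sym
    (unit-cancel-zero {2ℚ ^ #E} {(+ 1 / 2) ^ #E} (inverse-^ {2ℚ} refl #E) (trans (sym (penrose-chromatic G plane))
      (trans (cong (-2ℚ ^ #V *_) penrose≡0) (ℚ.*-zeroʳ (-2ℚ ^ #V))))))
    where
    open RibbonGraph G
    penrose≡0 : penrose (petrieDual G) -2ℚ ≡ 0ℚ
    penrose≡0 = trans (sym (neg-neg _)) (cong -_ (trans (sym (value G conn))
      (trans (cong (λ r → (-1^ #V) * (-2ℚ * r)) R≡0) (ℚ.*-zeroʳ (-1^ #V)))))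
      where
      open ℚ.+-*-Solver
      neg-neg : ∀ p → - (- p) ≡ p
      neg-neg = solve 1 (λ p → :- (:- p) := p) refl
  colourable : (∀ G → Connected G → Loopless G → Plane G → R× G ≢ 0ℚ) → FourColourTheorem
  colourable R≢0 G plane@(conn , _) loopless = chromatic-colourable G λ χ≡0 → R≢0 G conn loopless plane
    -- Three units are removed by explicit inverses: -2, then (-1)^v, which is its own inverse, and
    -- (-2)^v inside.
    (unit-cancel-zero { -2ℚ} { - (+ 1 / 2)} refl (unit-cancel-zero { -1^ #V} { -1^ #V} (inverse-^ { - 1ℚ} refl #V) (trans (value G conn)
      (cong -_ (unit-cancel-zero { -2ℚ ^ #V} {(- (+ 1 / 2)) ^ #V} (inverse-^ { -2ℚ} refl #V)
        (trans (penrose-chromatic G plane) (trans (cong (2ℚ ^ #E *_) χ≡0) (ℚ.*-zeroʳ (2ℚ ^ #E)))))))))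
    where open RibbonGraph G
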